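{- Let $n$ be a positive integer and $r,s$ non-negative integers. Then, modulo $[2n+1]{2n\brack n}$, \begin{align*} &\sum_{k=0}^{n}q^{ -(2r+1)k}[2k+1]^{2r+1} {2n+1\brack n-k}(q^{ -k};q)_s (q^{k+1};q)_s \equiv 0, \\ &\sum_{k=0}^{n}q^{k^2-2rk}[2k+1]^{2r+1} {2n+1\brack n-k}(q^{ -k};q)_s (q^{k+1};q)_s \equiv 0, \\ &\sum_{k=0}^{n}(-1)^k q^{{k\choose 2}-2rk}[2k+1]^{2r+1} {2n+1\brack n-k}(q^{ -k};q)_s (q^{k+1};q)_s \equiv 0, \\ &\sum_{k=0}^{n}(-1)^k q^{\frac{3k^2+k}{2}-2rk}[2k+1]^{2r+1} {2n+1\brack n-k}(q^{ -k};q)_s (q^{k+1};q)_s \equiv 0. \end{align*}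
   Context: For a non-negative integer $n$, $[n]=1+q+\cdots+q^{n-1}$. The $q$-binomial coefficient is ${n\brack k}=\prod_{i=1}^k\frac{1-q^{n-i+1}}{1-q^i}$ if $k\geqslant 0$ and ${n\brack k}=0$ if $k<0$. The $q$-shifted factorial is $(a;q)_0=1$ and $(a;q)_n=(1-a)(1-aq)\cdots(1-aq^{n-1})$ for $n\geqslant 1$. For a polynomial $D$ in $q$ and Laurent polynomials $A,B$ in $q$, $A\equiv B \bmod D$ means that $(A-B)/D$ is a Laurent polynomial in $q$. -}

module Defs where

open import Data.Nat as ℕ using (ℕ; zero; suc)
open import Data.Nat.DivMod as ℕD using ()
open import Data.Nat.Combinatorics using (_C_)
open import Data.Integer as ℤ using (ℤ; +_; -[1+_])
open import Data.List using (List; []; _∷_; map; replicate; _++_)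
open import Data.Product using (Σ; _×_)
open import Relation.Binary.PropositionalEquality using (_≡_)

-- Polynomials in q with integer coefficients: coefficient lists,
-- the i-th entry being the coefficient of q^i.

Poly : Set
Poly = List ℤ

coeff : Poly → ℕ → ℤ
coeff []      _       = + 0
coeff (a ∷ p) zero    = a
coeff (a ∷ p) (suc i) = coeff p i

_+P_ : Poly → Poly → Poly
[]      +P q       = q
(a ∷ p) +P []      = a ∷ p
(a ∷ p) +P (b ∷ q) = (a ℤ.+ b) ∷ (p +P q)

_*P_ : Poly → Poly → Poly
[]      *P q = []
(a ∷ p) *P q = map (a ℤ.*_) q +P (+ 0 ∷ (p *P q))

shiftP : ℕ → Poly → Poly
shiftP m p = replicate m (+ 0) ++ p

-- equality of polynomials: all coefficients agree (trailing zeros ignored)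
_≈P_ : Poly → Poly → Set
p ≈P q = ∀ i → coeff p i ≡ coeff q i

-- Laurent polynomials in q with integer coefficients:
-- ⟨ m , p ⟩ stands for q^(-m) · p(q).

record LPoly : Set where
  constructor ⟨_,_⟩
  field
    low  : ℕ
    body : Poly
open LPoly public

poly : Poly → LPoly
poly p = ⟨ 0 , p ⟩

const : ℤ → LPoly
const c = poly (c ∷ [])

0L 1L : LPoly
0L = const (+ 0)
1L = const (+ 1)

_+L_ : LPoly → LPoly → LPoly
⟨ m , p ⟩ +L ⟨ m' , p' ⟩ = ⟨ m ℕ.+ m' , shiftP m' p +P shiftP m p' ⟩

_*L_ : LPoly → LPoly → LPoly
⟨ m , p ⟩ *L ⟨ m' , p' ⟩ = ⟨ m ℕ.+ m' , p *P p' ⟩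

-L_ : LPoly → LPoly
-L ⟨ m , p ⟩ = ⟨ m , map ℤ.-_ p ⟩

_-L_ : LPoly → LPoly → LPoly
a -L b = a +L (-L b)

q^ : ℤ → LPoly
q^ (+ n)     = ⟨ 0 , shiftP n (+ 1 ∷ []) ⟩
q^ -[1+ n ]  = ⟨ suc n , + 1 ∷ [] ⟩

_^L_ : LPoly → ℕ → LPoly
a ^L zero  = 1L
a ^L suc n = (a ^L n) *L a

_≈L_ : LPoly → LPoly → Set
⟨ m , p ⟩ ≈L ⟨ m' , p' ⟩ = shiftP m' p ≈P shiftP m p'

-- A ≡ B (mod D): (A - B)/D is a Laurent polynomial in q
_≡_[mod_] : LPoly → LPoly → LPoly → Set
A ≡ B [mod D ] = Σ LPoly (λ C → (A -L B) ≈L (C *L D))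

[_]q : ℕ → LPoly
[ n ]q = poly (replicate n (+ 1))

qbinomP : ℕ → ℕ → Poly
qbinomP zero    zero    = + 1 ∷ []
qbinomP zero    (suc k) = []
qbinomP (suc n) zero    = + 1 ∷ []
qbinomP (suc n) (suc k) = qbinomP n k +P shiftP (suc k) (qbinomP n (suc k))

qbinom : ℕ → ℕ → LPoly
qbinom n k = poly (qbinomP n k)

qpoch : LPoly → ℕ → LPoly
qpoch a zero    = 1L
qpoch a (suc s) = qpoch a s *L (1L -L (a *L q^ (+ s)))

sumTo : ℕ → (ℕ → LPoly) → LPoly
sumTo zero    f = f 0
sumTo (suc n) f = sumTo n f +L f (suc n)

modulus : ℕ → LPoly
modulus n = [ 2 ℕ.* n ℕ.+ 1 ]q *L qbinom (2 ℕ.* n) n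

common : ℕ → ℕ → ℕ → ℕ → LPoly
common n r s k =
  ([ 2 ℕ.* k ℕ.+ 1 ]q ^L (2 ℕ.* r ℕ.+ 1))
  *L (qbinom (2 ℕ.* n ℕ.+ 1) (n ℕ.∸ k)
  *L (qpoch (q^ (ℤ.- (+ k))) s *L qpoch (q^ (+ (k ℕ.+ 1))) s))

sign : ℕ → LPoly
sign k = const ((ℤ.- (+ 1)) ℤ.^ k)

e₁ e₂ e₃ e₄ : ℕ → ℕ → ℤ
e₁ r k = ℤ.- (+ ((2 ℕ.* r ℕ.+ 1) ℕ.* k))
e₂ r k = + (k ℕ.* k) ℤ.- + (2 ℕ.* r ℕ.* k)
e₃ r k = + (k C 2) ℤ.- + (2 ℕ.* r ℕ.* k)
e₄ r k = + ((3 ℕ.* k ℕ.* k ℕ.+ k) ℕD./ 2) ℤ.- + (2 ℕ.* r ℕ.* k)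

S₁ S₂ S₃ S₄ : ℕ → ℕ → ℕ → LPoly
S₁ n r s = sumTo n (λ k → q^ (e₁ r k) *L common n r s k)
S₂ n r s = sumTo n (λ k → q^ (e₂ r k) *L common n r s k)
S₃ n r s = sumTo n (λ k → sign k *L (q^ (e₃ r k) *L common n r s k))
S₄ n r s = sumTo n (λ k → sign k *L (q^ (e₄ r k) *L common n r s k))

-- Put ĝ k = q^(-k)[2k+1], ĥ k = q^(-k)[k][k+1] and Bin n k = [2n+1,n-k].  Pulling
-- powers of q out of the exponents, the k-th summand of S_i becomes
--   w_i k · ĝ k · Bin n k · ĝ(k)^(2r) (q^(-k);q)_s (q^(k+1);q)_s
-- with weights w₁ = 1, w₂ = q^(k²+k), w₃ = (-1)^k q^(k(k+1)/2), w₄ = w₃ w₂.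
-- Call f w-divisible if Σ_{k≤n} w k ĝ k Bin n k f k is a multiple of Mod n for all n.
--  * Since ĥ k Bin (m+1) k = ĥ (m+1) Bin (m+1) k - q^(-m-1)[2m+2][2m+3] Bin m k,
--    w-divisibility of 1 propagates to Kprod j k = Π_{i<j} q^i (ĥ i - ĥ k) and then
--    to every ĥ-polynomial multiple of Kprod j.
--  * ĝ k² = 1 + 2(1+q) ĥ k + (1-q)² ĥ k² and (q^(-k);q)_s (q^(k+1);q)_s = (1-q)^(2s)
--    Kprod s k, so the whole factor ĝ^(2r) · (Pochhammers) is w-divisible.
--  * 1 is w-divisible for the four weights: by telescoping for w₁, w₂, w₃, and for w₄
--    through a q-Chu-Vandermonde expansion of w₃ and a closed form for Kprod.
module Submission where

open import Defs
open import Data.Nat using (ℕ; _≤_)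
open import Data.Product using (_×_; _,_)

-- Polynomials as integer coefficient lists: ring laws up to coefficientwise equality.
module PolyArith where

  open import Data.Nat as ℕ using (ℕ; zero; suc)
  open import Data.Integer as ℤ using (ℤ; +_)
  import Data.Integer.Properties as ℤP
  import Data.Nat.Properties as ℕP
  open import Data.Integer.Tactic.RingSolver using (solve-∀)
  open import Data.List using ([]; _∷_; map)
  open import Relation.Binary.PropositionalEquality

  infix 4 _≈_
  -- Coefficientwise equality of coefficient lists (trailing zeros are invisible),
  -- wrapped in a record so that Agda can infer the two lists from the proofs.
  record _≈_ (p q : Poly) : Set where
    constructor mk
    field get : p ≈P q
  open _≈_ public

  ≈refl : ∀ {p} → p ≈ p
  ≈refl = mk λ i → refl

  ≈sym : ∀ {p q} → p ≈ q → q ≈ p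
  ≈sym h = mk λ i → sym (get h i)

  ≈trans : ∀ {p q r} → p ≈ q → q ≈ r → p ≈ r
  ≈trans h g = mk λ i → trans (get h i) (get g i)

  coeffX : (ℕ → ℤ) → ℕ → ℤ
  coeffX f zero = + 0
  coeffX f (suc i) = f i

  coeff-cons0 : ∀ p i → coeff (+ 0 ∷ p) i ≡ coeffX (coeff p) i
  coeff-cons0 p zero = refl
  coeff-cons0 p (suc i) = refl

  coeff-+ : ∀ p q i → coeff (p +P q) i ≡ coeff p i ℤ.+ coeff q i
  coeff-+ [] q i = sym (ℤP.+-identityˡ _)
  coeff-+ (a ∷ p) [] i = sym (ℤP.+-identityʳ _)
  coeff-+ (a ∷ p) (b ∷ q) zero = refl
  coeff-+ (a ∷ p) (b ∷ q) (suc i) = coeff-+ p q i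

  coeff-map : ∀ a p i → coeff (map (a ℤ.*_) p) i ≡ a ℤ.* coeff p i
  coeff-map a [] i = sym (ℤP.*-zeroʳ a)
  coeff-map a (b ∷ p) zero = refl
  coeff-map a (b ∷ p) (suc i) = coeff-map a p i

  coeff-neg : ∀ p i → coeff (map ℤ.-_ p) i ≡ ℤ.- coeff p i
  coeff-neg [] i = refl
  coeff-neg (b ∷ p) zero = refl
  coeff-neg (b ∷ p) (suc i) = coeff-neg p i

  coeff-* : ∀ a p q i → coeff ((a ∷ p) *P q) i ≡ a ℤ.* coeff q i ℤ.+ coeffX (coeff (p *P q)) i
  coeff-* a p q i = trans (coeff-+ (map (a ℤ.*_) q) (+ 0 ∷ (p *P q)) i)
    (cong₂ ℤ._+_ (coeff-map a q i) (coeff-cons0 (p *P q) i))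

  +P-cong : ∀ {p p' q q'} → p ≈ p' → q ≈ q' → p +P q ≈ p' +P q'
  +P-cong {p} {p'} {q} {q'} h g = mk λ i →
    trans (coeff-+ p q i) (trans (cong₂ ℤ._+_ (get h i) (get g i)) (sym (coeff-+ p' q' i)))

  +P-comm : ∀ p q → p +P q ≈ q +P p
  +P-comm p q = mk λ i → trans (coeff-+ p q i) (trans (ℤP.+-comm (coeff p i) _) (sym (coeff-+ q p i)))

  +P-assoc : ∀ p q r → (p +P q) +P r ≈ p +P (q +P r)
  +P-assoc p q r = mk λ i →
    trans (coeff-+ (p +P q) r i) (trans (cong (ℤ._+ coeff r i) (coeff-+ p q i))
    (trans (ℤP.+-assoc (coeff p i) _ _)
    (trans (cong (λ zz → coeff p i ℤ.+ zz) (sym (coeff-+ q r i))) (sym (coeff-+ p (q +P r) i)))))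

  +P-idʳ : ∀ p → p +P [] ≈ p
  +P-idʳ p = mk λ i → trans (coeff-+ p [] i) (ℤP.+-identityʳ _)

  +P-inv : ∀ p → p +P map ℤ.-_ p ≈ []
  +P-inv p = mk λ i → trans (coeff-+ p _ i) (trans (cong (λ zz → coeff p i ℤ.+ zz) (coeff-neg p i)) (ℤP.+-inverseʳ (coeff p i)))

  neg-cong : ∀ {p q} → p ≈ q → map ℤ.-_ p ≈ map ℤ.-_ q
  neg-cong {p} {q} h = mk λ i → trans (coeff-neg p i) (trans (cong ℤ.-_ (get h i)) (sym (coeff-neg q i)))

  cons-cong : ∀ {a b p q} → a ≡ b → p ≈ q → (a ∷ p) ≈ (b ∷ q)
  cons-cong e h = mk λ { zero → e ; (suc i) → get h i }

  coeffX-cong : ∀ {f g} → (∀ i → f i ≡ g i) → ∀ i → coeffX f i ≡ coeffX g i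
  coeffX-cong h zero = refl
  coeffX-cong h (suc i) = h i

  coeffX-zero : ∀ i → coeffX (λ _ → + 0) i ≡ + 0
  coeffX-zero zero = refl
  coeffX-zero (suc i) = refl

  -- Multiplication respects _≈_ (a zero polynomial may be a list of zeros).
  *P-zeroL : ∀ p q → p ≈ [] → p *P q ≈ []
  *P-zeroL [] q h = ≈refl
  *P-zeroL (a ∷ p) q h = mk λ i → trans (coeff-* a p q i)
    (cong₂ ℤ._+_ (trans (cong (ℤ._* coeff q i) (get h 0)) (ℤP.*-zeroˡ (coeff q i)))
                 (trans (coeffX-cong (get (*P-zeroL p q (mk λ j → get h (suc j)))) i) (coeffX-zero i)))

  *P-congˡ : ∀ {p p'} q → p ≈ p' → p *P q ≈ p' *P q
  *P-congˡ {[]} {[]} q h = ≈refl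
  *P-congˡ {[]} {b ∷ p'} q h = ≈sym (*P-zeroL (b ∷ p') q (≈sym h))
  *P-congˡ {a ∷ p} {[]} q h = *P-zeroL (a ∷ p) q h
  *P-congˡ {a ∷ p} {b ∷ p'} q h = mk λ i →
    trans (coeff-* a p q i) (trans (cong₂ ℤ._+_ (cong (ℤ._* coeff q i) (get h 0))
       (coeffX-cong (get (*P-congˡ {p} {p'} q (mk λ j → get h (suc j)))) i)) (sym (coeff-* b p' q i)))

  *P-congʳ : ∀ p {q q'} → q ≈ q' → p *P q ≈ p *P q'
  *P-congʳ [] h = ≈refl
  *P-congʳ (a ∷ p) {q} {q'} h = mk λ i →
    trans (coeff-* a p q i) (trans (cong₂ ℤ._+_ (cong (a ℤ.*_) (get h i))
       (coeffX-cong (get (*P-congʳ p h)) i)) (sym (coeff-* a p q' i)))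

  *P-cong : ∀ {p p' q q'} → p ≈ p' → q ≈ q' → p *P q ≈ p' *P q'
  *P-cong {p} {p'} {q} {q'} h g = ≈trans (*P-congˡ q h) (*P-congʳ p' g)

  private
    dl : ∀ (a b x y z : ℤ) → (a ℤ.+ b) ℤ.* x ℤ.+ (y ℤ.+ z) ≡ (a ℤ.* x ℤ.+ y) ℤ.+ (b ℤ.* x ℤ.+ z)
    dl = solve-∀

  swap3 : ∀ x y z → x ℤ.+ (y ℤ.+ z) ≡ y ℤ.+ (x ℤ.+ z)
  swap3 = solve-∀

  coeffX-+ : ∀ f g i → coeffX (λ j → f j ℤ.+ g j) i ≡ coeffX f i ℤ.+ coeffX g i
  coeffX-+ f g zero = refl
  coeffX-+ f g (suc i) = refl

  *P-distribʳ : ∀ p q r → (p +P q) *P r ≈ (p *P r) +P (q *P r)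
  *P-distribʳ [] q r = ≈refl
  *P-distribʳ (a ∷ p) [] r = ≈sym (+P-idʳ _)
  *P-distribʳ (a ∷ p) (b ∷ q) r = mk λ i →
    trans (coeff-* (a ℤ.+ b) (p +P q) r i)
    (trans (cong (λ zz → (a ℤ.+ b) ℤ.* coeff r i ℤ.+ zz)
       (trans (coeffX-cong (λ j → trans (get (*P-distribʳ p q r) j) (coeff-+ (p *P r) (q *P r) j)) i)
              (coeffX-+ (coeff (p *P r)) (coeff (q *P r)) i)))
    (trans (dl a b (coeff r i) _ _)
    (trans (cong₂ ℤ._+_ (sym (coeff-* a p r i)) (sym (coeff-* b q r i)))
    (sym (coeff-+ ((a ∷ p) *P r) ((b ∷ q) *P r) i)))))

  *P-nilʳ : ∀ p → p *P [] ≈ []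
  *P-nilʳ [] = ≈refl
  *P-nilʳ (a ∷ p) = mk λ i → trans (coeff-* a p [] i) (trans (cong₂ ℤ._+_ (ℤP.*-zeroʳ a)
    (coeffX-cong (get (*P-nilʳ p)) i)) (trans (ℤP.+-identityˡ _) (coeffX-zero i)))

  *P-consʳ : ∀ p b q → p *P (b ∷ q) ≈ map (b ℤ.*_) p +P (+ 0 ∷ (p *P q))
  *P-consʳ [] b q = mk λ { zero → refl ; (suc i) → refl }
  *P-consʳ (a ∷ p) b q = mk λ
    { zero → trans (coeff-* a p (b ∷ q) 0)
        (trans (ℤP.+-identityʳ _) (trans (ℤP.*-comm a b) (sym (trans (coeff-+ (map (b ℤ.*_) (a ∷ p)) (+ 0 ∷ ((a ∷ p) *P q)) 0) (ℤP.+-identityʳ _)))))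
    ; (suc i) →
        trans (coeff-* a p (b ∷ q) (suc i))
        (trans (cong (λ zz → a ℤ.* coeff q i ℤ.+ zz) (trans (get (*P-consʳ p b q) i)
           (trans (coeff-+ (map (b ℤ.*_) p) _ i) (cong₂ ℤ._+_ (coeff-map b p i) (coeff-cons0 _ i)))))
        (trans (swap3 (a ℤ.* coeff q i) (b ℤ.* coeff p i) (coeffX (coeff (p *P q)) i))
        (sym (trans (coeff-+ (map (b ℤ.*_) (a ∷ p)) (+ 0 ∷ ((a ∷ p) *P q)) (suc i))
           (cong₂ ℤ._+_ (coeff-map b p i) (coeff-* a p q i))))))
    }

  *P-comm : ∀ p q → p *P q ≈ q *P p
  *P-comm [] q = ≈sym (*P-nilʳ q)
  *P-comm (a ∷ p) q = ≈trans (+P-cong (≈refl {map (a ℤ.*_) q}) (cons-cong refl (*P-comm p q)))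
                             (≈sym (*P-consʳ q a p))

  map-+ : ∀ a p q → map (a ℤ.*_) (p +P q) ≈ map (a ℤ.*_) p +P map (a ℤ.*_) q
  map-+ a p q = mk λ i → trans (coeff-map a (p +P q) i) (trans (cong (a ℤ.*_) (coeff-+ p q i))
    (trans (ℤP.*-distribˡ-+ a (coeff p i) (coeff q i))
    (sym (trans (coeff-+ (map (a ℤ.*_) p) _ i) (cong₂ ℤ._+_ (coeff-map a p i) (coeff-map a q i))))))

  map-map : ∀ a b p → map (a ℤ.*_) (map (b ℤ.*_) p) ≈ map ((a ℤ.* b) ℤ.*_) p
  map-map a b p = mk λ i → trans (coeff-map a (map (b ℤ.*_) p) i) (trans (cong (a ℤ.*_) (coeff-map b p i))
    (trans (sym (ℤP.*-assoc a b (coeff p i))) (sym (coeff-map (a ℤ.* b) p i))))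

  map-cons0 : ∀ a p → map (a ℤ.*_) (+ 0 ∷ p) ≈ (+ 0 ∷ map (a ℤ.*_) p)
  map-cons0 a p = cons-cong (ℤP.*-zeroʳ a) ≈refl

  cons0-* : ∀ s r → (+ 0 ∷ s) *P r ≈ (+ 0 ∷ (s *P r))
  cons0-* s r = mk λ i → trans (coeff-* (+ 0) s r i) (trans (ℤP.+-identityˡ _) (sym (coeff-cons0 _ i)))

  map-* : ∀ a q r → map (a ℤ.*_) q *P r ≈ map (a ℤ.*_) (q *P r)
  map-* a [] r = ≈refl
  map-* a (b ∷ q) r =
    ≈trans (+P-cong (≈sym (map-map a b r)) (cons-cong refl (map-* a q r)))
    (≈trans (+P-cong ≈refl (≈sym (map-cons0 a (q *P r)))) (≈sym (map-+ a (map (b ℤ.*_) r) (+ 0 ∷ (q *P r)))))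

  *P-assoc : ∀ p q r → (p *P q) *P r ≈ p *P (q *P r)
  *P-assoc [] q r = ≈refl
  *P-assoc (a ∷ p) q r =
    ≈trans (*P-distribʳ (map (a ℤ.*_) q) (+ 0 ∷ (p *P q)) r)
    (+P-cong (map-* a q r) (≈trans (cons0-* (p *P q) r) (cons-cong refl (*P-assoc p q r))))

  *P-oneˡ : ∀ q → (+ 1 ∷ []) *P q ≈ q
  *P-oneˡ q = mk λ i → trans (coeff-* (+ 1) [] q i) (trans (cong₂ ℤ._+_ (ℤP.*-identityˡ (coeff q i)) (coeffX-zero i)) (ℤP.+-identityʳ _))

  *P-distribˡ : ∀ p q r → p *P (q +P r) ≈ (p *P q) +P (p *P r)
  *P-distribˡ p q r = ≈trans (*P-comm p (q +P r)) (≈trans (*P-distribʳ q r p) (+P-cong (*P-comm q p) (*P-comm r p)))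

  shift-add : ∀ m n p → shiftP (m ℕ.+ n) p ≡ shiftP m (shiftP n p)
  shift-add zero n p = refl
  shift-add (suc m) n p = cong (+ 0 ∷_) (shift-add m n p)

  shift-cong : ∀ m {p q} → p ≈ q → shiftP m p ≈ shiftP m q
  shift-cong zero h = h
  shift-cong (suc m) h = cons-cong refl (shift-cong m h)

  shift-cancel : ∀ m {p q} → shiftP m p ≈ shiftP m q → p ≈ q
  shift-cancel zero h = h
  shift-cancel (suc m) h = shift-cancel m (mk λ i → get h (suc i))

  shift-+ : ∀ m p q → shiftP m (p +P q) ≈ shiftP m p +P shiftP m q
  shift-+ zero p q = ≈refl
  shift-+ (suc m) p q = cons-cong refl (shift-+ m p q)

  shift-*ˡ : ∀ m p q → shiftP m p *P q ≈ shiftP m (p *P q)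
  shift-*ˡ zero p q = ≈refl
  shift-*ˡ (suc m) p q = ≈trans (cons0-* (shiftP m p) q) (cons-cong refl (shift-*ˡ m p q))

  shift-*ʳ : ∀ m p q → p *P shiftP m q ≈ shiftP m (p *P q)
  shift-*ʳ m p q = ≈trans (*P-comm p (shiftP m q)) (≈trans (shift-*ˡ m q p) (shift-cong m (*P-comm q p)))

  shift-neg : ∀ m p → map ℤ.-_ (shiftP m p) ≡ shiftP m (map ℤ.-_ p)
  shift-neg zero p = refl
  shift-neg (suc m) p = cong (+ 0 ∷_) (shift-neg m p)

  shift-comm : ∀ m n p → shiftP m (shiftP n p) ≡ shiftP n (shiftP m p)
  shift-comm m n p = trans (sym (shift-add m n p)) (trans (cong (λ e → shiftP e p) (ℕP.+-comm m n)) (shift-add n m p))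

  shiftEq : ∀ {a b} p → a ≡ b → shiftP a p ≈ shiftP b p
  shiftEq p refl = ≈refl

  ≡⇒≈ : ∀ {p q} → p ≡ q → p ≈ q
  ≡⇒≈ refl = ≈refl

  nil-zeros : ∀ m → shiftP m (+ 0 ∷ []) ≈ []
  nil-zeros zero = mk λ { zero → refl ; (suc i) → refl }
  nil-zeros (suc m) = mk λ { zero → refl ; (suc i) → get (nil-zeros m) i }

  zero1 : (+ 0 ∷ []) ≈ []
  zero1 = nil-zeros 0

-- Laurent polynomials ⟨ m , p ⟩ = q^(-m) p form a commutative ring up to _≃_.
module LaurentRing where

  open PolyArith
  open import Data.Nat as ℕ using (ℕ; zero; suc)
  open import Data.Integer using (+_)
  import Data.Nat.Properties as ℕP
  import Data.Nat.Tactic.RingSolver as NS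
  open import Data.List using ([])
  open import Relation.Binary.PropositionalEquality

  infix 4 _≃_
  record _≃_ (a b : LPoly) : Set where
    constructor mkL
    field getL : shiftP (low b) (body a) ≈ shiftP (low a) (body b)
  open _≃_ public

  -- It is an equivalence relation; transitivity cancels the middle denominator.
  ≃refl : ∀ {a} → a ≃ a
  ≃refl = mkL ≈refl

  ≃sym : ∀ {a b} → a ≃ b → b ≃ a
  ≃sym h = mkL (≈sym (getL h))

  ≃trans : ∀ {a b c} → a ≃ b → b ≃ c → a ≃ c
  ≃trans {⟨ m , p ⟩} {⟨ m' , p' ⟩} {⟨ m'' , p'' ⟩} (mkL h) (mkL g) = mkL (shift-cancel m'
    (≈trans (≡⇒≈ (shift-comm m' m'' p)) (≈trans (shift-cong m'' h)
    (≈trans (≡⇒≈ (shift-comm m'' m p')) (≈trans (shift-cong m g) (≡⇒≈ (shift-comm m m' p'')))))))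

  ≃body : ∀ {m p q} → p ≈ q → ⟨ m , p ⟩ ≃ ⟨ m , q ⟩
  ≃body {m} h = mkL (shift-cong m h)

  ≃low : ∀ {m n p} → m ≡ n → ⟨ m , p ⟩ ≃ ⟨ n , p ⟩
  ≃low refl = ≃refl

  shift-merge : ∀ a b p → shiftP a (shiftP b p) ≡ shiftP (a ℕ.+ b) p
  shift-merge a b p = sym (shift-add a b p)

  +L-comm : ∀ a b → a +L b ≃ b +L a
  +L-comm ⟨ m , p ⟩ ⟨ n , r ⟩ = mkL (≈trans (shiftEq _ (ℕP.+-comm n m)) (shift-cong (m ℕ.+ n) (+P-comm (shiftP n p) (shiftP m r))))

  +L-assoc : ∀ a b c → (a +L b) +L c ≃ a +L (b +L c)
  +L-assoc ⟨ m , p ⟩ ⟨ n , r ⟩ ⟨ k , s ⟩ = ≃trans (≃body lhs) (≃trans (≃low (ℕP.+-assoc m n k)) (≃body (≈sym rhs)))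
    where
    X : Poly
    X = shiftP (n ℕ.+ k) p
    Y : Poly
    Y = shiftP (m ℕ.+ k) r
    Z : Poly
    Z = shiftP (m ℕ.+ n) s
    lhs : (shiftP k (shiftP n p +P shiftP m r) +P shiftP (m ℕ.+ n) s) ≈ (X +P (Y +P Z))
    lhs = ≈trans (+P-cong (shift-+ k (shiftP n p) (shiftP m r)) ≈refl) (≈trans (+P-assoc (shiftP k (shiftP n p)) (shiftP k (shiftP m r)) Z)
           (+P-cong (≈trans (≡⇒≈ (shift-merge k n p)) (shiftEq p (ℕP.+-comm k n)))
             (+P-cong (≈trans (≡⇒≈ (shift-merge k m r)) (shiftEq r (ℕP.+-comm k m))) ≈refl)))
    rhs : (shiftP (n ℕ.+ k) p +P shiftP m (shiftP k r +P shiftP n s)) ≈ (X +P (Y +P Z))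
    rhs = +P-cong ≈refl (≈trans (shift-+ m _ _) (+P-cong (≡⇒≈ (shift-merge m k r)) (≡⇒≈ (shift-merge m n s))))

  shift-regroup₁ : ∀ {p q x y} a c e → shiftP x p ≈ shiftP y q → a ≡ e ℕ.+ x → c ≡ e ℕ.+ y → shiftP a p ≈ shiftP c q
  shift-regroup₁ {p} {q} {x} {y} a c e h ea ec = ≈trans (shiftEq p ea) (≈trans (≡⇒≈ (shift-add e x p))
    (≈trans (shift-cong e h) (≈trans (≡⇒≈ (sym (shift-add e y q))) (shiftEq q (sym ec)))))

  shift-regroup₂ : ∀ {p q x y} a b c d e → shiftP x p ≈ shiftP y q → a ℕ.+ b ≡ e ℕ.+ x → c ℕ.+ d ≡ e ℕ.+ y →
        shiftP a (shiftP b p) ≈ shiftP c (shiftP d q)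
  shift-regroup₂ {p} {q} a b c d e h ea ec = ≈trans (≡⇒≈ (shift-merge a b p)) (≈trans (shift-regroup₁ (a ℕ.+ b) (c ℕ.+ d) e h ea ec) (≡⇒≈ (sym (shift-merge c d q))))

  shift-regroup : ∀ {p} a b c d → a ℕ.+ b ≡ c ℕ.+ d → shiftP a (shiftP b p) ≈ shiftP c (shiftP d p)
  shift-regroup {p} a b c d e = shift-regroup₂ a b c d (c ℕ.+ d) (≈refl {shiftP 0 p}) (trans e (sym (ℕP.+-identityʳ (c ℕ.+ d)))) (sym (ℕP.+-identityʳ (c ℕ.+ d)))

  +L-cong : ∀ {a a' b b'} → a ≃ a' → b ≃ b' → a +L b ≃ a' +L b'
  +L-cong {⟨ m , p ⟩} {⟨ m1 , p1 ⟩} {⟨ n , r ⟩} {⟨ n1 , r1 ⟩} (mkL h) (mkL g) = mkL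
    (≈trans (shift-+ (m1 ℕ.+ n1) _ _) (≈trans (+P-cong A B) (≈sym (shift-+ (m ℕ.+ n) _ _))))
    where
    e1 : ∀ a b c → (a ℕ.+ b) ℕ.+ c ≡ (b ℕ.+ c) ℕ.+ a
    e1 = NS.solve-∀
    e2 : ∀ a b c → (a ℕ.+ b) ℕ.+ c ≡ (c ℕ.+ a) ℕ.+ b
    e2 = NS.solve-∀
    e3 : ∀ a b c → (a ℕ.+ b) ℕ.+ c ≡ (c ℕ.+ b) ℕ.+ a
    e3 = NS.solve-∀
    e4 : ∀ a b c → (a ℕ.+ b) ℕ.+ c ≡ (a ℕ.+ c) ℕ.+ b
    e4 = NS.solve-∀
    A : shiftP (m1 ℕ.+ n1) (shiftP n p) ≈ shiftP (m ℕ.+ n) (shiftP n1 p1)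
    A = shift-regroup₂ (m1 ℕ.+ n1) n (m ℕ.+ n) n1 (n1 ℕ.+ n) h (e1 m1 n1 n) (e3 m n n1)
    B : shiftP (m1 ℕ.+ n1) (shiftP m r) ≈ shiftP (m ℕ.+ n) (shiftP m1 r1)
    B = shift-regroup₂ (m1 ℕ.+ n1) m (m ℕ.+ n) m1 (m1 ℕ.+ m) g (e4 m1 n1 m) (e2 m n m1)

  +L-idˡ : ∀ a → 0L +L a ≃ a
  +L-idˡ ⟨ m , p ⟩ = mkL (≈trans (shift-+ m _ _) (≈trans (+P-cong (shift-cong m (≈trans (nil-zeros m) (≈sym (nil-zeros 0)))) ≈refl)
     (≈trans (+P-cong (≈trans (shift-cong m zero1) (nil-zeros' m)) ≈refl) ≈refl)))
    where
    nil-zeros' : ∀ m → shiftP m [] ≈ []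
    nil-zeros' zero = ≈refl
    nil-zeros' (suc m) = mk λ { zero → refl ; (suc i) → get (nil-zeros' m) i }

  -L-cong : ∀ {a b} → a ≃ b → -L a ≃ -L b
  -L-cong {⟨ m , p ⟩} {⟨ n , r ⟩} (mkL h) = mkL (≈trans (≡⇒≈ (sym (shift-neg n p))) (≈trans (neg-cong h) (≡⇒≈ (shift-neg m r))))

  +L-invʳ : ∀ a → a +L (-L a) ≃ 0L
  +L-invʳ ⟨ m , p ⟩ = mkL (≈trans (≈trans (+P-cong ≈refl (≡⇒≈ (sym (shift-neg m p)))) (+P-inv (shiftP m p))) (≈sym (nil-zeros (m ℕ.+ m))))

  *L-cong : ∀ {a a' b b'} → a ≃ a' → b ≃ b' → a *L b ≃ a' *L b'
  *L-cong {⟨ m , p ⟩} {⟨ m1 , p1 ⟩} {⟨ n , r ⟩} {⟨ n1 , r1 ⟩} (mkL h) (mkL g) = mkL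
    (≈trans (≡⇒≈ (shift-add m1 n1 (p *P r))) (≈trans (shift-cong m1 (≈sym (shift-*ʳ n1 p r)))
    (≈trans (≈sym (shift-*ˡ m1 p (shiftP n1 r))) (≈trans (*P-cong h g)
    (≈trans (shift-*ˡ m p1 (shiftP n r1)) (≈trans (shift-cong m (shift-*ʳ n p1 r1)) (≡⇒≈ (sym (shift-add m n (p1 *P r1))))))))))

  *L-comm : ∀ a b → a *L b ≃ b *L a
  *L-comm ⟨ m , p ⟩ ⟨ n , r ⟩ = mkL (≈trans (shiftEq _ (ℕP.+-comm n m)) (shift-cong (m ℕ.+ n) (*P-comm p r)))

  *L-assoc : ∀ a b c → (a *L b) *L c ≃ a *L (b *L c)
  *L-assoc ⟨ m , p ⟩ ⟨ n , r ⟩ ⟨ k , s ⟩ = mkL (≈trans (shiftEq _ (sym (ℕP.+-assoc m n k))) (shift-cong ((m ℕ.+ n) ℕ.+ k) (*P-assoc p r s)))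

  *L-idˡ : ∀ a → 1L *L a ≃ a
  *L-idˡ ⟨ m , p ⟩ = mkL (shift-cong m (*P-oneˡ p))

  *L-distribˡ : ∀ a b c → a *L (b +L c) ≃ (a *L b) +L (a *L c)
  *L-distribˡ ⟨ m , p ⟩ ⟨ n , r ⟩ ⟨ k , s ⟩ = mkL
    (≈trans (shift-cong ((m ℕ.+ n) ℕ.+ (m ℕ.+ k)) (≈trans (*P-distribˡ p _ _) (+P-cong (shift-*ʳ k p r) (shift-*ʳ n p s))))
    (≈trans (shift-+ ((m ℕ.+ n) ℕ.+ (m ℕ.+ k)) (shiftP k (p *P r)) (shiftP n (p *P s)))
    (≈trans (+P-cong (shift-regroup ((m ℕ.+ n) ℕ.+ (m ℕ.+ k)) k (m ℕ.+ (n ℕ.+ k)) (m ℕ.+ k) (e m n k))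
                     (shift-regroup ((m ℕ.+ n) ℕ.+ (m ℕ.+ k)) n (m ℕ.+ (n ℕ.+ k)) (m ℕ.+ n) (e' m n k)))
    (≈sym (shift-+ (m ℕ.+ (n ℕ.+ k)) (shiftP (m ℕ.+ k) (p *P r)) (shiftP (m ℕ.+ n) (p *P s)))))))
    where
    e : ∀ m n k → (m ℕ.+ n) ℕ.+ (m ℕ.+ k) ℕ.+ k ≡ m ℕ.+ (n ℕ.+ k) ℕ.+ (m ℕ.+ k)
    e = NS.solve-∀
    e' : ∀ m n k → (m ℕ.+ n) ℕ.+ (m ℕ.+ k) ℕ.+ n ≡ m ℕ.+ (n ℕ.+ k) ℕ.+ (m ℕ.+ n)
    e' = NS.solve-∀

  open import Algebra.Bundles using (CommutativeRing)
  open import Algebra.Structures {A = LPoly} _≃_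
  open import Relation.Binary.Structures using (IsEquivalence)
  open import Data.Product using (_,_)

  ≃isEq : IsEquivalence _≃_
  ≃isEq = record { refl = ≃refl ; sym = ≃sym ; trans = ≃trans }

  +L-idʳ : ∀ a → a +L 0L ≃ a
  +L-idʳ a = ≃trans (+L-comm a 0L) (+L-idˡ a)

  *L-idʳ : ∀ a → a *L 1L ≃ a
  *L-idʳ a = ≃trans (*L-comm a 1L) (*L-idˡ a)

  *L-distribʳ : ∀ a b c → (b +L c) *L a ≃ (b *L a) +L (c *L a)
  *L-distribʳ a b c = ≃trans (*L-comm (b +L c) a) (≃trans (*L-distribˡ a b c) (+L-cong (*L-comm a b) (*L-comm a c)))

  LPolyRing : CommutativeRing _ _
  LPolyRing = record
    { Carrier = LPoly ; _≈_ = _≃_ ; _+_ = _+L_ ; _*_ = _*L_ ; -_ = -L_ ; 0# = 0L ; 1# = 1L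
    ; isCommutativeRing = record
      { isRing = record
        { +-isAbelianGroup = record
          { isGroup = record
            { isMonoid = record
              { isSemigroup = record
                { isMagma = record { isEquivalence = ≃isEq ; ∙-cong = +L-cong }
                ; assoc = +L-assoc }
              ; identity = +L-idˡ , +L-idʳ }
            ; inverse = (λ a → ≃trans (+L-comm (-L a) a) (+L-invʳ a)) , +L-invʳ
            ; ⁻¹-cong = -L-cong }
          ; comm = +L-comm }
        ; *-cong = *L-cong
        ; *-assoc = *L-assoc
        ; *-identity = *L-idˡ , *L-idʳ
        ; distrib = *L-distribˡ , *L-distribʳ }
      ; *-comm = *L-comm } }

module LaurentSolver where

  open PolyArith
  open LaurentRing
  open import Data.Integer as ℤ using (ℤ; +_)
  import Data.Integer.Properties as ℤP
  open import Data.Maybe using (just; nothing)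
  open import Relation.Nullary using (yes; no)
  open import Relation.Binary.PropositionalEquality using (_≡_; refl; sym)
  import Algebra.Solver.Ring.AlmostCommutativeRing as ACR
  open import Relation.Binary.Definitions using (WeaklyDecidable)
  open import Algebra.Bundles using (CommutativeRing)
  import Algebra.Structures

  infixl 6 _⊕_
  infixl 7 _⊗_

  opaque
    _⊕_ : LPoly → LPoly → LPoly
    a ⊕ b = a +L b
    _⊗_ : LPoly → LPoly → LPoly
    a ⊗ b = a *L b
    ⊖' : LPoly → LPoly
    ⊖' a = -L a
    cst : ℤ → LPoly
    cst c = const c

  𝟘 : LPoly
  𝟘 = cst (+ 0)
  𝟙 : LPoly
  𝟙 = cst (+ 1)

  opaque
    unfolding _⊕_ _⊗_ ⊖' cst
    ⊕≡ : ∀ a b → a ⊕ b ≡ a +L b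
    ⊕≡ a b = refl
    ⊗≡ : ∀ a b → a ⊗ b ≡ a *L b
    ⊗≡ a b = refl
    ⊖≡ : ∀ a → ⊖' a ≡ -L a
    ⊖≡ a = refl
    cst≡ : ∀ c → cst c ≡ const c
    cst≡ c = refl

    isCommutativeRing : Algebra.Structures.IsCommutativeRing _≃_ _⊕_ _⊗_ ⊖' 𝟘 𝟙
    isCommutativeRing = CommutativeRing.isCommutativeRing LPolyRing
    cst*h : ∀ a b → cst (a ℤ.* b) ≃ cst a ⊗ cst b
    cst*h a b = ≃body (cons-cong (sym (ℤP.+-identityʳ (a ℤ.* b))) ≈refl)
    cst+h : ∀ a b → cst (a ℤ.+ b) ≃ cst a ⊕ cst b
    cst+h a b = ≃refl
    cst-h : ∀ a → cst (ℤ.- a) ≃ ⊖' (cst a)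
    cst-h a = ≃refl
    cst0 : cst (+ 0) ≃ 𝟘
    cst0 = ≃refl
    cst1 : cst (+ 1) ≃ 𝟙
    cst1 = ≃refl

  -- The same ring with opaque operations, which keeps the reflective ring solver
  -- from unfolding the list representation.
  Ring : CommutativeRing _ _
  Ring = record
      { Carrier = LPoly ; _≈_ = _≃_ ; _+_ = _⊕_ ; _*_ = _⊗_ ; -_ = ⊖' ; 0# = 𝟘 ; 1# = 𝟙
      ; isCommutativeRing = isCommutativeRing }

  -- Integer constants embed homomorphically; this lets `solve` handle numerals.
  constHom : ℤ.+-*-rawRing ACR.-Raw-AlmostCommutative⟶ ACR.fromCommutativeRing Ring
  constHom = record
      { ⟦_⟧ = cst
      ; +-homo = cst+h
      ; *-homo = cst*h
      ; -‿homo = cst-h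
      ; 0-homo = cst0
      ; 1-homo = cst1 }

  const-test : WeaklyDecidable (ACR.Induced-equivalence constHom)
  const-test a b with a ℤ.≟ b
  ... | yes refl = just ≃refl
  ... | no _ = nothing

  open import Algebra.Solver.Ring ℤ.+-*-rawRing (ACR.fromCommutativeRing Ring) constHom const-test public using (solve; _:=_; con; _:+_; _:*_; _:-_; :-_; Polynomial; ⟦_⟧; op; var; _:^_; Op; [+]; [*])

-- Powers of q, q-integers [n], q-binomial coefficients [n,k], and cancellation of
-- the factors q^e, [n+1] and 1 - q^(s+1).
module QAnalogues where

  open PolyArith
  open LaurentRing
  open LaurentSolver public
  open import Data.Nat as ℕ using (ℕ; zero; suc; _<_; s≤s; z≤n)
  open import Data.Integer as ℤ using (ℤ; +_; -[1+_])
  import Data.Integer.Properties as ℤP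
  import Data.Nat.Properties as ℕP
  import Data.Integer.Tactic.RingSolver as ZS
  open import Data.List using ([]; _∷_; map; replicate)
  open import Data.Product using (Σ; _,_)
  open import Relation.Nullary using (yes; no)
  open import Relation.Binary.PropositionalEquality using (_≡_; refl; sym; trans; cong; cong₂)
  open import Algebra.Bundles using (CommutativeRing)
  open import Data.Vec using (allFin)
  import Data.Vec as Vec
  open import Data.Vec.N-ary using (N-ary; _$ⁿ_)
  import Data.Vec.Relation.Binary.Pointwise.Inductive as PW
  open PW using (Pointwise)
  import Algebra.Solver.Ring.AlmostCommutativeRing as ACR
  open import Algebra.Properties.Semiring.Exp (ACR.AlmostCommutativeRing.semiring (ACR.fromCommutativeRing Ring)) using (^-congˡ)
  import Relation.Binary.Reasoning.Setoid as SR
  open SR (CommutativeRing.setoid Ring) public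
  open CommutativeRing Ring public using ()
    renaming (+-cong to ⊕c; *-cong to ⊗c; +-comm to ⊕comm; *-comm to ⊗comm; +-assoc to ⊕assoc; *-assoc to ⊗assoc;
              distribˡ to ⊗distribˡ; distribʳ to ⊗distribʳ; -‿cong to ⊖'c;
              +-identityˡ to ⊕idˡ; +-identityʳ to ⊕idʳ; *-identityˡ to ⊗idˡ; *-identityʳ to ⊗idʳ)

  infixl 6 _⊖_
  _⊖_ : LPoly → LPoly → LPoly
  a ⊖ b = a ⊕ ⊖' b

  ⊖c : ∀ {a a' b b'} → a ≃ a' → b ≃ b' → a ⊖ b ≃ a' ⊖ b'
  ⊖c h g = ⊕c h (⊖'c g)
  ⊗l : ∀ {a a'} b → a ≃ a' → a ⊗ b ≃ a' ⊗ b
  ⊗l b h = ⊗c h ≃refl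
  ⊗r : ∀ a {b b'} → b ≃ b' → a ⊗ b ≃ a ⊗ b'
  ⊗r a h = ⊗c ≃refl h
  ⊕l : ∀ {a a'} b → a ≃ a' → a ⊕ b ≃ a' ⊕ b
  ⊕l b h = ⊕c h ≃refl
  ⊕r : ∀ a {b b'} → b ≃ b' → a ⊕ b ≃ a ⊕ b'
  ⊕r a h = ⊕c ≃refl h

  -- Evaluating the same solver polynomial at pointwise equal arguments gives equal
  -- results: this rewrites several atoms of a ring expression at once.
  eval-cong : ∀ {n} (p : Polynomial n) {ρ ρ'} → Pointwise _≃_ ρ ρ' → ⟦ p ⟧ ρ ≃ ⟦ p ⟧ ρ'
  eval-cong (op [+] p q) h = ⊕c (eval-cong p h) (eval-cong q h)
  eval-cong (op [*] p q) h = ⊗c (eval-cong p h) (eval-cong q h)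
  eval-cong (con c) h = ≃refl
  eval-cong (var x) h = PW.lookup h x
  eval-cong (p :^ k) h = ^-congˡ k (eval-cong p h)
  eval-cong (:- p) h = ⊖'c (eval-cong p h)

  close : ∀ n → N-ary n (Polynomial n) (Polynomial n) → Polynomial n
  close n f = f $ⁿ Vec.map var (allFin n)

  solve-subst : ∀ n (f : N-ary n (Polynomial n) (Polynomial n)) {ρ ρ'} → Pointwise _≃_ ρ ρ' → ⟦ close n f ⟧ ρ ≃ ⟦ close n f ⟧ ρ'
  solve-subst n f h = eval-cong (close n f) h

  -- q^e, [n] and [n,k] as opaque atoms, so that ring normalisation treats them as
  -- variables.
  opaque
    Q : ℤ → LPoly
    Q e = q^ e
    qint : ℕ → LPoly
    qint n = [ n ]q
    qbin : ℕ → ℕ → LPoly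
    qbin n k = qbinom n k

  q¹ : LPoly
  q¹ = Q (+ 1)

  monomial : ℕ → ℕ → LPoly
  monomial l h = ⟨ l , shiftP h (+ 1 ∷ []) ⟩

  opaque
    unfolding _⊗_
    monomial-* : ∀ l h l' h' → monomial l h ⊗ monomial l' h' ≃ monomial (l ℕ.+ l') (h ℕ.+ h')
    monomial-* l h l' h' = ≃body (≈trans (shift-*ˡ h (+ 1 ∷ []) (shiftP h' (+ 1 ∷ [])))
      (≈trans (shift-cong h (*P-oneˡ (shiftP h' (+ 1 ∷ [])))) (≡⇒≈ (sym (shift-add h h' (+ 1 ∷ []))))))

  monomial-≃ : ∀ {l h l' h'} → h ℕ.+ l' ≡ h' ℕ.+ l → monomial l h ≃ monomial l' h'
  monomial-≃ {l} {h} {l'} {h'} e = mkL (shift-regroup l' h l h' (trans (ℕP.+-comm l' h) (trans e (ℕP.+-comm h' l))))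

  ℤ-diff-injective : ∀ h l h' l' → + h ℤ.- + l ≡ + h' ℤ.- + l' → h ℕ.+ l' ≡ h' ℕ.+ l
  ℤ-diff-injective h l h' l' e = ℤP.+-injective (trans (ℤP.pos-+ h l') (trans (lem (+ h) (+ l) (+ l'))
     (trans (cong (λ z → z ℤ.+ (+ l ℤ.+ + l')) e) (trans (sym (lem' (+ h') (+ l') (+ l))) (sym (ℤP.pos-+ h' l))))))
    where
    lem : ∀ a b c → a ℤ.+ c ≡ (a ℤ.- b) ℤ.+ (b ℤ.+ c)
    lem = ZS.solve-∀
    lem' : ∀ a b c → a ℤ.+ c ≡ (a ℤ.- b) ℤ.+ (c ℤ.+ b)
    lem' = ZS.solve-∀

  opaque
    unfolding Q
    Q≃monomial : ∀ e l h → + h ℤ.- + l ≡ e → Q e ≃ monomial l h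
    Q≃monomial (+ n) l h eq = monomial-≃ (ℤ-diff-injective n 0 h l (trans (ℤP.+-identityʳ (+ n)) (sym eq)))
    Q≃monomial -[1+ n ] l h eq = monomial-≃ (ℤ-diff-injective 0 (suc n) h l (sym eq))

  Q-split : ∀ e → Σ ℕ (λ l → Σ ℕ (λ h → + h ℤ.- + l ≡ e))
  Q-split (+ n) = 0 , n , ℤP.+-identityʳ (+ n)
  Q-split -[1+ n ] = suc n , 0 , refl

  Q-add : ∀ a b → Q (a ℤ.+ b) ≃ Q a ⊗ Q b
  Q-add a b with Q-split a | Q-split b
  ... | la , ha , ea | lb , hb , eb = ≃trans (Q≃monomial (a ℤ.+ b) (la ℕ.+ lb) (ha ℕ.+ hb) eq)
        (≃sym (≃trans (⊗c (Q≃monomial a la ha ea) (Q≃monomial b lb hb eb)) (monomial-* la ha lb hb)))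
    where
    lem : ∀ x y z w → (x ℤ.+ y) ℤ.- (z ℤ.+ w) ≡ (x ℤ.- z) ℤ.+ (y ℤ.- w)
    lem = ZS.solve-∀
    eq : + (ha ℕ.+ hb) ℤ.- + (la ℕ.+ lb) ≡ a ℤ.+ b
    eq = trans (cong₂ ℤ._-_ (ℤP.pos-+ ha hb) (ℤP.pos-+ la lb)) (trans (lem (+ ha) (+ hb) (+ la) (+ lb)) (cong₂ ℤ._+_ ea eb))

  Q-cong : ∀ {a b} → a ≡ b → Q a ≃ Q b
  Q-cong refl = ≃refl

  opaque
    unfolding Q cst
    Q0 : Q (+ 0) ≃ 𝟙
    Q0 = ≃refl

  Q-inv : ∀ a → Q a ⊗ Q (ℤ.- a) ≃ 𝟙
  Q-inv a = ≃trans (≃sym (Q-add a (ℤ.- a))) (≃trans (Q-cong (ℤP.+-inverseʳ a)) Q0)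

  Q-sucq : ∀ n → Q (+ suc n) ≃ Q (+ n) ⊗ q¹
  Q-sucq n = ≃trans (Q-cong (trans (cong +_ (ℕP.+-comm 1 n)) (ℤP.pos-+ n 1))) (Q-add (+ n) (+ 1))

  Q+ : ∀ m n → Q (+ (m ℕ.+ n)) ≃ Q (+ m) ⊗ Q (+ n)
  Q+ m n = ≃trans (Q-cong (ℤP.pos-+ m n)) (Q-add (+ m) (+ n))

  poly-cons : ∀ a r → poly (a ∷ r) ≃ (const a +L (q^ (+ 1) *L poly r))
  poly-cons a r = ≃body (≈trans (cons-cong (sym (ℤP.+-identityʳ a)) ≈refl)
     (≈sym (+P-cong (≈refl {a ∷ []}) (≈trans (cons0-* (+ 1 ∷ []) r) (cons-cong refl (*P-oneˡ r))))))

  opaque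
    unfolding qint _⊕_ _⊗_ cst Q
    qint-zero : qint 0 ≃ 𝟘
    qint-zero = ≃body (≈sym zero1)

    qint-suc : ∀ n → qint (suc n) ≃ 𝟙 ⊕ q¹ ⊗ qint n
    qint-suc n = poly-cons (+ 1) (replicate n (+ 1))

  qint-one : qint 1 ≃ 𝟙
  qint-one = ≃trans (qint-suc 0) (≃trans (⊕r 𝟙 (≃trans (⊗r q¹ qint-zero) (solve 1 (λ x → x :* con (+ 0) := con (+ 0)) ≃refl q¹))) (⊕idʳ 𝟙))

  qint-+ : ∀ a b → qint (a ℕ.+ b) ≃ qint a ⊕ Q (+ a) ⊗ qint b
  qint-+ zero b = ≃trans (≃sym (⊗idˡ (qint b))) (≃trans (⊗l (qint b) (≃sym Q0)) (≃trans (≃sym (⊕idˡ _)) (⊕l _ (≃sym qint-zero))))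
  qint-+ (suc a) b = begin
    qint (suc (a ℕ.+ b)) ≈⟨ qint-suc (a ℕ.+ b) ⟩
    𝟙 ⊕ q¹ ⊗ qint (a ℕ.+ b) ≈⟨ ⊕r 𝟙 (⊗r q¹ (qint-+ a b)) ⟩
    𝟙 ⊕ q¹ ⊗ (qint a ⊕ Q (+ a) ⊗ qint b) ≈⟨ solve 4 (λ x y z w → con (+ 1) :+ x :* (y :+ z :* w) := (con (+ 1) :+ x :* y) :+ (z :* x) :* w) ≃refl q¹ (qint a) (Q (+ a)) (qint b) ⟩
    (𝟙 ⊕ q¹ ⊗ qint a) ⊕ (Q (+ a) ⊗ q¹) ⊗ qint b ≈⟨ ⊕c (≃sym (qint-suc a)) (⊗l (qint b) (≃sym (Q-sucq a))) ⟩
    qint (suc a) ⊕ Q (+ suc a) ⊗ qint b ∎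

  qint-geometric : ∀ n → (𝟙 ⊖ q¹) ⊗ qint n ≃ 𝟙 ⊖ Q (+ n)
  qint-geometric zero = begin
    (𝟙 ⊖ q¹) ⊗ qint 0 ≈⟨ ⊗r _ qint-zero ⟩
    (𝟙 ⊖ q¹) ⊗ 𝟘 ≈⟨ solve 1 (λ x → (con (+ 1) :- x) :* con (+ 0) := con (+ 1) :- con (+ 1)) ≃refl q¹ ⟩
    𝟙 ⊖ 𝟙 ≈⟨ ⊖c ≃refl (≃sym Q0) ⟩
    𝟙 ⊖ Q (+ 0) ∎
  qint-geometric (suc n) = begin
    (𝟙 ⊖ q¹) ⊗ qint (suc n) ≈⟨ ⊗r _ (qint-suc n) ⟩
    (𝟙 ⊖ q¹) ⊗ (𝟙 ⊕ q¹ ⊗ qint n) ≈⟨ solve 2 (λ x b → (con (+ 1) :- x) :* (con (+ 1) :+ x :* b) := con (+ 1) :- x :* (con (+ 1) :- (con (+ 1) :- x) :* b)) ≃refl q¹ (qint n) ⟩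
    𝟙 ⊖ q¹ ⊗ (𝟙 ⊖ (𝟙 ⊖ q¹) ⊗ qint n) ≈⟨ ⊖c ≃refl (⊗r q¹ (⊖c ≃refl (qint-geometric n))) ⟩
    𝟙 ⊖ q¹ ⊗ (𝟙 ⊖ (𝟙 ⊖ Q (+ n))) ≈⟨ ⊖c ≃refl (≃trans (solve 2 (λ x y → x :* (con (+ 1) :- (con (+ 1) :- y)) := y :* x) ≃refl q¹ (Q (+ n))) (≃sym (Q-sucq n))) ⟩
    𝟙 ⊖ Q (+ suc n) ∎

  opaque
    unfolding qbin _⊕_ _⊗_ Q cst
    poly-+ : ∀ p r → poly (p +P r) ≃ (poly p +L poly r)
    poly-+ p r = ≃refl

    poly-shift : ∀ j p → poly (shiftP j p) ≃ (q^ (+ j) *L poly p)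
    poly-shift j p = ≃body (≈sym (≈trans (shift-*ˡ j (+ 1 ∷ []) p) (shift-cong j (*P-oneˡ p))))

    pascal : ∀ n k → qbin (suc n) (suc k) ≃ qbin n k ⊕ Q (+ suc k) ⊗ qbin n (suc k)
    pascal n k = ≃trans (poly-+ (qbinomP n k) _) (⊕c ≃refl (poly-shift (suc k) (qbinomP n (suc k))))

    qbin-zero : ∀ n → qbin n 0 ≃ 𝟙
    qbin-zero zero = ≃refl
    qbin-zero (suc n) = ≃refl

    qbin-empty : ∀ k → qbin 0 (suc k) ≃ 𝟘
    qbin-empty k = ≃body (≈sym zero1)

  z⊗ : ∀ a → a ⊗ 𝟘 ≃ 𝟘
  z⊗ a = solve 1 (λ x → x :* con (+ 0) := con (+ 0)) ≃refl a

  ≡≃ : ∀ {a b} → a ≡ b → a ≃ b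
  ≡≃ refl = ≃refl

  qbin-above′ : ∀ n d → qbin n (n ℕ.+ suc d) ≃ 𝟘
  qbin-above′ zero d = qbin-empty d
  qbin-above′ (suc n) d = begin
    qbin (suc n) (suc (n ℕ.+ suc d)) ≈⟨ pascal n (n ℕ.+ suc d) ⟩
    qbin n (n ℕ.+ suc d) ⊕ Q (+ suc (n ℕ.+ suc d)) ⊗ qbin n (suc (n ℕ.+ suc d)) ≈⟨ ⊕c (qbin-above′ n d)
         (⊗r _ (≃trans (≡≃ (cong (qbin n) (sym (ℕP.+-suc n (suc d))))) (qbin-above′ n (suc d)))) ⟩
    𝟘 ⊕ Q (+ suc (n ℕ.+ suc d)) ⊗ 𝟘 ≈⟨ solve 1 (λ x → con (+ 0) :+ x :* con (+ 0) := con (+ 0)) ≃refl _ ⟩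
    𝟘 ∎

  qbin-above : ∀ n k → n < k → qbin n k ≃ 𝟘
  qbin-above n k lt with ℕP.m≤n⇒∃[o]m+o≡n lt
  ... | d , e = ≃trans (≡≃ (cong (qbin n) (trans (sym e) (sym (ℕP.+-suc n d))))) (qbin-above′ n d)

  qbin-diag : ∀ n → qbin n n ≃ 𝟙
  qbin-diag zero = qbin-zero 0
  qbin-diag (suc n) = begin
    qbin (suc n) (suc n) ≈⟨ pascal n n ⟩
    qbin n n ⊕ Q (+ suc n) ⊗ qbin n (suc n) ≈⟨ ⊕c (qbin-diag n) (⊗r _ (qbin-above n (suc n) (ℕP.n<1+n n))) ⟩
    𝟙 ⊕ Q (+ suc n) ⊗ 𝟘 ≈⟨ solve 1 (λ x → con (+ 1) :+ x :* con (+ 0) := con (+ 1)) ≃refl _ ⟩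
    𝟙 ∎

  coeff-shift-below : ∀ m p i → i < m → coeff (shiftP m p) i ≡ + 0
  coeff-shift-below (suc m) p zero lt = refl
  coeff-shift-below (suc m) p (suc i) (s≤s lt) = coeff-shift-below m p i lt

  coeff-shift-above : ∀ m p j → coeff (shiftP m p) (m ℕ.+ j) ≡ coeff p j
  coeff-shift-above zero p j = refl
  coeff-shift-above (suc m) p j = coeff-shift-above m p j

  shift-fixpoint-zero : ∀ s p → (p +P map ℤ.-_ (shiftP (suc s) p)) ≈ [] → p ≈ []
  shift-fixpoint-zero s p h = mk λ i → go (suc i) i (ℕP.n<1+n i)
    where
    eqi : ∀ i → coeff p i ≡ coeff (shiftP (suc s) p) i
    eqi i = trans (l1 (coeff p i) (coeff (shiftP (suc s) p) i))
       (trans (cong (ℤ._+ coeff (shiftP (suc s) p) i) e0) (ℤP.+-identityˡ _))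
      where
      l1 : ∀ x y → x ≡ (x ℤ.+ ℤ.- y) ℤ.+ y
      l1 = ZS.solve-∀
      e0 : coeff p i ℤ.+ ℤ.- coeff (shiftP (suc s) p) i ≡ + 0
      e0 = trans (cong (λ zz → coeff p i ℤ.+ zz) (sym (coeff-neg (shiftP (suc s) p) i)))
           (trans (sym (coeff-+ p (map ℤ.-_ (shiftP (suc s) p)) i)) (get h i))
    go : ∀ b i → i < b → coeff p i ≡ + 0
    go (suc b) i (s≤s lt) with i ℕ.<? suc s
    ... | yes ilt = trans (eqi i) (coeff-shift-below (suc s) p i ilt)
    ... | no ige with ℕP.m≤n⇒∃[o]m+o≡n (ℕP.≮⇒≥ ige)
    ... | j , e = trans (eqi i) (trans (cong (coeff (shiftP (suc s) p)) (sym e))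
           (trans (coeff-shift-above (suc s) p j) (go b j (ℕP.<-≤-trans (jlt j e) lt))))
      where
      jlt : ∀ j → suc s ℕ.+ j ≡ i → j < i
      jlt j refl = ℕP.m<n+m j (s≤s z≤n)

  neg-as-scale : ∀ u → map ℤ.-_ u ≈ map (ℤ.-1ℤ ℤ.*_) u
  neg-as-scale u = mk λ i → trans (coeff-neg u i) (trans (sym (ℤP.-1*i≡-i (coeff u i))) (sym (coeff-map ℤ.-1ℤ u i)))

  neg-* : ∀ u p → (map ℤ.-_ u) *P p ≈ map ℤ.-_ (u *P p)
  neg-* u p = ≈trans (*P-congˡ p (neg-as-scale u)) (≈trans (map-* ℤ.-1ℤ u p) (≈sym (neg-as-scale (u *P p))))

  -- c is cancellable if c·A = 0 forces A = 0; we show this for powers of q,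
  -- q-integers and 1 - q^(s+1), which suffices for all divisions in the paper.
  Cancellable : LPoly → Set
  Cancellable c = ∀ A → c ⊗ A ≃ 𝟘 → A ≃ 𝟘

  -- 1 - q^(s+1) is cancellable: an annihilated A is fixed by multiplication by
  -- q^(s+1), hence zero.
  opaque
    unfolding _⊕_ _⊗_ ⊖' cst Q
    Cancellable-1-Q : ∀ s → Cancellable (𝟙 ⊖ Q (+ suc s))
    Cancellable-1-Q s ⟨ m , p ⟩ (mkL h) = mkL (≈trans (shift-fixpoint-zero s p body≈) (≈sym (nil-zeros m)))
      where
      sh : Poly
      sh = shiftP (suc s) (+ 1 ∷ [])
      body≈ : (p +P map ℤ.-_ (shiftP (suc s) p)) ≈ []
      body≈ = ≈trans (≈sym (≈trans (*P-distribʳ (+ 1 ∷ []) (map ℤ.-_ sh) p)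
                (+P-cong (*P-oneˡ p) (≈trans (neg-* sh p) (neg-cong (≈trans (shift-*ˡ (suc s) (+ 1 ∷ []) p) (shift-cong (suc s) (*P-oneˡ p))))))))
              (≈trans h (nil-zeros m))

  Cancellable-* : ∀ {c d} → Cancellable c → Cancellable d → Cancellable (c ⊗ d)
  Cancellable-* {c} {d} nc nd A h = nd A (nc (d ⊗ A) (≃trans (≃sym (⊗assoc c d A)) h))

  Cancellable-Q : ∀ e → Cancellable (Q e)
  Cancellable-Q e A h = begin
    A ≈⟨ ≃sym (⊗idˡ A) ⟩
    𝟙 ⊗ A ≈⟨ ⊗l A (≃sym (≃trans (⊗comm (Q (ℤ.- e)) (Q e)) (Q-inv e))) ⟩
    (Q (ℤ.- e) ⊗ Q e) ⊗ A ≈⟨ ⊗assoc _ _ _ ⟩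
    Q (ℤ.- e) ⊗ (Q e ⊗ A) ≈⟨ ⊗r _ h ⟩
    Q (ℤ.- e) ⊗ 𝟘 ≈⟨ z⊗ _ ⟩
    𝟘 ∎

  Cancellable-qint : ∀ n → Cancellable (qint (suc n))
  Cancellable-qint n A h = Cancellable-1-Q n A (begin
    (𝟙 ⊖ Q (+ suc n)) ⊗ A ≈⟨ ⊗l A (≃sym (qint-geometric (suc n))) ⟩
    ((𝟙 ⊖ q¹) ⊗ qint (suc n)) ⊗ A ≈⟨ ⊗assoc _ _ _ ⟩
    (𝟙 ⊖ q¹) ⊗ (qint (suc n) ⊗ A) ≈⟨ ⊗r _ h ⟩
    (𝟙 ⊖ q¹) ⊗ 𝟘 ≈⟨ z⊗ _ ⟩
    𝟘 ∎)

  cancel : ∀ {c A B} → Cancellable c → c ⊗ A ≃ c ⊗ B → A ≃ B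
  cancel {c} {A} {B} nc h = begin
    A ≈⟨ solve 2 (λ a b → a := (a :- b) :+ b) ≃refl A B ⟩
    (A ⊖ B) ⊕ B ≈⟨ ⊕l B (nc (A ⊖ B) (begin
        c ⊗ (A ⊖ B) ≈⟨ solve 3 (λ x a b → x :* (a :- b) := x :* a :- x :* b) ≃refl c A B ⟩
        c ⊗ A ⊖ c ⊗ B ≈⟨ ⊖c h ≃refl ⟩
        c ⊗ B ⊖ c ⊗ B ≈⟨ solve 1 (λ x → x :- x := con (+ 0)) ≃refl (c ⊗ B) ⟩
        𝟘 ∎)) ⟩
    𝟘 ⊕ B ≈⟨ ⊕idˡ B ⟩
    B ∎

  qfact : ℕ → LPoly
  qfact zero = 𝟙
  qfact (suc n) = qfact n ⊗ qint (suc n)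

  Cancellable-𝟙 : Cancellable 𝟙
  Cancellable-𝟙 A h = ≃trans (≃sym (⊗idˡ A)) h

  Cancellable-qfact : ∀ n → Cancellable (qfact n)
  Cancellable-qfact zero = Cancellable-𝟙
  Cancellable-qfact (suc n) = Cancellable-* (Cancellable-qfact n) (Cancellable-qint n)

module FiniteSums where

  open PolyArith
  open LaurentRing
  open QAnalogues
  open import Data.Nat as ℕ using (ℕ; zero; suc; _<_; _≤_; s≤s; z≤n)
  open import Data.Integer using (+_)
  import Data.Nat.Properties as ℕP

  sumUp : ℕ → (ℕ → LPoly) → LPoly
  sumUp zero f = f 0
  sumUp (suc n) f = sumUp n f ⊕ f (suc n)

  sumUp-cong : ∀ n {f g} → (∀ k → k ≤ n → f k ≃ g k) → sumUp n f ≃ sumUp n g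
  sumUp-cong zero h = h 0 z≤n
  sumUp-cong (suc n) h = ⊕c (sumUp-cong n (λ k le → h k (ℕP.m≤n⇒m≤1+n le))) (h (suc n) ℕP.≤-refl)

  sumUp-cong′ : ∀ n {f g} → (∀ k → f k ≃ g k) → sumUp n f ≃ sumUp n g
  sumUp-cong′ n h = sumUp-cong n (λ k _ → h k)

  sumUp-+ : ∀ n (f g : ℕ → LPoly) → sumUp n (λ k → f k ⊕ g k) ≃ sumUp n f ⊕ sumUp n g
  sumUp-+ zero f g = ≃refl
  sumUp-+ (suc n) f g = ≃trans (⊕l _ (sumUp-+ n f g))
    (solve 4 (λ a b c d → (a :+ b) :+ (c :+ d) := (a :+ c) :+ (b :+ d)) ≃refl (sumUp n f) (sumUp n g) (f (suc n)) (g (suc n)))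

  sumUp-* : ∀ n c (f : ℕ → LPoly) → sumUp n (λ k → c ⊗ f k) ≃ c ⊗ sumUp n f
  sumUp-* zero c f = ≃refl
  sumUp-* (suc n) c f = ≃trans (⊕l _ (sumUp-* n c f)) (≃sym (⊗distribˡ c (sumUp n f) (f (suc n))))

  sumUp-neg : ∀ n (f : ℕ → LPoly) → sumUp n (λ k → ⊖' (f k)) ≃ ⊖' (sumUp n f)
  sumUp-neg zero f = ≃refl
  sumUp-neg (suc n) f = ≃trans (⊕l _ (sumUp-neg n f)) (solve 2 (λ a b → (:- a) :+ (:- b) := :- (a :+ b)) ≃refl (sumUp n f) (f (suc n)))

  sumUp-- : ∀ n (f g : ℕ → LPoly) → sumUp n (λ k → f k ⊖ g k) ≃ sumUp n f ⊖ sumUp n g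
  sumUp-- n f g = ≃trans (sumUp-+ n f (λ k → ⊖' (g k))) (⊕r _ (sumUp-neg n g))

  sumUp-shift : ∀ n (f : ℕ → LPoly) → sumUp (suc n) f ≃ f 0 ⊕ sumUp n (λ k → f (suc k))
  sumUp-shift zero f = ≃refl
  sumUp-shift (suc n) f = ≃trans (⊕l _ (sumUp-shift n f)) (⊕assoc _ _ _)

  sumUp-zero : ∀ n {f} → (∀ k → k ≤ n → f k ≃ 𝟘) → sumUp n f ≃ 𝟘
  sumUp-zero zero h = h 0 z≤n
  sumUp-zero (suc n) h = ≃trans (⊕c (sumUp-zero n (λ k le → h k (ℕP.m≤n⇒m≤1+n le))) (h (suc n) ℕP.≤-refl)) (⊕idʳ 𝟘)

  sumUp-telescope : ∀ n {f : ℕ → LPoly} (G : ℕ → LPoly) → (∀ k → k ≤ n → f k ≃ G k ⊖ G (suc k)) → sumUp n f ≃ G 0 ⊖ G (suc n)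
  sumUp-telescope zero G h = h 0 z≤n
  sumUp-telescope (suc n) {f} G h = ≃trans (⊕c (sumUp-telescope n {f} G (λ k le → h k (ℕP.m≤n⇒m≤1+n le))) (h (suc n) ℕP.≤-refl))
    (solve 3 (λ a b c → (a :- b) :+ (b :- c) := a :- c) ≃refl (G 0) (G (suc n)) (G (suc (suc n))))

  sumUp-swap : ∀ n m (F : ℕ → ℕ → LPoly) → sumUp n (λ i → sumUp m (λ j → F i j)) ≃ sumUp m (λ j → sumUp n (λ i → F i j))
  sumUp-swap zero m F = ≃refl
  sumUp-swap (suc n) m F = ≃trans (⊕l _ (sumUp-swap n m F)) (≃sym (sumUp-+ m (λ j → sumUp n (λ i → F i j)) (λ j → F (suc n) j)))

  sumUp-extend : ∀ n d {f} → (∀ k → n < k → f k ≃ 𝟘) → sumUp (d ℕ.+ n) f ≃ sumUp n f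
  sumUp-extend n zero h = ≃refl
  sumUp-extend n (suc d) h = ≃trans (⊕c (sumUp-extend n d h) (h (suc (d ℕ.+ n)) (s≤s (ℕP.m≤n+m n d)))) (⊕idʳ _)

module QBinomials where

  open PolyArith
  open LaurentRing
  open QAnalogues
  open FiniteSums
  open import Data.Nat as ℕ using (ℕ; zero; suc; _<_; s≤s)
  open import Data.Integer as ℤ using (ℤ; +_)
  import Data.Integer.Properties as ℤP
  import Data.Nat.Properties as ℕP
  import Data.Integer.Tactic.RingSolver as ZS
  import Data.Nat.Tactic.RingSolver as NS
  open import Data.Product using (_,_)
  open import Relation.Nullary using (yes; no)
  open import Relation.Binary.PropositionalEquality using (_≡_; refl; sym; trans; cong)

  -- The factorial formula [a+b,a] [a]! [b]! = [a+b]!; every other q-binomial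
  -- identity below is proved by cancelling factorials against it.
  qbin-qfact : ∀ a b → qbin (a ℕ.+ b) a ⊗ (qfact a ⊗ qfact b) ≃ qfact (a ℕ.+ b)
  qbin-qfact zero b = ≃trans (⊗l _ (qbin-zero b)) (≃trans (⊗idˡ _) (⊗idˡ _))
  qbin-qfact (suc a) zero = ≃trans (⊗c (≃trans (≡≃ (cong (λ N → qbin N (suc a)) (ℕP.+-identityʳ (suc a)))) (qbin-diag (suc a))) ≃refl)
    (≃trans (⊗idˡ _) (≃trans (⊗idʳ _) (≡≃ (cong qfact (sym (ℕP.+-identityʳ (suc a)))))))
  qbin-qfact (suc a) (suc b) = begin
    qbin (suc (a ℕ.+ suc b)) (suc a) ⊗ ((qfact a ⊗ qint (suc a)) ⊗ (qfact b ⊗ qint (suc b)))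
      ≈⟨ ⊗l _ (pascal (a ℕ.+ suc b) a) ⟩
    (qbin (a ℕ.+ suc b) a ⊕ Q (+ suc a) ⊗ qbin (a ℕ.+ suc b) (suc a)) ⊗ ((qfact a ⊗ qint (suc a)) ⊗ (qfact b ⊗ qint (suc b)))
      ≈⟨ solve 7 (λ c₁ c2 fa fb x y z → (c₁ :+ z :* c2) :* ((fa :* x) :* (fb :* y)) :=
            (c₁ :* (fa :* (fb :* y))) :* x :+ z :* ((c2 :* ((fa :* x) :* fb)) :* y)) ≃refl
            (qbin (a ℕ.+ suc b) a) (qbin (a ℕ.+ suc b) (suc a)) (qfact a) (qfact b) (qint (suc a)) (qint (suc b)) (Q (+ suc a)) ⟩
    (qbin (a ℕ.+ suc b) a ⊗ (qfact a ⊗ (qfact b ⊗ qint (suc b)))) ⊗ qint (suc a) ⊕ Q (+ suc a) ⊗ ((qbin (a ℕ.+ suc b) (suc a) ⊗ ((qfact a ⊗ qint (suc a)) ⊗ qfact b)) ⊗ qint (suc b))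
      ≈⟨ ⊕c (⊗l _ (qbin-qfact a (suc b))) (⊗r _ (⊗l _ (≃trans (⊗l _ (≡≃ (cong (λ N → qbin N (suc a)) e))) (≃trans (qbin-qfact (suc a) b) (≡≃ (cong qfact (sym e))))))) ⟩
    qfact (a ℕ.+ suc b) ⊗ qint (suc a) ⊕ Q (+ suc a) ⊗ (qfact (a ℕ.+ suc b) ⊗ qint (suc b))
      ≈⟨ solve 4 (λ f x y z → f :* x :+ z :* (f :* y) := f :* (x :+ z :* y)) ≃refl (qfact (a ℕ.+ suc b)) (qint (suc a)) (qint (suc b)) (Q (+ suc a)) ⟩
    qfact (a ℕ.+ suc b) ⊗ (qint (suc a) ⊕ Q (+ suc a) ⊗ qint (suc b))
      ≈⟨ ⊗r _ (≃sym (qint-+ (suc a) (suc b))) ⟩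
    qfact (a ℕ.+ suc b) ⊗ qint (suc (a ℕ.+ suc b)) ∎
    where
    e : a ℕ.+ suc b ≡ suc a ℕ.+ b
    e = ℕP.+-suc a b

  absorb-top : ∀ a b → qint (suc a) ⊗ qbin (suc (a ℕ.+ b)) (suc a) ≃ qint (suc (a ℕ.+ b)) ⊗ qbin (a ℕ.+ b) a
  absorb-top a b = cancel (Cancellable-* (Cancellable-qfact a) (Cancellable-qfact b)) (begin
    (qfact a ⊗ qfact b) ⊗ (qint (suc a) ⊗ qbin (suc (a ℕ.+ b)) (suc a))
      ≈⟨ solve 4 (λ fa fb x c → (fa :* fb) :* (x :* c) := c :* ((fa :* x) :* fb)) ≃refl (qfact a) (qfact b) (qint (suc a)) (qbin (suc (a ℕ.+ b)) (suc a)) ⟩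
    qbin (suc a ℕ.+ b) (suc a) ⊗ (qfact (suc a) ⊗ qfact b) ≈⟨ qbin-qfact (suc a) b ⟩
    qfact (a ℕ.+ b) ⊗ qint (suc (a ℕ.+ b)) ≈⟨ ⊗l _ (≃sym (qbin-qfact a b)) ⟩
    (qbin (a ℕ.+ b) a ⊗ (qfact a ⊗ qfact b)) ⊗ qint (suc (a ℕ.+ b))
      ≈⟨ solve 4 (λ fa fb x c → (c :* (fa :* fb)) :* x := (fa :* fb) :* (x :* c)) ≃refl (qfact a) (qfact b) (qint (suc (a ℕ.+ b))) (qbin (a ℕ.+ b) a) ⟩
    (qfact a ⊗ qfact b) ⊗ (qint (suc (a ℕ.+ b)) ⊗ qbin (a ℕ.+ b) a) ∎)

  absorb-bottom : ∀ a b → qint (suc b) ⊗ qbin (suc (a ℕ.+ b)) a ≃ qint (suc (a ℕ.+ b)) ⊗ qbin (a ℕ.+ b) a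
  absorb-bottom a b = cancel (Cancellable-* (Cancellable-qfact a) (Cancellable-qfact b)) (begin
    (qfact a ⊗ qfact b) ⊗ (qint (suc b) ⊗ qbin (suc (a ℕ.+ b)) a)
      ≈⟨ solve 4 (λ fa fb x c → (fa :* fb) :* (x :* c) := c :* (fa :* (fb :* x))) ≃refl (qfact a) (qfact b) (qint (suc b)) (qbin (suc (a ℕ.+ b)) a) ⟩
    qbin (suc (a ℕ.+ b)) a ⊗ (qfact a ⊗ qfact (suc b)) ≈⟨ ⊗l _ (≡≃ (cong (λ N → qbin N a) (sym e))) ⟩
    qbin (a ℕ.+ suc b) a ⊗ (qfact a ⊗ qfact (suc b)) ≈⟨ qbin-qfact a (suc b) ⟩
    qfact (a ℕ.+ suc b) ≈⟨ ≡≃ (cong qfact e) ⟩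
    qfact (a ℕ.+ b) ⊗ qint (suc (a ℕ.+ b)) ≈⟨ ⊗l _ (≃sym (qbin-qfact a b)) ⟩
    (qbin (a ℕ.+ b) a ⊗ (qfact a ⊗ qfact b)) ⊗ qint (suc (a ℕ.+ b))
      ≈⟨ solve 4 (λ fa fb x c → (c :* (fa :* fb)) :* x := (fa :* fb) :* (x :* c)) ≃refl (qfact a) (qfact b) (qint (suc (a ℕ.+ b))) (qbin (a ℕ.+ b) a) ⟩
    (qfact a ⊗ qfact b) ⊗ (qint (suc (a ℕ.+ b)) ⊗ qbin (a ℕ.+ b) a) ∎)
    where
    e : a ℕ.+ suc b ≡ suc (a ℕ.+ b)
    e = ℕP.+-suc a b

  qbin-sym : ∀ a b → qbin (a ℕ.+ b) a ≃ qbin (a ℕ.+ b) b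
  qbin-sym a b = cancel (Cancellable-* (Cancellable-qfact a) (Cancellable-qfact b)) (begin
    (qfact a ⊗ qfact b) ⊗ qbin (a ℕ.+ b) a ≈⟨ ⊗comm _ _ ⟩
    qbin (a ℕ.+ b) a ⊗ (qfact a ⊗ qfact b) ≈⟨ qbin-qfact a b ⟩
    qfact (a ℕ.+ b) ≈⟨ ≡≃ (cong qfact e) ⟩
    qfact (b ℕ.+ a) ≈⟨ ≃sym (qbin-qfact b a) ⟩
    qbin (b ℕ.+ a) b ⊗ (qfact b ⊗ qfact a) ≈⟨ ⊗c (≡≃ (cong (λ N → qbin N b) (sym e))) (⊗comm _ _) ⟩
    qbin (a ℕ.+ b) b ⊗ (qfact a ⊗ qfact b) ≈⟨ ⊗comm _ _ ⟩
    (qfact a ⊗ qfact b) ⊗ qbin (a ℕ.+ b) b ∎)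
    where
    e : a ℕ.+ b ≡ b ℕ.+ a
    e = ℕP.+-comm a b

  pascal′ : ∀ a b → qbin (suc (a ℕ.+ b)) (suc a) ≃ Q (+ b) ⊗ qbin (a ℕ.+ b) a ⊕ qbin (a ℕ.+ b) (suc a)
  pascal′ a zero = begin
    qbin (suc (a ℕ.+ 0)) (suc a) ≈⟨ ≃trans (≡≃ (cong (λ N → qbin (suc N) (suc a)) (ℕP.+-identityʳ a))) (qbin-diag (suc a)) ⟩
    𝟙 ≈⟨ solve 0 (con (+ 1) := con (+ 1) :* con (+ 1) :+ con (+ 0)) ≃refl ⟩
    𝟙 ⊗ 𝟙 ⊕ 𝟘 ≈⟨ ≃sym (⊕c (⊗c Q0 c₁) c2) ⟩
    Q (+ 0) ⊗ qbin (a ℕ.+ 0) a ⊕ qbin (a ℕ.+ 0) (suc a) ∎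
    where
    c₁ : qbin (a ℕ.+ 0) a ≃ 𝟙
    c₁ = ≃trans (≡≃ (cong (λ N → qbin N a) (ℕP.+-identityʳ a))) (qbin-diag a)
    c2 : qbin (a ℕ.+ 0) (suc a) ≃ 𝟘
    c2 = ≃trans (≡≃ (cong (λ N → qbin N (suc a)) (ℕP.+-identityʳ a))) (qbin-above a (suc a) (ℕP.n<1+n a))
  pascal′ a (suc b) = cancel (Cancellable-* (Cancellable-qfact (suc a)) (Cancellable-qfact (suc b))) (begin
    X ⊗ qbin (suc (a ℕ.+ suc b)) (suc a) ≈⟨ ⊗comm _ _ ⟩
    qbin (suc a ℕ.+ suc b) (suc a) ⊗ X ≈⟨ qbin-qfact (suc a) (suc b) ⟩
    qfact (a ℕ.+ suc b) ⊗ qint (suc (a ℕ.+ suc b)) ≈⟨ ⊗r _ (≃trans (≡≃ (cong qint e2)) (qint-+ (suc b) (suc a))) ⟩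
    qfact (a ℕ.+ suc b) ⊗ (qint (suc b) ⊕ Q (+ suc b) ⊗ qint (suc a))
      ≈⟨ solve 4 (λ f x y z → f :* (x :+ z :* y) := z :* (y :* f) :+ x :* f) ≃refl (qfact (a ℕ.+ suc b)) (qint (suc b)) (qint (suc a)) (Q (+ suc b)) ⟩
    Q (+ suc b) ⊗ (qint (suc a) ⊗ qfact (a ℕ.+ suc b)) ⊕ qint (suc b) ⊗ qfact (a ℕ.+ suc b)
      ≈⟨ ⊕c (⊗r _ (⊗r _ (≃sym (qbin-qfact a (suc b))))) (⊗r _ (≃trans (≡≃ (cong qfact e1)) (≃sym (qbin-qfact (suc a) b)))) ⟩
    Q (+ suc b) ⊗ (qint (suc a) ⊗ (qbin (a ℕ.+ suc b) a ⊗ (qfact a ⊗ qfact (suc b)))) ⊕ qint (suc b) ⊗ (qbin (suc a ℕ.+ b) (suc a) ⊗ (qfact (suc a) ⊗ qfact b))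
      ≈⟨ ⊕r _ (⊗r _ (⊗l _ (≡≃ (cong (λ N → qbin N (suc a)) (sym e1))))) ⟩
    Q (+ suc b) ⊗ (qint (suc a) ⊗ (qbin (a ℕ.+ suc b) a ⊗ (qfact a ⊗ qfact (suc b)))) ⊕ qint (suc b) ⊗ (qbin (a ℕ.+ suc b) (suc a) ⊗ (qfact (suc a) ⊗ qfact b))
      ≈⟨ solve 8 (λ z x y c₁ c2 fa fb w → z :* (x :* (c₁ :* (fa :* (fb :* y)))) :+ y :* (c2 :* ((fa :* x) :* fb)) :=
             ((fa :* x) :* (fb :* y)) :* (z :* c₁ :+ c2)) ≃refl
             (Q (+ suc b)) (qint (suc a)) (qint (suc b)) (qbin (a ℕ.+ suc b) a) (qbin (a ℕ.+ suc b) (suc a)) (qfact a) (qfact b) 𝟘 ⟩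
    X ⊗ (Q (+ suc b) ⊗ qbin (a ℕ.+ suc b) a ⊕ qbin (a ℕ.+ suc b) (suc a)) ∎)
    where
    X : LPoly
    X = qfact (suc a) ⊗ qfact (suc b)
    e1 : a ℕ.+ suc b ≡ suc a ℕ.+ b
    e1 = ℕP.+-suc a b
    e2 : suc (a ℕ.+ suc b) ≡ suc b ℕ.+ suc a
    e2 = l a b
      where
      l : ∀ a b → suc (a ℕ.+ suc b) ≡ suc b ℕ.+ suc a
      l = NS.solve-∀

  pascal′-general : ∀ i k → qbin (suc i) (suc k) ≃ Q (+ i ℤ.- + k) ⊗ qbin i k ⊕ qbin i (suc k)
  pascal′-general i k with k ℕ.≤? i
  ... | yes le with ℕP.m≤n⇒∃[o]m+o≡n le
  ...   | b , refl = ≃trans (pascal′ k b) (⊕l _ (⊗l _ (Q-cong (sym (lem k b)))))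
    where
    lem : ∀ k b → + (k ℕ.+ b) ℤ.- + k ≡ + b
    lem k b = trans (cong (ℤ._- + k) (ℤP.pos-+ k b)) (l2 (+ k) (+ b))
      where
      l2 : ∀ x y → (x ℤ.+ y) ℤ.- x ≡ y
      l2 = ZS.solve-∀
  pascal′-general i k | no nle = begin
    qbin (suc i) (suc k) ≈⟨ qbin-above (suc i) (suc k) (s≤s lt) ⟩
    𝟘 ≈⟨ solve 1 (λ x → con (+ 0) := x :* con (+ 0) :+ con (+ 0)) ≃refl (Q (+ i ℤ.- + k)) ⟩
    Q (+ i ℤ.- + k) ⊗ 𝟘 ⊕ 𝟘 ≈⟨ ≃sym (⊕c (⊗r _ (qbin-above i k lt)) (qbin-above i (suc k) (ℕP.m<n⇒m<1+n lt))) ⟩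
    Q (+ i ℤ.- + k) ⊗ qbin i k ⊕ qbin i (suc k) ∎
    where
    lt : i < k
    lt = ℕP.≰⇒> nle

  hockey1 : ∀ i k → qbin (suc i) (suc k) ≃ sumUp i (λ t → Q (+ t ℤ.- + k) ⊗ qbin t k)
  hockey1 zero k = ≃trans (pascal′-general 0 k) (≃trans (⊕r _ (qbin-empty k)) (⊕idʳ _))
  hockey1 (suc i) k = ≃trans (pascal′-general (suc i) k) (≃trans (⊕r _ (hockey1 i k)) (⊕comm _ _))

  hockey2 : ∀ i l → qbin (suc (i ℕ.+ l)) (suc l) ≃ sumUp i (λ t → Q (+ t) ⊗ qbin (t ℕ.+ l) l)
  hockey2 zero l = begin
    qbin (suc l) (suc l) ≈⟨ qbin-diag (suc l) ⟩
    𝟙 ≈⟨ ≃sym (≃trans (⊗c Q0 (qbin-diag l)) (⊗idˡ 𝟙)) ⟩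
    Q (+ 0) ⊗ qbin l l ∎
  hockey2 (suc i) l = begin
    qbin (suc (suc i ℕ.+ l)) (suc l) ≈⟨ pascal′-general (suc i ℕ.+ l) l ⟩
    Q (+ (suc i ℕ.+ l) ℤ.- + l) ⊗ qbin (suc i ℕ.+ l) l ⊕ qbin (suc i ℕ.+ l) (suc l)
      ≈⟨ ⊕c (⊗l _ (Q-cong (lem (suc i) l))) (hockey2 i l) ⟩
    Q (+ suc i) ⊗ qbin (suc i ℕ.+ l) l ⊕ sumUp i (λ t → Q (+ t) ⊗ qbin (t ℕ.+ l) l) ≈⟨ ⊕comm _ _ ⟩
    sumUp (suc i) (λ t → Q (+ t) ⊗ qbin (t ℕ.+ l) l) ∎
    where
    lem : ∀ i l → + (i ℕ.+ l) ℤ.- + l ≡ + i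
    lem i l = trans (cong (ℤ._- + l) (ℤP.pos-+ i l)) (l2 (+ i) (+ l))
      where
      l2 : ∀ x y → (x ℤ.+ y) ℤ.- y ≡ x
      l2 = ZS.solve-∀

-- The divisibility framework: w-divisibility of Kprod, of ĥ-multiples, and of the
-- factor ĝ^(2r) (q^(-k);q)_s (q^(k+1);q)_s, assuming w-divisibility of 1.
module Divisibility where

  open PolyArith
  open LaurentRing
  open QAnalogues
  open FiniteSums
  open QBinomials
  open import Data.Nat as ℕ using (ℕ; zero; suc; _<_; _≤_)
  open import Data.Integer as ℤ using (ℤ; +_)
  import Data.Integer.Properties as ℤP
  import Data.Nat.Properties as ℕP
  import Data.Integer.Tactic.RingSolver as ZS
  import Data.Nat.Tactic.RingSolver as NS
  open import Data.Product using (Σ; _,_)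
  open import Data.Vec.Relation.Binary.Pointwise.Inductive using ([]; _∷_)
  open import Relation.Binary.PropositionalEquality using (_≡_; refl; sym; trans; cong)

  -- ĝ k = q^(-k) [2k+1]; the factor [2k+1] of each summand, normalised so that
  -- ĝ k² becomes a polynomial in ĥ k (see ĝ²-via-ĥ).
  ĝ : ℕ → LPoly
  ĝ k = Q (ℤ.- (+ k)) ⊗ qint (2 ℕ.* k ℕ.+ 1)

  -- ĥ k = q^(-k) [k][k+1], the quantity whose differences ĥ j - ĥ k factor nicely.
  ĥ : ℕ → LPoly
  ĥ k = Q (ℤ.- (+ k)) ⊗ (qint k ⊗ qint (suc k))

  -- Kprod j k = Π_{i<j} q^i (ĥ i - ĥ k): a polynomial of degree j in ĥ k that
  -- vanishes for k < j.
  Kprod : ℕ → ℕ → LPoly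
  Kprod zero k = 𝟙
  Kprod (suc j) k = (Q (+ j) ⊗ (ĥ j ⊖ ĥ k)) ⊗ Kprod j k

  Bin : ℕ → ℕ → LPoly
  Bin n k = qbin (2 ℕ.* n ℕ.+ 1) (n ℕ.∸ k)

  Mod : ℕ → LPoly
  Mod n = qint (2 ℕ.* n ℕ.+ 1) ⊗ qbin (2 ℕ.* n) n

  Usum : (ℕ → LPoly) → (ℕ → LPoly) → ℕ → LPoly
  Usum w f n = sumUp n (λ k → w k ⊗ (ĝ k ⊗ (Bin n k ⊗ f k)))

  Divisible : (ℕ → LPoly) → (ℕ → LPoly) → Set
  Divisible w f = ∀ n → Σ LPoly (λ C → Usum w f n ≃ C ⊗ Mod n)

  -- δ = 1 - q; multiplying by δ turns q-integers into differences of powers of q.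
  δ : LPoly
  δ = 𝟙 ⊖ q¹

  cancel-δ² : ∀ {L R} → δ ⊗ (δ ⊗ L) ≃ δ ⊗ (δ ⊗ R) → L ≃ R
  cancel-δ² h = cancel (Cancellable-1-Q 0) (cancel (Cancellable-1-Q 0) h)

  Q-cancel : ∀ k e → Q (+ (k ℕ.+ e)) ⊗ Q (ℤ.- (+ k)) ≃ Q (+ e)
  Q-cancel k e = ≃trans (≃sym (Q-add (+ (k ℕ.+ e)) (ℤ.- + k))) (Q-cong (trans (cong (ℤ._+ ℤ.- + k) (ℤP.pos-+ k e)) (l (+ k) (+ e))))
    where
    l : ∀ a b → (a ℤ.+ b) ℤ.+ ℤ.- a ≡ b
    l = ZS.solve-∀

  Q-unit : ∀ n x → x ≃ Q (ℤ.- (+ n)) ⊗ (Q (+ n) ⊗ x)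
  Q-unit n x = begin
    x ≈⟨ ≃sym (⊗idˡ x) ⟩
    𝟙 ⊗ x ≈⟨ ⊗l x (≃sym (≃trans (⊗comm _ _) (Q-inv (+ n)))) ⟩
    (Q (ℤ.- (+ n)) ⊗ Q (+ n)) ⊗ x ≈⟨ ⊗assoc _ _ _ ⟩
    Q (ℤ.- (+ n)) ⊗ (Q (+ n) ⊗ x) ∎

  -- The key factorisation q^(k+e) (ĥ (k+e) - ĥ k) = [e][2k+e+1].
  -- Proof: clear denominators by δ², then it is an identity in q^k and q^e.
  ĥ-difference : ∀ k e → Q (+ (k ℕ.+ e)) ⊗ (ĥ (k ℕ.+ e) ⊖ ĥ k) ≃ qint e ⊗ qint (e ℕ.+ suc (k ℕ.+ k))
  ĥ-difference k e = begin
    Q (+ n) ⊗ (Q (ℤ.- + n) ⊗ (qint n ⊗ qint (suc n)) ⊖ Q (ℤ.- + k) ⊗ (qint k ⊗ qint (suc k)))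
      ≈⟨ solve 6 (λ a b c z1 z2 z3 → a :* (b :* z1 :- c :* z2) := (a :* b) :* z1 :- (a :* c) :* z2) ≃refl
           (Q (+ n)) (Q (ℤ.- + n)) (Q (ℤ.- + k)) (qint n ⊗ qint (suc n)) (qint k ⊗ qint (suc k)) 𝟘 ⟩
    (Q (+ n) ⊗ Q (ℤ.- + n)) ⊗ (qint n ⊗ qint (suc n)) ⊖ (Q (+ n) ⊗ Q (ℤ.- + k)) ⊗ (qint k ⊗ qint (suc k))
      ≈⟨ solve-subst 6 (λ u v bn bn1 bk bk1 → u :* (bn :* bn1) :- v :* (bk :* bk1))
           (Q-inv (+ n) ∷ Q-cancel k e ∷ qint-+ k e ∷ ≃trans (≡≃ (cong qint (sym (ℕP.+-suc k e)))) (≃trans (qint-+ k (suc e)) (⊕r _ (⊗r _ (qint-suc e)))) ∷ ≃refl ∷ qint-suc k ∷ []) ⟩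
    𝟙 ⊗ ((X ⊕ A ⊗ Y) ⊗ (X ⊕ A ⊗ (𝟙 ⊕ q¹ ⊗ Y))) ⊖ E ⊗ (X ⊗ (𝟙 ⊕ q¹ ⊗ X))
      ≈⟨ cancel-δ² (begin
        δ ⊗ (δ ⊗ (𝟙 ⊗ ((X ⊕ A ⊗ Y) ⊗ (X ⊕ A ⊗ (𝟙 ⊕ q¹ ⊗ Y))) ⊖ E ⊗ (X ⊗ (𝟙 ⊕ q¹ ⊗ X))))
          ≈⟨ solve 5 (λ x y a ee q → (con (+ 1) :- q) :* ((con (+ 1) :- q) :* (con (+ 1) :* ((x :+ a :* y) :* (x :+ a :* (con (+ 1) :+ q :* y))) :- ee :* (x :* (con (+ 1) :+ q :* x))))
                 := ((con (+ 1) :- q) :* x :+ a :* ((con (+ 1) :- q) :* y)) :* ((con (+ 1) :- q) :* x :+ a :* ((con (+ 1) :- q) :+ q :* ((con (+ 1) :- q) :* y)))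
                    :- ee :* ((con (+ 1) :- q) :* x) :* ((con (+ 1) :- q) :+ q :* ((con (+ 1) :- q) :* x))) ≃refl X Y A E q¹ ⟩
        (δ ⊗ X ⊕ A ⊗ (δ ⊗ Y)) ⊗ (δ ⊗ X ⊕ A ⊗ (δ ⊕ q¹ ⊗ (δ ⊗ Y))) ⊖ E ⊗ (δ ⊗ X) ⊗ (δ ⊕ q¹ ⊗ (δ ⊗ X))
          ≈⟨ solve-subst 5 (λ x' y' a ee q → (x' :+ a :* y') :* (x' :+ a :* ((con (+ 1) :- q) :+ q :* y')) :- ee :* x' :* ((con (+ 1) :- q) :+ q :* x'))
               (qint-geometric k ∷ qint-geometric e ∷ ≃refl ∷ ≃refl ∷ ≃refl ∷ []) ⟩
        ((𝟙 ⊖ A) ⊕ A ⊗ (𝟙 ⊖ E)) ⊗ ((𝟙 ⊖ A) ⊕ A ⊗ (δ ⊕ q¹ ⊗ (𝟙 ⊖ E))) ⊖ E ⊗ (𝟙 ⊖ A) ⊗ (δ ⊕ q¹ ⊗ (𝟙 ⊖ A))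
          ≈⟨ solve 3 (λ a ee q → ((con (+ 1) :- a) :+ a :* (con (+ 1) :- ee)) :* ((con (+ 1) :- a) :+ a :* ((con (+ 1) :- q) :+ q :* (con (+ 1) :- ee)))
                   :- ee :* (con (+ 1) :- a) :* ((con (+ 1) :- q) :+ q :* (con (+ 1) :- a))
                 := (con (+ 1) :- ee) :* ((con (+ 1) :- ee) :+ ee :* ((con (+ 1) :- a) :+ a :* ((con (+ 1) :- q) :+ q :* (con (+ 1) :- a))))) ≃refl A E q¹ ⟩
        (𝟙 ⊖ E) ⊗ ((𝟙 ⊖ E) ⊕ E ⊗ ((𝟙 ⊖ A) ⊕ A ⊗ (δ ⊕ q¹ ⊗ (𝟙 ⊖ A))))
          ≈⟨ ≃sym (solve-subst 5 (λ x' y' a ee q → y' :* (y' :+ ee :* (x' :+ a :* ((con (+ 1) :- q) :+ q :* x'))))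
               (qint-geometric k ∷ qint-geometric e ∷ ≃refl ∷ ≃refl ∷ ≃refl ∷ [])) ⟩
        (δ ⊗ Y) ⊗ ((δ ⊗ Y) ⊕ E ⊗ ((δ ⊗ X) ⊕ A ⊗ (δ ⊕ q¹ ⊗ (δ ⊗ X))))
          ≈⟨ solve 5 (λ x y a ee q → ((con (+ 1) :- q) :* y) :* (((con (+ 1) :- q) :* y) :+ ee :* (((con (+ 1) :- q) :* x) :+ a :* ((con (+ 1) :- q) :+ q :* ((con (+ 1) :- q) :* x))))
                := (con (+ 1) :- q) :* ((con (+ 1) :- q) :* (y :* (y :+ ee :* (x :+ a :* (con (+ 1) :+ q :* x)))))) ≃refl X Y A E q¹ ⟩
        δ ⊗ (δ ⊗ (Y ⊗ (Y ⊕ E ⊗ (X ⊕ A ⊗ (𝟙 ⊕ q¹ ⊗ X))))) ∎) ⟩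
    Y ⊗ (Y ⊕ E ⊗ (X ⊕ A ⊗ (𝟙 ⊕ q¹ ⊗ X)))
      ≈⟨ ⊗r Y (≃sym (≃trans (qint-+ e (suc (k ℕ.+ k))) (⊕r Y (⊗r E (≃trans (≡≃ (cong qint (sym (ℕP.+-suc k k)))) (≃trans (qint-+ k (suc k)) (⊕r X (⊗r A (qint-suc k))))))))) ⟩
    qint e ⊗ qint (e ℕ.+ suc (k ℕ.+ k)) ∎
    where
    n : ℕ
    n = k ℕ.+ e
    X : LPoly
    X = qint k
    Y : LPoly
    Y = qint e
    A : LPoly
    A = Q (+ k)
    E : LPoly
    E = Q (+ e)

  ĥ-gap-Bin : ∀ k d → (ĥ (suc (k ℕ.+ d)) ⊖ ĥ k) ⊗ Bin (suc (k ℕ.+ d)) k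
             ≃ Q (ℤ.- (+ suc (k ℕ.+ d))) ⊗ ((qint (2 ℕ.* suc (k ℕ.+ d)) ⊗ qint (2 ℕ.* suc (k ℕ.+ d) ℕ.+ 1)) ⊗ Bin (k ℕ.+ d) k)
  ĥ-gap-Bin k d = begin
    (ĥ n ⊖ ĥ k) ⊗ Bin n k ≈⟨ Q-unit n _ ⟩
    Q (ℤ.- (+ n)) ⊗ (Q (+ n) ⊗ ((ĥ n ⊖ ĥ k) ⊗ Bin n k)) ≈⟨ ⊗r _ (≃sym (⊗assoc _ _ _)) ⟩
    Q (ℤ.- (+ n)) ⊗ ((Q (+ n) ⊗ (ĥ n ⊖ ĥ k)) ⊗ Bin n k) ≈⟨ ⊗r _ (⊗c H' Bn) ⟩
    Q (ℤ.- (+ n)) ⊗ ((qint (suc d) ⊗ qint (suc b2)) ⊗ qbin (suc (d ℕ.+ b1)) (suc d)) ≈⟨ ⊗r _ (solve 3 (λ x y z → (x :* y) :* z := y :* (x :* z)) ≃refl _ _ _) ⟩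
    Q (ℤ.- (+ n)) ⊗ (qint (suc b2) ⊗ (qint (suc d) ⊗ qbin (suc (d ℕ.+ b1)) (suc d))) ≈⟨ ⊗r _ (⊗r _ (absorb-top d b1)) ⟩
    Q (ℤ.- (+ n)) ⊗ (qint (suc b2) ⊗ (qint (suc (d ℕ.+ b1)) ⊗ qbin (d ℕ.+ b1) d)) ≈⟨ ⊗r _ (solve 3 (λ x y z → x :* (y :* z) := y :* (x :* z)) ≃refl _ _ _) ⟩
    Q (ℤ.- (+ n)) ⊗ (qint (suc (d ℕ.+ b1)) ⊗ (qint (suc b2) ⊗ qbin (d ℕ.+ b1) d)) ≈⟨ ⊗r _ (⊗r _ (⊗r _ (≡≃ (cong (λ N → qbin N d) (l2 k d))))) ⟩
    Q (ℤ.- (+ n)) ⊗ (qint (suc (d ℕ.+ b1)) ⊗ (qint (suc b2) ⊗ qbin (suc (d ℕ.+ b2)) d)) ≈⟨ ⊗r _ (⊗r _ (absorb-bottom d b2)) ⟩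
    Q (ℤ.- (+ n)) ⊗ (qint (suc (d ℕ.+ b1)) ⊗ (qint (suc (d ℕ.+ b2)) ⊗ qbin (d ℕ.+ b2) d))
      ≈⟨ ⊗r _ (≃trans (solve 3 (λ x y z → x :* (y :* z) := (y :* x) :* z) ≃refl _ _ _)
           (⊗c (⊗c (≡≃ (cong qint (l4 k d))) (≡≃ (cong qint (l1 k d)))) (≡≃ (trans (cong (λ N → qbin N d) (l5 k d)) (cong (qbin (2 ℕ.* (k ℕ.+ d) ℕ.+ 1)) (sym (ℕP.m+n∸m≡n k d))))))) ⟩
    Q (ℤ.- (+ n)) ⊗ ((qint (2 ℕ.* n) ⊗ qint (2 ℕ.* n ℕ.+ 1)) ⊗ Bin (k ℕ.+ d) k) ∎
    where
    n : ℕ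
    n = suc (k ℕ.+ d)
    b1 : ℕ
    b1 = suc (suc (k ℕ.+ k ℕ.+ d))
    b2 : ℕ
    b2 = suc (k ℕ.+ k ℕ.+ d)
    l1 : ∀ k d → suc (d ℕ.+ suc (suc (k ℕ.+ k ℕ.+ d))) ≡ 2 ℕ.* suc (k ℕ.+ d) ℕ.+ 1
    l1 = NS.solve-∀
    l2 : ∀ k d → d ℕ.+ suc (suc (k ℕ.+ k ℕ.+ d)) ≡ suc (d ℕ.+ suc (k ℕ.+ k ℕ.+ d))
    l2 = NS.solve-∀
    l3 : ∀ k d → suc d ℕ.+ suc (k ℕ.+ k) ≡ suc (suc (k ℕ.+ k ℕ.+ d))
    l3 = NS.solve-∀
    l4 : ∀ k d → suc (d ℕ.+ suc (k ℕ.+ k ℕ.+ d)) ≡ 2 ℕ.* suc (k ℕ.+ d)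
    l4 = NS.solve-∀
    l5 : ∀ k d → d ℕ.+ suc (k ℕ.+ k ℕ.+ d) ≡ 2 ℕ.* (k ℕ.+ d) ℕ.+ 1
    l5 = NS.solve-∀
    l6 : ∀ k d → suc (k ℕ.+ d) ≡ k ℕ.+ suc d
    l6 = NS.solve-∀
    H' : Q (+ n) ⊗ (ĥ n ⊖ ĥ k) ≃ qint (suc d) ⊗ qint (suc b2)
    H' = ≃trans (≡≃ (cong (λ N → Q (+ N) ⊗ (ĥ N ⊖ ĥ k)) (l6 k d))) (≃trans (ĥ-difference k (suc d)) (⊗r _ (≡≃ (cong qint (l3 k d)))))
    Bn : Bin n k ≃ qbin (suc (d ℕ.+ b1)) (suc d)
    Bn = ≡≃ (trans (cong (qbin (2 ℕ.* n ℕ.+ 1)) (trans (cong (ℕ._∸ k) (l6 k d)) (ℕP.m+n∸m≡n k (suc d)))) (cong (λ N → qbin N (suc d)) (sym (l1 k d))))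

  Mod-step : ∀ m → (qint (2 ℕ.* suc m) ⊗ qint (2 ℕ.* suc m ℕ.+ 1)) ⊗ Mod m ≃ (qint (suc m) ⊗ qint (suc m)) ⊗ Mod (suc m)
  Mod-step m = ≃sym (begin
    (qint (suc m) ⊗ qint (suc m)) ⊗ (qint (2 ℕ.* suc m ℕ.+ 1) ⊗ qbin (2 ℕ.* suc m) (suc m))
      ≈⟨ solve 3 (λ x y z → (x :* x) :* (y :* z) := y :* (x :* (x :* z))) ≃refl _ _ _ ⟩
    qint (2 ℕ.* suc m ℕ.+ 1) ⊗ (qint (suc m) ⊗ (qint (suc m) ⊗ qbin (2 ℕ.* suc m) (suc m)))
      ≈⟨ ⊗r _ (⊗r _ (≃trans (⊗r _ (≡≃ (cong (λ N → qbin N (suc m)) (l1 m)))) (absorb-top m (suc m)))) ⟩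
    qint (2 ℕ.* suc m ℕ.+ 1) ⊗ (qint (suc m) ⊗ (qint (suc (m ℕ.+ suc m)) ⊗ qbin (m ℕ.+ suc m) m))
      ≈⟨ ⊗r _ (⊗r _ (⊗r _ (≃trans (qbin-sym m (suc m)) (≡≃ (cong (λ N → qbin N (suc m)) (ℕP.+-suc m m)))))) ⟩
    qint (2 ℕ.* suc m ℕ.+ 1) ⊗ (qint (suc m) ⊗ (qint (suc (m ℕ.+ suc m)) ⊗ qbin (suc (m ℕ.+ m)) (suc m)))
      ≈⟨ ⊗r _ (solve 3 (λ x y z → x :* (y :* z) := y :* (x :* z)) ≃refl _ _ _) ⟩
    qint (2 ℕ.* suc m ℕ.+ 1) ⊗ (qint (suc (m ℕ.+ suc m)) ⊗ (qint (suc m) ⊗ qbin (suc (m ℕ.+ m)) (suc m)))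
      ≈⟨ ⊗r _ (⊗r _ (absorb-top m m)) ⟩
    qint (2 ℕ.* suc m ℕ.+ 1) ⊗ (qint (suc (m ℕ.+ suc m)) ⊗ (qint (suc (m ℕ.+ m)) ⊗ qbin (m ℕ.+ m) m))
      ≈⟨ ⊗r _ (⊗c (≡≃ (cong qint (sym (l1 m)))) (⊗c (≡≃ (cong qint (l2 m))) (≡≃ (cong (λ N → qbin N m) (l3 m))))) ⟩
    qint (2 ℕ.* suc m ℕ.+ 1) ⊗ (qint (2 ℕ.* suc m) ⊗ (qint (2 ℕ.* m ℕ.+ 1) ⊗ qbin (2 ℕ.* m) m))
      ≈⟨ solve 4 (λ a b c d → a :* (b :* (c :* d)) := (b :* a) :* (c :* d)) ≃refl _ _ _ _ ⟩
    (qint (2 ℕ.* suc m) ⊗ qint (2 ℕ.* suc m ℕ.+ 1)) ⊗ Mod m ∎)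
    where
    l1 : ∀ m → 2 ℕ.* suc m ≡ suc (m ℕ.+ suc m)
    l1 = NS.solve-∀
    l2 : ∀ m → suc (m ℕ.+ m) ≡ 2 ℕ.* m ℕ.+ 1
    l2 = NS.solve-∀
    l3 : ∀ m → m ℕ.+ m ≡ 2 ℕ.* m
    l3 = NS.solve-∀

  cstep : ℕ → LPoly
  cstep m = Q (ℤ.- (+ suc m)) ⊗ (qint (2 ℕ.* suc m) ⊗ qint (2 ℕ.* suc m ℕ.+ 1))

  ĥ-Bin : ∀ m k → k ≤ m → ĥ k ⊗ Bin (suc m) k ≃ ĥ (suc m) ⊗ Bin (suc m) k ⊖ cstep m ⊗ Bin m k
  ĥ-Bin m k le with ℕP.m≤n⇒∃[o]m+o≡n le
  ... | d , refl = begin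
    ĥ k ⊗ B1 ≈⟨ solve 3 (λ a b x → b :* x := a :* x :- (a :- b) :* x) ≃refl (ĥ n) (ĥ k) B1 ⟩
    ĥ n ⊗ B1 ⊖ (ĥ n ⊖ ĥ k) ⊗ B1 ≈⟨ ⊖c ≃refl (ĥ-gap-Bin k d) ⟩
    ĥ n ⊗ B1 ⊖ Q (ℤ.- (+ n)) ⊗ ((qint (2 ℕ.* n) ⊗ qint (2 ℕ.* n ℕ.+ 1)) ⊗ Bin (k ℕ.+ d) k)
      ≈⟨ ⊖c ≃refl (≃sym (⊗assoc _ _ _)) ⟩
    ĥ n ⊗ B1 ⊖ cstep (k ℕ.+ d) ⊗ Bin (k ℕ.+ d) k ∎
    where
    n : ℕ
    n = suc (k ℕ.+ d)
    B1 : LPoly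
    B1 = Bin n k

  Vsum : (ℕ → LPoly) → (ℕ → LPoly) → ℕ → LPoly
  Vsum w f n = sumUp n (λ k → w k ⊗ (ĝ k ⊗ (Bin n k ⊗ (ĥ k ⊗ f k))))

  Vsum-step : ∀ w f m → Vsum w f (suc m) ≃ ĥ (suc m) ⊗ Usum w f (suc m) ⊖ cstep m ⊗ Usum w f m
  Vsum-step w f m = begin
    sumUp m F ⊕ F (suc m) ≈⟨ ⊕l _ (sumUp-cong m (λ k le → pt k le)) ⟩
    sumUp m (λ k → ĥ n ⊗ G k ⊖ cstep m ⊗ G' k) ⊕ F (suc m) ≈⟨ ⊕c (≃trans (sumUp-- m _ _) (⊖c (sumUp-* m (ĥ n) G) (sumUp-* m (cstep m) G'))) lastpt ⟩
    (ĥ n ⊗ sumUp m G ⊖ cstep m ⊗ sumUp m G') ⊕ ĥ n ⊗ G (suc m)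
      ≈⟨ solve 5 (λ a b c d e → (a :* b :- c :* d) :+ a :* e := a :* (b :+ e) :- c :* d) ≃refl (ĥ n) (sumUp m G) (cstep m) (sumUp m G') (G (suc m)) ⟩
    ĥ n ⊗ Usum w f n ⊖ cstep m ⊗ Usum w f m ∎
    where
    n : ℕ
    n = suc m
    F : ℕ → LPoly
    F k = w k ⊗ (ĝ k ⊗ (Bin n k ⊗ (ĥ k ⊗ f k)))
    G : ℕ → LPoly
    G k = w k ⊗ (ĝ k ⊗ (Bin n k ⊗ f k))
    G' : ℕ → LPoly
    G' k = w k ⊗ (ĝ k ⊗ (Bin m k ⊗ f k))
    pt : ∀ k → k ≤ m → F k ≃ ĥ n ⊗ G k ⊖ cstep m ⊗ G' k
    pt k le = begin
      w k ⊗ (ĝ k ⊗ (Bin n k ⊗ (ĥ k ⊗ f k))) ≈⟨ solve 5 (λ a b c d e → a :* (b :* (c :* (d :* e))) := a :* (b :* ((d :* c) :* e))) ≃refl (w k) (ĝ k) (Bin n k) (ĥ k) (f k) ⟩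
      w k ⊗ (ĝ k ⊗ ((ĥ k ⊗ Bin n k) ⊗ f k)) ≈⟨ ⊗r _ (⊗r _ (⊗l _ (ĥ-Bin m k le))) ⟩
      w k ⊗ (ĝ k ⊗ ((ĥ n ⊗ Bin n k ⊖ cstep m ⊗ Bin m k) ⊗ f k))
        ≈⟨ solve 7 (λ a b x y c d e → a :* (b :* ((x :* y :- c :* d) :* e)) := x :* (a :* (b :* (y :* e))) :- c :* (a :* (b :* (d :* e))))
             ≃refl (w k) (ĝ k) (ĥ n) (Bin n k) (cstep m) (Bin m k) (f k) ⟩
      ĥ n ⊗ G k ⊖ cstep m ⊗ G' k ∎
    lastpt : F (suc m) ≃ ĥ n ⊗ G (suc m)
    lastpt = solve 5 (λ a b c d e → a :* (b :* (c :* (d :* e))) := d :* (a :* (b :* (c :* e)))) ≃refl (w n) (ĝ n) (Bin n n) (ĥ n) (f n)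

  Usum-Kprod-suc : ∀ w j n → Usum w (Kprod (suc j)) n ≃ Q (+ j) ⊗ (ĥ j ⊗ Usum w (Kprod j) n ⊖ Vsum w (Kprod j) n)
  Usum-Kprod-suc w j n = begin
    Usum w (Kprod (suc j)) n ≈⟨ sumUp-cong′ n (λ k → solve 7 (λ a b c qj x y kk → a :* (b :* (c :* ((qj :* (x :- y)) :* kk))) :=
          qj :* (x :* (a :* (b :* (c :* kk)))) :- qj :* (a :* (b :* (c :* (y :* kk))))) ≃refl (w k) (ĝ k) (Bin n k) (Q (+ j)) (ĥ j) (ĥ k) (Kprod j k)) ⟩
    sumUp n (λ k → Q (+ j) ⊗ (ĥ j ⊗ (w k ⊗ (ĝ k ⊗ (Bin n k ⊗ Kprod j k)))) ⊖ Q (+ j) ⊗ (w k ⊗ (ĝ k ⊗ (Bin n k ⊗ (ĥ k ⊗ Kprod j k))))) ≈⟨ sumUp-- n _ _ ⟩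
    sumUp n (λ k → Q (+ j) ⊗ (ĥ j ⊗ (w k ⊗ (ĝ k ⊗ (Bin n k ⊗ Kprod j k))))) ⊖ sumUp n (λ k → Q (+ j) ⊗ (w k ⊗ (ĝ k ⊗ (Bin n k ⊗ (ĥ k ⊗ Kprod j k))))) ≈⟨ ⊖c (≃trans (sumUp-* n (Q (+ j)) _) (⊗r _ (sumUp-* n (ĥ j) _))) (sumUp-* n (Q (+ j)) _) ⟩
    Q (+ j) ⊗ (ĥ j ⊗ Usum w (Kprod j) n) ⊖ Q (+ j) ⊗ Vsum w (Kprod j) n ≈⟨ solve 3 (λ a b c → a :* b :- a :* c := a :* (b :- c)) ≃refl _ _ _ ⟩
    Q (+ j) ⊗ (ĥ j ⊗ Usum w (Kprod j) n ⊖ Vsum w (Kprod j) n) ∎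

  Vsum-zero : ∀ w f → Vsum w f 0 ≃ ĥ 0 ⊗ Usum w f 0
  Vsum-zero w f = solve 5 (λ a b c d e → a :* (b :* (c :* (d :* e))) := d :* (a :* (b :* (c :* e)))) ≃refl (w 0) (ĝ 0) (Bin 0 0) (ĥ 0) (f 0)

  -- If the constant 1 is w-divisible then so is every Kprod j: induction on j,
  -- using Vsum-step and Mod-step for the divisibility of each piece.
  Divisible-Kprod : ∀ w → Divisible w (λ _ → 𝟙) → ∀ j → Divisible w (Kprod j)
  Divisible-Kprod w base zero = base
  Divisible-Kprod w base (suc j) zero with Divisible-Kprod w base j 0
  ... | C0 , h0 = (Q (+ j) ⊗ (ĥ j ⊖ ĥ 0)) ⊗ C0 , (begin
    Usum w (Kprod (suc j)) 0 ≈⟨ Usum-Kprod-suc w j 0 ⟩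
    Q (+ j) ⊗ (ĥ j ⊗ U ⊖ Vsum w (Kprod j) 0) ≈⟨ ⊗r _ (⊖c ≃refl (Vsum-zero w (Kprod j))) ⟩
    Q (+ j) ⊗ (ĥ j ⊗ U ⊖ ĥ 0 ⊗ U) ≈⟨ solve 4 (λ a b c u → a :* (b :* u :- c :* u) := (a :* (b :- c)) :* u) ≃refl _ _ _ _ ⟩
    (Q (+ j) ⊗ (ĥ j ⊖ ĥ 0)) ⊗ U ≈⟨ ⊗r _ h0 ⟩
    (Q (+ j) ⊗ (ĥ j ⊖ ĥ 0)) ⊗ (C0 ⊗ Mod 0) ≈⟨ ≃sym (⊗assoc _ _ _) ⟩
    ((Q (+ j) ⊗ (ĥ j ⊖ ĥ 0)) ⊗ C0) ⊗ Mod 0 ∎)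
    where
    U : LPoly
    U = Usum w (Kprod j) 0
  Divisible-Kprod w base (suc j) (suc m) with Divisible-Kprod w base j (suc m) | Divisible-Kprod w base j m
  ... | Cn , hn | Cm , hm = Q (+ j) ⊗ ((ĥ j ⊖ ĥ n) ⊗ Cn ⊕ Q (ℤ.- (+ n)) ⊗ ((qint n ⊗ qint n) ⊗ Cm)) , (begin
    Usum w (Kprod (suc j)) n ≈⟨ Usum-Kprod-suc w j n ⟩
    Q (+ j) ⊗ (ĥ j ⊗ Un ⊖ Vsum w (Kprod j) n) ≈⟨ ⊗r _ (⊖c ≃refl (Vsum-step w (Kprod j) m)) ⟩
    Q (+ j) ⊗ (ĥ j ⊗ Un ⊖ (ĥ n ⊗ Un ⊖ cstep m ⊗ Um))
      ≈⟨ solve 5 (λ a b c u d → a :* (b :* u :- (c :* u :- d)) := a :* ((b :- c) :* u :+ d)) ≃refl (Q (+ j)) (ĥ j) (ĥ n) Un (cstep m ⊗ Um) ⟩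
    Q (+ j) ⊗ ((ĥ j ⊖ ĥ n) ⊗ Un ⊕ cstep m ⊗ Um) ≈⟨ ⊗r _ (⊕c (⊗r _ hn) (⊗r _ hm)) ⟩
    Q (+ j) ⊗ ((ĥ j ⊖ ĥ n) ⊗ (Cn ⊗ Mod n) ⊕ cstep m ⊗ (Cm ⊗ Mod m))
      ≈⟨ ⊗r _ (⊕r _ (≃trans (solve 5 (λ qi x y c mm → (qi :* (x :* y)) :* (c :* mm) := (qi :* c) :* ((x :* y) :* mm)) ≃refl (Q (ℤ.- (+ n))) (qint (2 ℕ.* n)) (qint (2 ℕ.* n ℕ.+ 1)) Cm (Mod m))
           (⊗r _ (Mod-step m)))) ⟩
    Q (+ j) ⊗ ((ĥ j ⊖ ĥ n) ⊗ (Cn ⊗ Mod n) ⊕ (Q (ℤ.- (+ n)) ⊗ Cm) ⊗ ((qint n ⊗ qint n) ⊗ Mod n))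
      ≈⟨ solve 8 (λ a x c qi cm b1 b2 mm → a :* (x :* (c :* mm) :+ (qi :* cm) :* ((b1 :* b2) :* mm)) := (a :* (x :* c :+ qi :* ((b1 :* b2) :* cm))) :* mm)
           ≃refl (Q (+ j)) (ĥ j ⊖ ĥ n) Cn (Q (ℤ.- (+ n))) Cm (qint n) (qint n) (Mod n) ⟩
    (Q (+ j) ⊗ ((ĥ j ⊖ ĥ n) ⊗ Cn ⊕ Q (ℤ.- (+ n)) ⊗ ((qint n ⊗ qint n) ⊗ Cm))) ⊗ Mod n ∎)
    where
    n : ℕ
    n = suc m
    Un : LPoly
    Un = Usum w (Kprod j) n
    Um : LPoly
    Um = Usum w (Kprod j) m

  Usum-cong : ∀ w {f f'} → (∀ k → f k ≃ f' k) → ∀ n → Usum w f n ≃ Usum w f' n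
  Usum-cong w h n = sumUp-cong′ n (λ k → ⊗r _ (⊗r _ (⊗r _ (h k))))

  Divisible-cong : ∀ w {f f'} → (∀ k → f k ≃ f' k) → Divisible w f → Divisible w f'
  Divisible-cong w h G n with G n
  ... | C , e = C , ≃trans (≃sym (Usum-cong w h n)) e

  Divisible-+ : ∀ w {f f'} → Divisible w f → Divisible w f' → Divisible w (λ k → f k ⊕ f' k)
  Divisible-+ w {f} {f'} G G' n with G n | G' n
  ... | C , e | C' , e' = C ⊕ C' , (begin
    Usum w (λ k → f k ⊕ f' k) n ≈⟨ sumUp-cong′ n (λ k → solve 5 (λ a b c x y → a :* (b :* (c :* (x :+ y))) := a :* (b :* (c :* x)) :+ a :* (b :* (c :* y))) ≃refl (w k) (ĝ k) (Bin n k) (f k) (f' k)) ⟩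
    sumUp n (λ k → w k ⊗ (ĝ k ⊗ (Bin n k ⊗ f k)) ⊕ w k ⊗ (ĝ k ⊗ (Bin n k ⊗ f' k))) ≈⟨ sumUp-+ n _ _ ⟩
    Usum w f n ⊕ Usum w f' n ≈⟨ ⊕c e e' ⟩
    C ⊗ Mod n ⊕ C' ⊗ Mod n ≈⟨ ≃sym (⊗distribʳ _ _ _) ⟩
    (C ⊕ C') ⊗ Mod n ∎)

  Divisible-* : ∀ w c {f} → Divisible w f → Divisible w (λ k → c ⊗ f k)
  Divisible-* w c {f} G n with G n
  ... | C , e = c ⊗ C , (begin
    Usum w (λ k → c ⊗ f k) n ≈⟨ sumUp-cong′ n (λ k → solve 5 (λ a b d c x → a :* (b :* (d :* (c :* x))) := c :* (a :* (b :* (d :* x)))) ≃refl (w k) (ĝ k) (Bin n k) c (f k)) ⟩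
    sumUp n (λ k → c ⊗ (w k ⊗ (ĝ k ⊗ (Bin n k ⊗ f k)))) ≈⟨ sumUp-* n c _ ⟩
    c ⊗ Usum w f n ≈⟨ ⊗r c e ⟩
    c ⊗ (C ⊗ Mod n) ≈⟨ ≃sym (⊗assoc _ _ _) ⟩
    (c ⊗ C) ⊗ Mod n ∎)

  Divisible-lin : ∀ w {f f'} a b → Divisible w f → Divisible w f' → Divisible w (λ k → a ⊗ f k ⊕ b ⊗ f' k)
  Divisible-lin w a b G G' = Divisible-+ w (Divisible-* w a G) (Divisible-* w b G')

  ĥ-Kprod : ∀ s k → ĥ k ⊗ Kprod s k ≃ ĥ s ⊗ Kprod s k ⊖ Q (ℤ.- (+ s)) ⊗ Kprod (suc s) k
  ĥ-Kprod s k = begin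
    ĥ k ⊗ Kprod s k ≈⟨ solve 3 (λ a b y → b :* y := a :* y :- (a :- b) :* y) ≃refl (ĥ s) (ĥ k) (Kprod s k) ⟩
    ĥ s ⊗ Kprod s k ⊖ (ĥ s ⊖ ĥ k) ⊗ Kprod s k ≈⟨ ⊖c ≃refl (Q-unit s _) ⟩
    ĥ s ⊗ Kprod s k ⊖ Q (ℤ.- (+ s)) ⊗ (Q (+ s) ⊗ ((ĥ s ⊖ ĥ k) ⊗ Kprod s k)) ≈⟨ ⊖c ≃refl (⊗r _ (≃sym (⊗assoc _ _ _))) ⟩
    ĥ s ⊗ Kprod s k ⊖ Q (ℤ.- (+ s)) ⊗ Kprod (suc s) k ∎

  Divisible-ĥ : ∀ w (F : ℕ → LPoly) → (∀ s → Divisible w (λ k → F k ⊗ Kprod s k)) → ∀ s → Divisible w (λ k → (F k ⊗ ĥ k) ⊗ Kprod s k)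
  Divisible-ĥ w F G s = Divisible-cong w pt (Divisible-lin w (ĥ s) (⊖' (Q (ℤ.- (+ s)))) (G s) (G (suc s)))
    where
    pt : ∀ k → ĥ s ⊗ (F k ⊗ Kprod s k) ⊕ ⊖' (Q (ℤ.- (+ s))) ⊗ (F k ⊗ Kprod (suc s) k) ≃ (F k ⊗ ĥ k) ⊗ Kprod s k
    pt k = begin
      ĥ s ⊗ (F k ⊗ Kprod s k) ⊕ ⊖' (Q (ℤ.- (+ s))) ⊗ (F k ⊗ Kprod (suc s) k)
        ≈⟨ solve 5 (λ a f x qi y → a :* (f :* x) :+ (:- qi) :* (f :* y) := f :* (a :* x :- qi :* y)) ≃refl (ĥ s) (F k) (Kprod s k) (Q (ℤ.- (+ s))) (Kprod (suc s) k) ⟩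
      F k ⊗ (ĥ s ⊗ Kprod s k ⊖ Q (ℤ.- (+ s)) ⊗ Kprod (suc s) k) ≈⟨ ⊗r _ (≃sym (ĥ-Kprod s k)) ⟩
      F k ⊗ (ĥ k ⊗ Kprod s k) ≈⟨ ≃sym (⊗assoc _ _ _) ⟩
      (F k ⊗ ĥ k) ⊗ Kprod s k ∎

  c₁ : LPoly
  c₁ = cst (+ 2) ⊗ (𝟙 ⊕ q¹)

  Q-odd : ∀ k → Q (+ (2 ℕ.* k ℕ.+ 1)) ≃ (Q (+ k) ⊗ Q (+ k)) ⊗ q¹
  Q-odd k = ≃trans (≡≃ (cong (λ N → Q (+ N)) (l k))) (≃trans (Q+ (k ℕ.+ k) 1) (⊗l _ (Q+ k k)))
    where
    l : ∀ k → 2 ℕ.* k ℕ.+ 1 ≡ k ℕ.+ k ℕ.+ 1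
    l = NS.solve-∀

  ĝ²-via-ĥ : ∀ k → ĝ k ⊗ ĝ k ≃ 𝟙 ⊕ c₁ ⊗ ĥ k ⊕ (δ ⊗ δ) ⊗ (ĥ k ⊗ ĥ k)
  ĝ²-via-ĥ k = cancel (Cancellable-* (Cancellable-* (Cancellable-Q (+ k)) (Cancellable-Q (+ k))) (Cancellable-* (Cancellable-1-Q 0) (Cancellable-1-Q 0))) (begin
    (A ⊗ A ⊗ (δ ⊗ δ)) ⊗ ((Ki ⊗ X) ⊗ (Ki ⊗ X))
      ≈⟨ solve 4 (λ a ki x q → (a :* a :* ((con (+ 1) :- q) :* (con (+ 1) :- q))) :* ((ki :* x) :* (ki :* x)) :=
            ((ki :* a) :* ((con (+ 1) :- q) :* x)) :* ((ki :* a) :* ((con (+ 1) :- q) :* x))) ≃refl A Ki X q¹ ⟩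
    ((Ki ⊗ A) ⊗ (δ ⊗ X)) ⊗ ((Ki ⊗ A) ⊗ (δ ⊗ X))
      ≈⟨ solve-subst 2 (λ u x' → (u :* x') :* (u :* x')) (u1 ∷ ≃trans (qint-geometric (2 ℕ.* k ℕ.+ 1)) (⊖c ≃refl (Q-odd k)) ∷ []) ⟩
    (𝟙 ⊗ (𝟙 ⊖ (A ⊗ A) ⊗ q¹)) ⊗ (𝟙 ⊗ (𝟙 ⊖ (A ⊗ A) ⊗ q¹))
      ≈⟨ solve 2 (λ a q → (con (+ 1) :* (con (+ 1) :- (a :* a) :* q)) :* (con (+ 1) :* (con (+ 1) :- (a :* a) :* q)) :=
           (a :* a :* ((con (+ 1) :- q) :* (con (+ 1) :- q))) :+ con (+ 2) :* (con (+ 1) :+ q) :* a :* con (+ 1) :* ((con (+ 1) :- a) :* (con (+ 1) :- a :* q))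
           :+ (con (+ 1) :* con (+ 1)) :* (((con (+ 1) :- a) :* (con (+ 1) :- a :* q)) :* ((con (+ 1) :- a) :* (con (+ 1) :- a :* q)))) ≃refl A q¹ ⟩
    (A ⊗ A ⊗ (δ ⊗ δ)) ⊕ cst (+ 2) ⊗ (𝟙 ⊕ q¹) ⊗ A ⊗ 𝟙 ⊗ ((𝟙 ⊖ A) ⊗ (𝟙 ⊖ A ⊗ q¹))
       ⊕ (𝟙 ⊗ 𝟙) ⊗ (((𝟙 ⊖ A) ⊗ (𝟙 ⊖ A ⊗ q¹)) ⊗ ((𝟙 ⊖ A) ⊗ (𝟙 ⊖ A ⊗ q¹)))
      ≈⟨ ≃sym (solve-subst 5 (λ a q u y' z' → (a :* a :* ((con (+ 1) :- q) :* (con (+ 1) :- q))) :+ con (+ 2) :* (con (+ 1) :+ q) :* a :* u :* (y' :* z')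
                           :+ (u :* u) :* ((y' :* z') :* (y' :* z')))
          (≃refl ∷ ≃refl ∷ u1 ∷ qint-geometric k ∷ ≃trans (qint-geometric (suc k)) (⊖c ≃refl (Q-sucq k)) ∷ [])) ⟩
    (A ⊗ A ⊗ (δ ⊗ δ)) ⊕ cst (+ 2) ⊗ (𝟙 ⊕ q¹) ⊗ A ⊗ (Ki ⊗ A) ⊗ ((δ ⊗ Y) ⊗ (δ ⊗ Z))
       ⊕ ((Ki ⊗ A) ⊗ (Ki ⊗ A)) ⊗ (((δ ⊗ Y) ⊗ (δ ⊗ Z)) ⊗ ((δ ⊗ Y) ⊗ (δ ⊗ Z)))
      ≈⟨ solve 5 (λ a ki y z q → (a :* a :* ((con (+ 1) :- q) :* (con (+ 1) :- q))) :+ con (+ 2) :* (con (+ 1) :+ q) :* a :* (ki :* a) :* (((con (+ 1) :- q) :* y) :* ((con (+ 1) :- q) :* z))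
                           :+ ((ki :* a) :* (ki :* a)) :* ((((con (+ 1) :- q) :* y) :* ((con (+ 1) :- q) :* z)) :* (((con (+ 1) :- q) :* y) :* ((con (+ 1) :- q) :* z)))
            := (a :* a :* ((con (+ 1) :- q) :* (con (+ 1) :- q))) :* (con (+ 1) :+ con (+ 2) :* (con (+ 1) :+ q) :* (ki :* (y :* z))
                 :+ ((con (+ 1) :- q) :* (con (+ 1) :- q)) :* ((ki :* (y :* z)) :* (ki :* (y :* z))))) ≃refl A Ki Y Z q¹ ⟩
    (A ⊗ A ⊗ (δ ⊗ δ)) ⊗ (𝟙 ⊕ c₁ ⊗ ĥ k ⊕ (δ ⊗ δ) ⊗ (ĥ k ⊗ ĥ k)) ∎)
    where
    A : LPoly
    A = Q (+ k)
    Ki : LPoly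
    Ki = Q (ℤ.- (+ k))
    X : LPoly
    X = qint (2 ℕ.* k ℕ.+ 1)
    Y : LPoly
    Y = qint k
    Z : LPoly
    Z = qint (suc k)
    u1 : Ki ⊗ A ≃ 𝟙
    u1 = ≃trans (⊗comm _ _) (Q-inv (+ k))

  power : LPoly → ℕ → LPoly
  power a zero = 𝟙
  power a (suc n) = power a n ⊗ a

  ĝ²ʳ : ℕ → ℕ → LPoly
  ĝ²ʳ r k = power (ĝ k ⊗ ĝ k) r

  -- By ĝ²-via-ĥ and Divisible-ĥ, every ĝ²ʳ r · Kprod s is w-divisible.
  Divisible-ĝ²ʳ-Kprod : ∀ w → Divisible w (λ _ → 𝟙) → ∀ r s → Divisible w (λ k → ĝ²ʳ r k ⊗ Kprod s k)
  Divisible-ĝ²ʳ-Kprod w base zero s = Divisible-cong w (λ k → ≃sym (⊗idˡ (Kprod s k))) (Divisible-Kprod w base s)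
  Divisible-ĝ²ʳ-Kprod w base (suc r) s = Divisible-cong w pt
      (Divisible-+ w (Divisible-+ w (IH s) (Divisible-* w c₁ (H1 s))) (Divisible-* w (δ ⊗ δ) (H2 s)))
    where
    F : ℕ → LPoly
    F = ĝ²ʳ r
    IH : ∀ s → Divisible w (λ k → F k ⊗ Kprod s k)
    IH = Divisible-ĝ²ʳ-Kprod w base r
    H1 : ∀ s → Divisible w (λ k → (F k ⊗ ĥ k) ⊗ Kprod s k)
    H1 = Divisible-ĥ w F IH
    H2 : ∀ s → Divisible w (λ k → ((F k ⊗ ĥ k) ⊗ ĥ k) ⊗ Kprod s k)
    H2 = Divisible-ĥ w (λ k → F k ⊗ ĥ k) H1
    pt : ∀ k → (F k ⊗ Kprod s k ⊕ c₁ ⊗ ((F k ⊗ ĥ k) ⊗ Kprod s k)) ⊕ (δ ⊗ δ) ⊗ (((F k ⊗ ĥ k) ⊗ ĥ k) ⊗ Kprod s k)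
             ≃ (F k ⊗ (ĝ k ⊗ ĝ k)) ⊗ Kprod s k
    pt k = begin
      (F k ⊗ Kprod s k ⊕ c₁ ⊗ ((F k ⊗ ĥ k) ⊗ Kprod s k)) ⊕ (δ ⊗ δ) ⊗ (((F k ⊗ ĥ k) ⊗ ĥ k) ⊗ Kprod s k)
        ≈⟨ solve 5 (λ f x c h z → (f :* x :+ c :* ((f :* h) :* x)) :+ z :* (((f :* h) :* h) :* x) := (f :* (con (+ 1) :+ c :* h :+ z :* (h :* h))) :* x)
             ≃refl (F k) (Kprod s k) c₁ (ĥ k) (δ ⊗ δ) ⟩
      (F k ⊗ (𝟙 ⊕ c₁ ⊗ ĥ k ⊕ (δ ⊗ δ) ⊗ (ĥ k ⊗ ĥ k))) ⊗ Kprod s k ≈⟨ ⊗l _ (⊗r _ (≃sym (ĝ²-via-ĥ k))) ⟩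
      (F k ⊗ (ĝ k ⊗ ĝ k)) ⊗ Kprod s k ∎

  poch : LPoly → ℕ → LPoly
  poch a zero = 𝟙
  poch a (suc s) = poch a s ⊗ (𝟙 ⊖ a ⊗ Q (+ s))

  pochPair : ℕ → ℕ → LPoly
  pochPair s k = poch (Q (ℤ.- (+ k))) s ⊗ poch (Q (+ (k ℕ.+ 1))) s

  poch-factor : ∀ s k → (𝟙 ⊖ Q (ℤ.- (+ k)) ⊗ Q (+ s)) ⊗ (𝟙 ⊖ Q (+ (k ℕ.+ 1)) ⊗ Q (+ s)) ≃ (δ ⊗ δ) ⊗ (Q (+ s) ⊗ (ĥ s ⊖ ĥ k))
  poch-factor s k = cancel (Cancellable-Q (+ k)) (begin
    A ⊗ ((𝟙 ⊖ Ki ⊗ S) ⊗ (𝟙 ⊖ A1 ⊗ S))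
      ≈⟨ solve 4 (λ a ki s a1 → a :* ((con (+ 1) :- ki :* s) :* (con (+ 1) :- a1 :* s)) := (a :- (ki :* a) :* s) :* (con (+ 1) :- a1 :* s)) ≃refl A Ki S A1 ⟩
    (A ⊖ (Ki ⊗ A) ⊗ S) ⊗ (𝟙 ⊖ A1 ⊗ S)
      ≈⟨ solve-subst 4 (λ a u s a1 → (a :- u :* s) :* (con (+ 1) :- a1 :* s)) (≃refl ∷ u1 ∷ ≃refl ∷ Q+ k 1 ∷ []) ⟩
    (A ⊖ 𝟙 ⊗ S) ⊗ (𝟙 ⊖ (A ⊗ q¹) ⊗ S)
      ≈⟨ solve 3 (λ a s q → (a :- con (+ 1) :* s) :* (con (+ 1) :- (a :* q) :* s) :=
            a :* (con (+ 1) :* ((con (+ 1) :- s) :* (con (+ 1) :- s :* q))) :- s :* con (+ 1) :* ((con (+ 1) :- a) :* (con (+ 1) :- a :* q))) ≃refl A S q¹ ⟩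
    A ⊗ (𝟙 ⊗ ((𝟙 ⊖ S) ⊗ (𝟙 ⊖ S ⊗ q¹))) ⊖ S ⊗ 𝟙 ⊗ ((𝟙 ⊖ A) ⊗ (𝟙 ⊖ A ⊗ q¹))
      ≈⟨ ≃sym (solve-subst 8 (λ a s v u y1 y2 x1 x2 → a :* (v :* (y1 :* y2)) :- s :* u :* (x1 :* x2))
           (≃refl ∷ ≃refl ∷ Q-inv (+ s) ∷ u1 ∷ qint-geometric s ∷ ≃trans (qint-geometric (suc s)) (⊖c ≃refl (Q-sucq s)) ∷ qint-geometric k ∷ ≃trans (qint-geometric (suc k)) (⊖c ≃refl (Q-sucq k)) ∷ [])) ⟩
    A ⊗ ((S ⊗ Si) ⊗ ((δ ⊗ Y1) ⊗ (δ ⊗ Y2))) ⊖ S ⊗ (Ki ⊗ A) ⊗ ((δ ⊗ X1) ⊗ (δ ⊗ X2))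
      ≈⟨ solve 9 (λ a s si ki y1 y2 x1 x2 q → a :* ((s :* si) :* (((con (+ 1) :- q) :* y1) :* ((con (+ 1) :- q) :* y2))) :- s :* (ki :* a) :* (((con (+ 1) :- q) :* x1) :* ((con (+ 1) :- q) :* x2))
           := a :* (((con (+ 1) :- q) :* (con (+ 1) :- q)) :* (s :* (si :* (y1 :* y2) :- ki :* (x1 :* x2))))) ≃refl A S Si Ki Y1 Y2 X1 X2 q¹ ⟩
    A ⊗ ((δ ⊗ δ) ⊗ (S ⊗ (ĥ s ⊖ ĥ k))) ∎)
    where
    A : LPoly
    A = Q (+ k)
    Ki : LPoly
    Ki = Q (ℤ.- (+ k))
    A1 : LPoly
    A1 = Q (+ (k ℕ.+ 1))
    S : LPoly
    S = Q (+ s)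
    Si : LPoly
    Si = Q (ℤ.- (+ s))
    Y1 : LPoly
    Y1 = qint s
    Y2 : LPoly
    Y2 = qint (suc s)
    X1 : LPoly
    X1 = qint k
    X2 : LPoly
    X2 = qint (suc k)
    u1 : Ki ⊗ A ≃ 𝟙
    u1 = ≃trans (⊗comm _ _) (Q-inv (+ k))

  pochPair-Kprod : ∀ s k → pochPair s k ≃ power (δ ⊗ δ) s ⊗ Kprod s k
  pochPair-Kprod zero k = solve 0 (con (+ 1) :* con (+ 1) := con (+ 1) :* con (+ 1)) ≃refl
  pochPair-Kprod (suc s) k = begin
    (poch Ki s ⊗ (𝟙 ⊖ Ki ⊗ Q (+ s))) ⊗ (poch A1 s ⊗ (𝟙 ⊖ A1 ⊗ Q (+ s)))
      ≈⟨ solve 4 (λ a b c d → (a :* b) :* (c :* d) := (a :* c) :* (b :* d)) ≃refl _ _ _ _ ⟩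
    pochPair s k ⊗ ((𝟙 ⊖ Ki ⊗ Q (+ s)) ⊗ (𝟙 ⊖ A1 ⊗ Q (+ s))) ≈⟨ ⊗c (pochPair-Kprod s k) (poch-factor s k) ⟩
    (power (δ ⊗ δ) s ⊗ Kprod s k) ⊗ ((δ ⊗ δ) ⊗ (Q (+ s) ⊗ (ĥ s ⊖ ĥ k)))
      ≈⟨ solve 4 (λ p kk z x → (p :* kk) :* (z :* x) := (p :* z) :* (x :* kk)) ≃refl _ _ _ _ ⟩
    power (δ ⊗ δ) (suc s) ⊗ Kprod (suc s) k ∎
    where
    Ki : LPoly
    Ki = Q (ℤ.- (+ k))
    A1 : LPoly
    A1 = Q (+ (k ℕ.+ 1))

  Divisible-ĝ²ʳ-pochPair : ∀ w → Divisible w (λ _ → 𝟙) → ∀ r s → Divisible w (λ k → ĝ²ʳ r k ⊗ pochPair s k)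
  Divisible-ĝ²ʳ-pochPair w base r s = Divisible-cong w pt (Divisible-* w (power (δ ⊗ δ) s) (Divisible-ĝ²ʳ-Kprod w base r s))
    where
    pt : ∀ k → power (δ ⊗ δ) s ⊗ (ĝ²ʳ r k ⊗ Kprod s k) ≃ ĝ²ʳ r k ⊗ pochPair s k
    pt k = ≃trans (solve 3 (λ a b c → a :* (b :* c) := b :* (a :* c)) ≃refl _ _ _) (⊗r _ (≃sym (pochPair-Kprod s k)))

-- w-divisibility of 1 for the first three weights, by telescoping.
module SimpleWeights where

  open PolyArith
  open LaurentRing
  open QAnalogues
  open FiniteSums
  open QBinomials
  open Divisibility
  open import Data.Nat as ℕ using (ℕ; zero; suc; _≤_; s≤s)
  open import Data.Integer as ℤ using (ℤ; +_)
  import Data.Integer.Properties as ℤP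
  import Data.Nat.Properties as ℕP
  import Data.Integer.Tactic.RingSolver as ZS
  import Data.Nat.Tactic.RingSolver as NS
  open import Data.Product using (Σ; _,_)
  open import Data.Vec.Relation.Binary.Pointwise.Inductive using ([]; _∷_)
  open import Relation.Binary.PropositionalEquality using (_≡_; refl; sym; trans; cong)

  Bin-offset : ∀ k m → Bin (k ℕ.+ m) k ≃ qbin (2 ℕ.* (k ℕ.+ m) ℕ.+ 1) m
  Bin-offset k m = ≡≃ (cong (qbin (2 ℕ.* (k ℕ.+ m) ℕ.+ 1)) (ℕP.m+n∸m≡n k m))

  Bin-sym : ∀ k m → qbin (2 ℕ.* (k ℕ.+ m) ℕ.+ 1) (suc (k ℕ.+ m ℕ.+ k)) ≃ qbin (2 ℕ.* (k ℕ.+ m) ℕ.+ 1) m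
  Bin-sym k m = ≃trans (≡≃ (cong (λ N → qbin N (suc (k ℕ.+ m ℕ.+ k))) (l k m))) (≃trans (qbin-sym (suc (k ℕ.+ m ℕ.+ k)) m)
               (≡≃ (cong (λ N → qbin N m) (sym (l k m)))))
    where
    l : ∀ k m → 2 ℕ.* (k ℕ.+ m) ℕ.+ 1 ≡ suc (k ℕ.+ m ℕ.+ k) ℕ.+ m
    l = NS.solve-∀

  -- The two shapes of [2n+1][2n,n+j] met when telescoping: with k ≤ n = k + m,
  -- [2n+1][2n,n+k] = [n+k+1] Bin n k and [2n+1][2n,n+k+1] = [m] Bin n k.
  Mod-center : ∀ k m → qint (2 ℕ.* (k ℕ.+ m) ℕ.+ 1) ⊗ qbin (2 ℕ.* (k ℕ.+ m)) (k ℕ.+ m ℕ.+ k)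
              ≃ qint (suc (k ℕ.+ m ℕ.+ k)) ⊗ Bin (k ℕ.+ m) k
  Mod-center k m = begin
    qint (2 ℕ.* n ℕ.+ 1) ⊗ qbin (2 ℕ.* n) a ≈⟨ ⊗c (≡≃ (cong qint (sym (l2 k m)))) (≡≃ (cong (λ N → qbin N a) (sym (l1 k m)))) ⟩
    qint (suc (a ℕ.+ m)) ⊗ qbin (a ℕ.+ m) a ≈⟨ ≃sym (absorb-top a m) ⟩
    qint (suc a) ⊗ qbin (suc (a ℕ.+ m)) (suc a) ≈⟨ ⊗r _ (≃trans (≡≃ (cong (λ N → qbin N (suc a)) (l2 k m))) (Bin-sym k m)) ⟩
    qint (suc a) ⊗ qbin (2 ℕ.* n ℕ.+ 1) m ≈⟨ ⊗r _ (≃sym (Bin-offset k m)) ⟩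
    qint (suc a) ⊗ Bin n k ∎
    where
    n : ℕ
    n = k ℕ.+ m
    a : ℕ
    a = k ℕ.+ m ℕ.+ k
    l1 : ∀ k m → (k ℕ.+ m ℕ.+ k) ℕ.+ m ≡ 2 ℕ.* (k ℕ.+ m)
    l1 = NS.solve-∀
    l2 : ∀ k m → suc ((k ℕ.+ m ℕ.+ k) ℕ.+ m) ≡ 2 ℕ.* (k ℕ.+ m) ℕ.+ 1
    l2 = NS.solve-∀

  Mod-center′ : ∀ k m → qint (2 ℕ.* (k ℕ.+ m) ℕ.+ 1) ⊗ qbin (2 ℕ.* (k ℕ.+ m)) (suc (k ℕ.+ m ℕ.+ k))
              ≃ qint m ⊗ Bin (k ℕ.+ m) k
  Mod-center′ k zero = begin
    qint (2 ℕ.* (k ℕ.+ 0) ℕ.+ 1) ⊗ qbin (2 ℕ.* (k ℕ.+ 0)) (suc (k ℕ.+ 0 ℕ.+ k)) ≈⟨ ⊗r _ (qbin-above _ _ (s≤s (ℕP.≤-reflexive (l k)))) ⟩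
    qint (2 ℕ.* (k ℕ.+ 0) ℕ.+ 1) ⊗ 𝟘 ≈⟨ z⊗ _ ⟩
    𝟘 ≈⟨ solve 1 (λ x → con (+ 0) := con (+ 0) :* x) ≃refl _ ⟩
    𝟘 ⊗ Bin (k ℕ.+ 0) k ≈⟨ ⊗l _ (≃sym qint-zero) ⟩
    qint 0 ⊗ Bin (k ℕ.+ 0) k ∎
    where
    l : ∀ k → 2 ℕ.* (k ℕ.+ 0) ≡ k ℕ.+ 0 ℕ.+ k
    l = NS.solve-∀
  Mod-center′ k (suc m) = begin
    qint (2 ℕ.* n ℕ.+ 1) ⊗ qbin (2 ℕ.* n) (suc a) ≈⟨ ⊗c (≡≃ (cong qint (sym (l2 k m)))) (≡≃ (cong (λ N → qbin N (suc a)) (sym (l1 k m)))) ⟩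
    qint (suc (suc a ℕ.+ m)) ⊗ qbin (suc a ℕ.+ m) (suc a) ≈⟨ ≃sym (absorb-bottom (suc a) m) ⟩
    qint (suc m) ⊗ qbin (suc (suc a ℕ.+ m)) (suc a) ≈⟨ ⊗r _ (≃trans (≡≃ (cong (λ N → qbin N (suc a)) (l2 k m))) (Bin-sym k (suc m))) ⟩
    qint (suc m) ⊗ qbin (2 ℕ.* n ℕ.+ 1) (suc m) ≈⟨ ⊗r _ (≃sym (Bin-offset k (suc m))) ⟩
    qint (suc m) ⊗ Bin n k ∎
    where
    n : ℕ
    n = k ℕ.+ suc m
    a : ℕ
    a = k ℕ.+ suc m ℕ.+ k
    l1 : ∀ k m → suc (k ℕ.+ suc m ℕ.+ k) ℕ.+ m ≡ 2 ℕ.* (k ℕ.+ suc m)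
    l1 = NS.solve-∀
    l2 : ∀ k m → suc (suc (k ℕ.+ suc m ℕ.+ k) ℕ.+ m) ≡ 2 ℕ.* (k ℕ.+ suc m) ℕ.+ 1
    l2 = NS.solve-∀

  Q-merge : ∀ a b c → a ℤ.+ b ≡ c → Q a ⊗ Q b ≃ Q c
  Q-merge a b c e = ≃trans (≃sym (Q-add a b)) (Q-cong e)

  leSplit : ∀ {k n} → k ≤ n → Σ ℕ (λ m → k ℕ.+ m ≡ n)
  leSplit le = ℕP.m≤n⇒∃[o]m+o≡n le

  -- edge n k = [2n+1][2n,n+k]: edge n 0 = Mod n and edge n (n+1) = 0.
  edge : ℕ → ℕ → LPoly
  edge n k = qint (2 ℕ.* n ℕ.+ 1) ⊗ qbin (2 ℕ.* n) (n ℕ.+ k)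

  telescope-Mod : (c F : ℕ → ℕ → LPoly) →
    (∀ k m → F (k ℕ.+ m) k ≃ c (k ℕ.+ m) k ⊗ edge (k ℕ.+ m) k ⊖ c (k ℕ.+ m) (suc k) ⊗ edge (k ℕ.+ m) (suc k)) →
    ∀ n → sumUp n (F n) ≃ c n 0 ⊗ Mod n
  telescope-Mod c F step n = begin
    sumUp n (F n) ≈⟨ sumUp-telescope n G pt ⟩
    G 0 ⊖ G (suc n) ≈⟨ ⊖c (⊗r _ (⊗r _ (≡≃ (cong (qbin (2 ℕ.* n)) (ℕP.+-identityʳ n)))))
                          (≃trans (⊗r _ (⊗r _ (qbin-above (2 ℕ.* n) (n ℕ.+ suc n) (ℕP.≤-reflexive (l n))))) (≃trans (⊗r _ (z⊗ _)) (z⊗ _))) ⟩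
    c n 0 ⊗ Mod n ⊖ 𝟘 ≈⟨ solve 1 (λ x → x :- con (+ 0) := x) ≃refl _ ⟩
    c n 0 ⊗ Mod n ∎
    where
    G : ℕ → LPoly
    G k = c n k ⊗ edge n k
    pt : ∀ k → k ≤ n → F n k ≃ G k ⊖ G (suc k)
    pt k le with leSplit le
    ... | m , refl = step k m
    l : ∀ n → suc (2 ℕ.* n) ≡ n ℕ.+ suc n
    l = NS.solve-∀

  w₁ : ℕ → LPoly
  w₁ k = 𝟙

  telescope₁ : ∀ k m → w₁ k ⊗ (ĝ k ⊗ (Bin (k ℕ.+ m) k ⊗ 𝟙))
     ≃ Q (ℤ.- (+ (k ℕ.+ m))) ⊗ edge (k ℕ.+ m) k ⊖ Q (ℤ.- (+ (k ℕ.+ m))) ⊗ edge (k ℕ.+ m) (suc k)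
  telescope₁ k m = ≃sym (begin
    Qn ⊗ (b ⊗ qbin (2 ℕ.* n) (n ℕ.+ k)) ⊖ Qn ⊗ (b ⊗ qbin (2 ℕ.* n) (n ℕ.+ suc k))
      ≈⟨ ⊖c (⊗r _ (Mod-center k m)) (⊗r _ (≃trans (⊗r _ (≡≃ (cong (qbin (2 ℕ.* n)) (ℕP.+-suc n k)))) (Mod-center′ k m))) ⟩
    Qn ⊗ (qint (suc (n ℕ.+ k)) ⊗ B) ⊖ Qn ⊗ (qint m ⊗ B) ≈⟨ ⊖c (⊗r _ (⊗l _ (≃trans (≡≃ (cong qint (l k m))) (qint-+ m (2 ℕ.* k ℕ.+ 1))))) ≃refl ⟩
    Qn ⊗ ((qint m ⊕ Q (+ m) ⊗ qint (2 ℕ.* k ℕ.+ 1)) ⊗ B) ⊖ Qn ⊗ (qint m ⊗ B)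
      ≈⟨ solve 5 (λ qn x qm y b → qn :* ((x :+ qm :* y) :* b) :- qn :* (x :* b) := con (+ 1) :* ((qn :* qm) :* y :* (b :* con (+ 1)))) ≃refl Qn (qint m) (Q (+ m)) (qint (2 ℕ.* k ℕ.+ 1)) B ⟩
    𝟙 ⊗ ((Qn ⊗ Q (+ m)) ⊗ qint (2 ℕ.* k ℕ.+ 1) ⊗ (B ⊗ 𝟙)) ≈⟨ ⊗r _ (⊗l _ (⊗l _ (Q-merge _ _ _ (e k m)))) ⟩
    𝟙 ⊗ (ĝ k ⊗ (B ⊗ 𝟙)) ∎)
    where
    n : ℕ
    n = k ℕ.+ m
    Qn : LPoly
    Qn = Q (ℤ.- (+ n))
    b : LPoly
    b = qint (2 ℕ.* n ℕ.+ 1)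
    B : LPoly
    B = Bin n k
    l : ∀ k m → suc (k ℕ.+ m ℕ.+ k) ≡ m ℕ.+ (2 ℕ.* k ℕ.+ 1)
    l = NS.solve-∀
    e : ∀ k m → ℤ.- (+ (k ℕ.+ m)) ℤ.+ + m ≡ ℤ.- (+ k)
    e k m = trans (cong (λ z → ℤ.- z ℤ.+ + m) (ℤP.pos-+ k m)) (l' (+ k) (+ m))
      where
      l' : ∀ x y → ℤ.- (x ℤ.+ y) ℤ.+ y ≡ ℤ.- x
      l' = ZS.solve-∀

  divisible-w₁ : Divisible w₁ (λ _ → 𝟙)
  divisible-w₁ n = Q (ℤ.- (+ n)) , telescope-Mod (λ n _ → Q (ℤ.- (+ n))) (λ n k → w₁ k ⊗ (ĝ k ⊗ (Bin n k ⊗ 𝟙))) telescope₁ n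

  w₂ : ℕ → LPoly
  w₂ k = Q (+ (k ℕ.* k ℕ.+ k))

  telescope₂ : ∀ k m → w₂ k ⊗ (ĝ k ⊗ (Bin (k ℕ.+ m) k ⊗ 𝟙))
     ≃ Q (+ (k ℕ.* k)) ⊗ edge (k ℕ.+ m) k ⊖ Q (+ (suc k ℕ.* suc k)) ⊗ edge (k ℕ.+ m) (suc k)
  telescope₂ k m = ≃sym (begin
    Q (+ (k ℕ.* k)) ⊗ (b ⊗ qbin (2 ℕ.* n) (n ℕ.+ k)) ⊖ Q (+ (suc k ℕ.* suc k)) ⊗ (b ⊗ qbin (2 ℕ.* n) (n ℕ.+ suc k))
      ≈⟨ ⊖c (⊗r _ (Mod-center k m)) (⊗c Qs (≃trans (⊗r _ (≡≃ (cong (qbin (2 ℕ.* n)) (ℕP.+-suc n k)))) (Mod-center′ k m))) ⟩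
    Q (+ (k ℕ.* k)) ⊗ (qint (suc (n ℕ.+ k)) ⊗ B) ⊖ (Q (+ (k ℕ.* k)) ⊗ Q (+ (2 ℕ.* k ℕ.+ 1))) ⊗ (qint m ⊗ B)
      ≈⟨ ⊖c (⊗r _ (⊗l _ (≃trans (≡≃ (cong qint (l k m))) (qint-+ (2 ℕ.* k ℕ.+ 1) m)))) ≃refl ⟩
    Q (+ (k ℕ.* k)) ⊗ ((qint (2 ℕ.* k ℕ.+ 1) ⊕ Q (+ (2 ℕ.* k ℕ.+ 1)) ⊗ qint m) ⊗ B) ⊖ (Q (+ (k ℕ.* k)) ⊗ Q (+ (2 ℕ.* k ℕ.+ 1))) ⊗ (qint m ⊗ B)
      ≈⟨ solve 5 (λ a y c x bb → a :* ((y :+ c :* x) :* bb) :- (a :* c) :* (x :* bb) := a :* y :* (bb :* con (+ 1))) ≃refl (Q (+ (k ℕ.* k))) (qint (2 ℕ.* k ℕ.+ 1)) (Q (+ (2 ℕ.* k ℕ.+ 1))) (qint m) B ⟩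
    Q (+ (k ℕ.* k)) ⊗ qint (2 ℕ.* k ℕ.+ 1) ⊗ (B ⊗ 𝟙)
      ≈⟨ ⊗l _ (⊗l _ (≃sym (Q-merge _ _ _ (e k)))) ⟩
    (Q (+ (k ℕ.* k ℕ.+ k)) ⊗ Q (ℤ.- (+ k))) ⊗ qint (2 ℕ.* k ℕ.+ 1) ⊗ (B ⊗ 𝟙)
      ≈⟨ solve 4 (λ a b c d → (a :* b) :* c :* d := a :* (b :* c :* d)) ≃refl _ _ _ _ ⟩
    w₂ k ⊗ (ĝ k ⊗ (B ⊗ 𝟙)) ∎)
    where
    n : ℕ
    n = k ℕ.+ m
    b : LPoly
    b = qint (2 ℕ.* n ℕ.+ 1)
    B : LPoly
    B = Bin n k
    l : ∀ k m → suc (k ℕ.+ m ℕ.+ k) ≡ (2 ℕ.* k ℕ.+ 1) ℕ.+ m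
    l = NS.solve-∀
    ls : ∀ k → suc k ℕ.* suc k ≡ k ℕ.* k ℕ.+ (2 ℕ.* k ℕ.+ 1)
    ls = NS.solve-∀
    Qs : Q (+ (suc k ℕ.* suc k)) ≃ Q (+ (k ℕ.* k)) ⊗ Q (+ (2 ℕ.* k ℕ.+ 1))
    Qs = ≃trans (≡≃ (cong (λ N → Q (+ N)) (ls k))) (Q+ (k ℕ.* k) (2 ℕ.* k ℕ.+ 1))
    e : ∀ k → + (k ℕ.* k ℕ.+ k) ℤ.+ ℤ.- (+ k) ≡ + (k ℕ.* k)
    e k = trans (cong (ℤ._+ ℤ.- (+ k)) (ℤP.pos-+ (k ℕ.* k) k)) (l' (+ (k ℕ.* k)) (+ k))
      where
      l' : ∀ x y → (x ℤ.+ y) ℤ.+ ℤ.- y ≡ x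
      l' = ZS.solve-∀

  Usum-w₂ : ∀ n → Usum w₂ (λ _ → 𝟙) n ≃ Mod n
  Usum-w₂ n = ≃trans (telescope-Mod (λ _ k → Q (+ (k ℕ.* k))) (λ n k → w₂ k ⊗ (ĝ k ⊗ (Bin n k ⊗ 𝟙))) telescope₂ n)
                     (≃trans (⊗l _ Q0) (⊗idˡ _))

  divisible-w₂ : Divisible w₂ (λ _ → 𝟙)
  divisible-w₂ n = 𝟙 , ≃trans (Usum-w₂ n) (≃sym (⊗idˡ _))

  tri : ℕ → ℕ
  tri zero = 0
  tri (suc k) = tri k ℕ.+ k

  sgn : ℕ → LPoly
  sgn k = cst ((ℤ.- (+ 1)) ℤ.^ k)

  sgn-suc : ∀ k → sgn (suc k) ≃ ⊖' (sgn k)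
  sgn-suc k = ≃trans (cst*h (ℤ.- (+ 1)) ((ℤ.- (+ 1)) ℤ.^ k)) (≃trans (⊗l _ (cst-h (+ 1)))
    (solve 1 (λ x → (:- con (+ 1)) :* x := :- x) ≃refl (sgn k)))

  w₃ : ℕ → LPoly
  w₃ k = sgn k ⊗ Q (+ (tri k ℕ.+ k))

  telescope₃-identity : ∀ k m → (𝟙 ⊖ Q (+ k)) ⊗ qint (suc (k ℕ.+ m ℕ.+ k)) ⊕ Q (+ k) ⊗ (𝟙 ⊖ Q (+ k) ⊗ q¹) ⊗ qint m
              ≃ (𝟙 ⊖ Q (+ k) ⊗ Q (+ m)) ⊗ qint (2 ℕ.* k ℕ.+ 1)
  telescope₃-identity k m = cancel (Cancellable-1-Q 0) (begin
    δ ⊗ ((𝟙 ⊖ A) ⊗ X1 ⊕ A ⊗ (𝟙 ⊖ A ⊗ q¹) ⊗ Y)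
      ≈⟨ solve 4 (λ a x1 y q → (con (+ 1) :- q) :* ((con (+ 1) :- a) :* x1 :+ a :* (con (+ 1) :- a :* q) :* y) :=
            (con (+ 1) :- a) :* ((con (+ 1) :- q) :* x1) :+ a :* (con (+ 1) :- a :* q) :* ((con (+ 1) :- q) :* y)) ≃refl A X1 Y q¹ ⟩
    (𝟙 ⊖ A) ⊗ (δ ⊗ X1) ⊕ A ⊗ (𝟙 ⊖ A ⊗ q¹) ⊗ (δ ⊗ Y)
      ≈⟨ solve-subst 4 (λ a q x' y' → (con (+ 1) :- a) :* x' :+ a :* (con (+ 1) :- a :* q) :* y')
           (≃refl ∷ ≃refl ∷ ≃trans (qint-geometric _) (⊖c ≃refl Qn1) ∷ qint-geometric m ∷ []) ⟩
    (𝟙 ⊖ A) ⊗ (𝟙 ⊖ ((A ⊗ A) ⊗ M) ⊗ q¹) ⊕ A ⊗ (𝟙 ⊖ A ⊗ q¹) ⊗ (𝟙 ⊖ M)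
      ≈⟨ solve 3 (λ a mm q → (con (+ 1) :- a) :* (con (+ 1) :- ((a :* a) :* mm) :* q) :+ a :* (con (+ 1) :- a :* q) :* (con (+ 1) :- mm)
            := (con (+ 1) :- a :* mm) :* (con (+ 1) :- (a :* a) :* q)) ≃refl A M q¹ ⟩
    (𝟙 ⊖ A ⊗ M) ⊗ (𝟙 ⊖ (A ⊗ A) ⊗ q¹) ≈⟨ ⊗r _ (≃sym (≃trans (qint-geometric _) (⊖c ≃refl (Q-odd k)))) ⟩
    (𝟙 ⊖ A ⊗ M) ⊗ (δ ⊗ qint (2 ℕ.* k ℕ.+ 1))
      ≈⟨ solve 3 (λ u q x → u :* ((con (+ 1) :- q) :* x) := (con (+ 1) :- q) :* (u :* x)) ≃refl _ q¹ _ ⟩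
    δ ⊗ ((𝟙 ⊖ A ⊗ M) ⊗ qint (2 ℕ.* k ℕ.+ 1)) ∎)
    where
    A : LPoly
    A = Q (+ k)
    M : LPoly
    M = Q (+ m)
    X1 : LPoly
    X1 = qint (suc (k ℕ.+ m ℕ.+ k))
    Y : LPoly
    Y = qint m
    l : ∀ k m → suc (k ℕ.+ m ℕ.+ k) ≡ ((k ℕ.+ k) ℕ.+ m) ℕ.+ 1
    l = NS.solve-∀
    Qn1 : Q (+ suc (k ℕ.+ m ℕ.+ k)) ≃ ((A ⊗ A) ⊗ M) ⊗ q¹
    Qn1 = ≃trans (≡≃ (cong (λ N → Q (+ N)) (l k m))) (≃trans (Q+ _ 1) (⊗l _ (≃trans (Q+ _ m) (⊗l _ (Q+ k k)))))

  -- After multiplication by 1 - q^n the w₃-summands telescope with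
  -- c n k = c₃ k = (-1)^k q^(k(k-1)/2) (1-q^k).
  c₃ : ℕ → LPoly
  c₃ k = sgn k ⊗ Q (+ tri k) ⊗ (𝟙 ⊖ Q (+ k))

  telescope₃ : ∀ k m → (𝟙 ⊖ Q (+ (k ℕ.+ m))) ⊗ (w₃ k ⊗ (ĝ k ⊗ (Bin (k ℕ.+ m) k ⊗ 𝟙)))
     ≃ c₃ k ⊗ edge (k ℕ.+ m) k ⊖ c₃ (suc k) ⊗ edge (k ℕ.+ m) (suc k)
  telescope₃ k m = ≃sym (begin
    (sgn k ⊗ T ⊗ (𝟙 ⊖ A)) ⊗ (b ⊗ qbin (2 ℕ.* n) (n ℕ.+ k)) ⊖ (sgn (suc k) ⊗ Q (+ tri (suc k)) ⊗ (𝟙 ⊖ Q (+ suc k))) ⊗ (b ⊗ qbin (2 ℕ.* n) (n ℕ.+ suc k))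
      ≈⟨ ⊖c (⊗r _ (Mod-center k m)) (⊗c (⊗c (⊗c (sgn-suc k) (Q+ (tri k) k)) (⊖c ≃refl (Q-sucq k))) (≃trans (⊗r _ (≡≃ (cong (qbin (2 ℕ.* n)) (ℕP.+-suc n k)))) (Mod-center′ k m))) ⟩
    (sgn k ⊗ T ⊗ (𝟙 ⊖ A)) ⊗ (qint (suc (n ℕ.+ k)) ⊗ B) ⊖ (⊖' (sgn k) ⊗ (T ⊗ A) ⊗ (𝟙 ⊖ A ⊗ q¹)) ⊗ (qint m ⊗ B)
      ≈⟨ solve 7 (λ s t a q x y bb → (s :* t :* (con (+ 1) :- a)) :* (x :* bb) :- ((:- s) :* (t :* a) :* (con (+ 1) :- a :* q)) :* (y :* bb)
            := (s :* t) :* (((con (+ 1) :- a) :* x :+ a :* (con (+ 1) :- a :* q) :* y) :* bb)) ≃refl (sgn k) T A q¹ (qint (suc (n ℕ.+ k))) (qint m) B ⟩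
    (sgn k ⊗ T) ⊗ (((𝟙 ⊖ A) ⊗ qint (suc (n ℕ.+ k)) ⊕ A ⊗ (𝟙 ⊖ A ⊗ q¹) ⊗ qint m) ⊗ B) ≈⟨ ⊗r _ (⊗l _ (telescope₃-identity k m)) ⟩
    (sgn k ⊗ T) ⊗ (((𝟙 ⊖ A ⊗ Q (+ m)) ⊗ qint (2 ℕ.* k ℕ.+ 1)) ⊗ B)
      ≈⟨ ⊗r _ (⊗l _ (⊗l _ (⊖c ≃refl (≃sym (Q+ k m))))) ⟩
    (sgn k ⊗ T) ⊗ (((𝟙 ⊖ Q (+ n)) ⊗ qint (2 ℕ.* k ℕ.+ 1)) ⊗ B)
      ≈⟨ solve 5 (λ s t u x bb → (s :* t) :* ((u :* x) :* bb) := u :* ((s :* t) :* x :* (bb :* con (+ 1)))) ≃refl (sgn k) T (𝟙 ⊖ Q (+ n)) (qint (2 ℕ.* k ℕ.+ 1)) B ⟩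
    (𝟙 ⊖ Q (+ n)) ⊗ ((sgn k ⊗ T) ⊗ qint (2 ℕ.* k ℕ.+ 1) ⊗ (B ⊗ 𝟙))
      ≈⟨ ⊗r _ (⊗l _ (⊗l _ (⊗r _ (≃sym (Q-merge _ _ _ (e k)))))) ⟩
    (𝟙 ⊖ Q (+ n)) ⊗ ((sgn k ⊗ (Q (+ (tri k ℕ.+ k)) ⊗ Q (ℤ.- (+ k)))) ⊗ qint (2 ℕ.* k ℕ.+ 1) ⊗ (B ⊗ 𝟙))
      ≈⟨ ⊗r _ (solve 5 (λ s a b c d → (s :* (a :* b)) :* c :* d := (s :* a) :* (b :* c :* d)) ≃refl _ _ _ _ _) ⟩
    (𝟙 ⊖ Q (+ n)) ⊗ (w₃ k ⊗ (ĝ k ⊗ (B ⊗ 𝟙))) ∎)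
    where
    n : ℕ
    n = k ℕ.+ m
    b : LPoly
    b = qint (2 ℕ.* n ℕ.+ 1)
    B : LPoly
    B = Bin n k
    A : LPoly
    A = Q (+ k)
    T : LPoly
    T = Q (+ tri k)
    e : ∀ k → + (tri k ℕ.+ k) ℤ.+ ℤ.- (+ k) ≡ + (tri k)
    e k = trans (cong (ℤ._+ ℤ.- (+ k)) (ℤP.pos-+ (tri k) k)) (l' (+ (tri k)) (+ k))
      where
      l' : ∀ x y → (x ℤ.+ y) ℤ.+ ℤ.- y ≡ x
      l' = ZS.solve-∀

  Mod-zero : Mod 0 ≃ 𝟙
  Mod-zero = ≃trans (⊗c qint-one (qbin-zero 0)) (⊗idˡ 𝟙)

  -- Hence Usum w₃ 1 n = 0 for n ≥ 1, cancelling 1 - q^n, since c₃ 0 = 0.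
  Usum-w₃ : ∀ n → Usum w₃ (λ _ → 𝟙) (suc n) ≃ 𝟘
  Usum-w₃ n' = Cancellable-1-Q n' _ (begin
    (𝟙 ⊖ Q (+ n)) ⊗ Usum w₃ (λ _ → 𝟙) n ≈⟨ ≃sym (sumUp-* n _ _) ⟩
    sumUp n (λ k → (𝟙 ⊖ Q (+ n)) ⊗ (w₃ k ⊗ (ĝ k ⊗ (Bin n k ⊗ 𝟙))))
      ≈⟨ telescope-Mod (λ _ → c₃) (λ n k → (𝟙 ⊖ Q (+ n)) ⊗ (w₃ k ⊗ (ĝ k ⊗ (Bin n k ⊗ 𝟙)))) telescope₃ n ⟩
    (sgn 0 ⊗ Q (+ 0) ⊗ (𝟙 ⊖ Q (+ 0))) ⊗ Mod n ≈⟨ ⊗l _ (⊗r _ (⊖c ≃refl Q0)) ⟩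
    (sgn 0 ⊗ Q (+ 0) ⊗ (𝟙 ⊖ 𝟙)) ⊗ Mod n ≈⟨ solve 3 (λ a b m → a :* b :* (con (+ 1) :- con (+ 1)) :* m := con (+ 0)) ≃refl _ _ _ ⟩
    𝟘 ∎)
    where
    n : ℕ
    n = suc n'

  divisible-w₃ : Divisible w₃ (λ _ → 𝟙)
  divisible-w₃ zero = Usum w₃ (λ _ → 𝟙) 0 , ≃trans (≃sym (⊗idʳ _)) (⊗r _ (≃sym Mod-zero))
  divisible-w₃ (suc n) = 𝟘 , ≃trans (Usum-w₃ n) (≃sym (solve 1 (λ x → con (+ 0) :* x := con (+ 0)) ≃refl (Mod (suc n))))

-- w-divisibility of 1 for the fourth weight.
module FourthWeight where

  open PolyArith
  open LaurentRing
  open QAnalogues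
  open FiniteSums
  open QBinomials
  open Divisibility
  open SimpleWeights
  open import Data.Nat as ℕ using (ℕ; zero; suc; _<_; _≤_; s≤s)
  open import Data.Integer as ℤ using (ℤ; +_)
  import Data.Integer.Properties as ℤP
  import Data.Nat.Properties as ℕP
  import Data.Integer.Tactic.RingSolver as ZS
  import Data.Nat.Tactic.RingSolver as NS
  open import Data.Product using (_,_)
  open import Data.Vec.Relation.Binary.Pointwise.Inductive using ([]; _∷_)
  open import Relation.Binary.Definitions using (tri<; tri≈; tri>)
  open import Relation.Binary.PropositionalEquality using (_≡_; refl; sym; trans; cong; cong₂)

  absorb-swap : ∀ j e → qint (suc j) ⊗ qbin (j ℕ.+ e) (suc j) ≃ qint e ⊗ qbin (j ℕ.+ e) j
  absorb-swap j zero = begin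
    qint (suc j) ⊗ qbin (j ℕ.+ 0) (suc j) ≈⟨ ⊗r _ (qbin-above _ _ (s≤s (ℕP.≤-reflexive (ℕP.+-identityʳ j)))) ⟩
    qint (suc j) ⊗ 𝟘 ≈⟨ z⊗ _ ⟩
    𝟘 ≈⟨ solve 1 (λ x → con (+ 0) := con (+ 0) :* x) ≃refl _ ⟩
    𝟘 ⊗ qbin (j ℕ.+ 0) j ≈⟨ ⊗l _ (≃sym qint-zero) ⟩
    qint 0 ⊗ qbin (j ℕ.+ 0) j ∎
  absorb-swap j (suc e) = begin
    qint (suc j) ⊗ qbin (j ℕ.+ suc e) (suc j) ≈⟨ ⊗r _ (≡≃ (cong (λ N → qbin N (suc j)) (ℕP.+-suc j e))) ⟩
    qint (suc j) ⊗ qbin (suc (j ℕ.+ e)) (suc j) ≈⟨ absorb-top j e ⟩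
    qint (suc (j ℕ.+ e)) ⊗ qbin (j ℕ.+ e) j ≈⟨ ≃sym (absorb-bottom j e) ⟩
    qint (suc e) ⊗ qbin (suc (j ℕ.+ e)) j ≈⟨ ⊗r _ (≡≃ (cong (λ N → qbin N j) (sym (ℕP.+-suc j e)))) ⟩
    qint (suc e) ⊗ qbin (j ℕ.+ suc e) j ∎

  Lterm : ℕ → ℕ → LPoly
  Lterm j k = sgn j ⊗ Q (+ tri j ℤ.- + (j ℕ.* k)) ⊗ qbin k j ⊗ qbin (k ℕ.+ j) j

  ĥ-self : ∀ k → ĥ k ⊖ ĥ k ≃ 𝟘
  ĥ-self k = solve 1 (λ x → x :- x := con (+ 0)) ≃refl (ĥ k)

  Kprod-closed-step : ∀ j k → (Q (+ j) ⊗ (ĥ j ⊖ ĥ k)) ⊗ (qbin k j ⊗ qbin (k ℕ.+ j) j)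
                 ≃ ⊖' (Q (+ j ℤ.- + k)) ⊗ ((qint (suc j) ⊗ qbin k (suc j)) ⊗ (qint (suc j) ⊗ qbin (k ℕ.+ suc j) (suc j)))
  Kprod-closed-step j k with ℕ.<-cmp j k
  ... | tri< lt _ _ with leSplit lt
  ...   | e' , refl = begin
    (Q (+ j) ⊗ (ĥ j ⊖ ĥ k)) ⊗ (qbin k j ⊗ qbin (k ℕ.+ j) j)
      ≈⟨ ⊗l _ (≃trans (solve 3 (λ a x y → a :* (x :- y) := :- (a :* (y :- x))) ≃refl _ _ _) (⊖'c (⊗r _ (Q-unit k _)))) ⟩
    ⊖' (Q (+ j) ⊗ (Q (ℤ.- (+ k)) ⊗ (Q (+ k) ⊗ (ĥ k ⊖ ĥ j)))) ⊗ (qbin k j ⊗ qbin (k ℕ.+ j) j)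
      ≈⟨ ⊗l _ (⊖'c (≃trans (≃sym (⊗assoc _ _ _)) (⊗c (Q-merge _ _ _ refl) (≃trans (≡≃ (cong (λ N → Q (+ N) ⊗ (ĥ N ⊖ ĥ j)) (sym (ℕP.+-suc j e')))) (ĥ-difference j e))))) ⟩
    ⊖' (Q (+ j ℤ.- + k) ⊗ (qint e ⊗ qint (e ℕ.+ suc (j ℕ.+ j)))) ⊗ (qbin k j ⊗ qbin (k ℕ.+ j) j)
      ≈⟨ solve 6 (λ a x y u v w → (:- (a :* (x :* y))) :* (u :* v) := (:- a) :* ((x :* u) :* (y :* v))) ≃refl _ _ _ _ _ (qint (suc j)) ⟩
    ⊖' (Q (+ j ℤ.- + k)) ⊗ ((qint e ⊗ qbin k j) ⊗ (qint (e ℕ.+ suc (j ℕ.+ j)) ⊗ qbin (k ℕ.+ j) j))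
      ≈⟨ ⊗r _ (⊗c (≃trans (⊗r _ (≡≃ (cong (λ N → qbin N j) (sym (ℕP.+-suc j e'))))) (≃trans (≃sym (absorb-swap j e)) (⊗r _ (≡≃ (cong (λ N → qbin N (suc j)) (ℕP.+-suc j e'))))))
           (≃trans (⊗c (≡≃ (cong qint (l1 j e'))) (≡≃ (cong (λ N → qbin N j) (l2 j e')))) (≃trans (≃sym (absorb-top j k)) (⊗r _ (≡≃ (cong (λ N → qbin N (suc j)) (l3 j k))))))) ⟩
    ⊖' (Q (+ j ℤ.- + k)) ⊗ ((qint (suc j) ⊗ qbin k (suc j)) ⊗ (qint (suc j) ⊗ qbin (k ℕ.+ suc j) (suc j))) ∎
    where
    e : ℕ
    e = suc e'
    l1 : ∀ j e' → suc e' ℕ.+ suc (j ℕ.+ j) ≡ suc (j ℕ.+ suc (j ℕ.+ e'))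
    l1 = NS.solve-∀
    l2 : ∀ j e' → suc (j ℕ.+ e') ℕ.+ j ≡ j ℕ.+ suc (j ℕ.+ e')
    l2 = NS.solve-∀
    l3 : ∀ j k → suc (j ℕ.+ k) ≡ k ℕ.+ suc j
    l3 = NS.solve-∀
  Kprod-closed-step j k | tri≈ _ refl _ = begin
    (Q (+ j) ⊗ (ĥ j ⊖ ĥ j)) ⊗ X ≈⟨ ⊗l _ (≃trans (⊗r _ (ĥ-self j)) (z⊗ _)) ⟩
    𝟘 ⊗ X ≈⟨ solve 2 (λ x y → con (+ 0) :* x := y :* con (+ 0)) ≃refl X _ ⟩
    Y ⊗ 𝟘 ≈⟨ ⊗r _ (≃sym (≃trans (⊗l _ (≃trans (⊗r _ (qbin-above j (suc j) (ℕP.n<1+n j))) (z⊗ _))) (solve 1 (λ x → con (+ 0) :* x := con (+ 0)) ≃refl _))) ⟩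
    Y ⊗ ((qint (suc j) ⊗ qbin j (suc j)) ⊗ (qint (suc j) ⊗ qbin (j ℕ.+ suc j) (suc j))) ∎
    where
    X : LPoly
    X = qbin j j ⊗ qbin (j ℕ.+ j) j
    Y : LPoly
    Y = ⊖' (Q (+ j ℤ.- + j))
  Kprod-closed-step j k | tri> _ _ gt = begin
    (Q (+ j) ⊗ (ĥ j ⊖ ĥ k)) ⊗ (qbin k j ⊗ qbin (k ℕ.+ j) j) ≈⟨ ⊗r _ (⊗l _ (qbin-above k j gt)) ⟩
    (Q (+ j) ⊗ (ĥ j ⊖ ĥ k)) ⊗ (𝟘 ⊗ qbin (k ℕ.+ j) j) ≈⟨ solve 3 (λ a b c → a :* (con (+ 0) :* b) := c :* con (+ 0)) ≃refl _ _ Y ⟩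
    Y ⊗ 𝟘 ≈⟨ ⊗r _ (≃sym (≃trans (⊗l _ (≃trans (⊗r _ (qbin-above k (suc j) (ℕP.m<n⇒m<1+n gt))) (z⊗ _))) (solve 1 (λ x → con (+ 0) :* x := con (+ 0)) ≃refl _))) ⟩
    Y ⊗ ((qint (suc j) ⊗ qbin k (suc j)) ⊗ (qint (suc j) ⊗ qbin (k ℕ.+ suc j) (suc j))) ∎
    where
    Y : LPoly
    Y = ⊖' (Q (+ j ℤ.- + k))

  Kprod-closed : ∀ j k → Kprod j k ≃ (qfact j ⊗ qfact j) ⊗ Lterm j k
  Kprod-closed zero k = ≃sym (≃trans (solve-subst 3 (λ a b c → (con (+ 1) :* con (+ 1)) :* (con (+ 1) :* a :* b :* c)) (Q0 ∷ qbin-zero k ∷ qbin-zero (k ℕ.+ 0) ∷ []))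
     (solve 0 ((con (+ 1) :* con (+ 1)) :* (con (+ 1) :* con (+ 1) :* con (+ 1) :* con (+ 1)) := con (+ 1)) ≃refl))
  Kprod-closed (suc j) k = begin
    (Qj ⊗ (ĥ j ⊖ ĥ k)) ⊗ Kprod j k ≈⟨ ⊗r _ (Kprod-closed j k) ⟩
    (Qj ⊗ (ĥ j ⊖ ĥ k)) ⊗ ((F ⊗ F) ⊗ (sgn j ⊗ E ⊗ qbin k j ⊗ qbin (k ℕ.+ j) j))
      ≈⟨ solve 7 (λ a f s e c₁ c2 z → a :* ((f :* f) :* (s :* e :* c₁ :* c2)) := ((f :* f) :* (s :* e)) :* (a :* (c₁ :* c2))) ≃refl (Qj ⊗ (ĥ j ⊖ ĥ k)) F (sgn j) E (qbin k j) (qbin (k ℕ.+ j) j) 𝟘 ⟩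
    ((F ⊗ F) ⊗ (sgn j ⊗ E)) ⊗ ((Qj ⊗ (ĥ j ⊖ ĥ k)) ⊗ (qbin k j ⊗ qbin (k ℕ.+ j) j)) ≈⟨ ⊗r _ (Kprod-closed-step j k) ⟩
    ((F ⊗ F) ⊗ (sgn j ⊗ E)) ⊗ (⊖' (Q (+ j ℤ.- + k)) ⊗ ((b ⊗ qbin k (suc j)) ⊗ (b ⊗ qbin (k ℕ.+ suc j) (suc j))))
      ≈⟨ solve 8 (λ f s e d b c₁ c2 z → ((f :* f) :* (s :* e)) :* ((:- d) :* ((b :* c₁) :* (b :* c2))) := ((f :* b) :* (f :* b)) :* ((:- s) :* (e :* d) :* c₁ :* c2))
            ≃refl F (sgn j) E (Q (+ j ℤ.- + k)) b (qbin k (suc j)) (qbin (k ℕ.+ suc j) (suc j)) 𝟘 ⟩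
    ((F ⊗ b) ⊗ (F ⊗ b)) ⊗ (⊖' (sgn j) ⊗ (E ⊗ Q (+ j ℤ.- + k)) ⊗ qbin k (suc j) ⊗ qbin (k ℕ.+ suc j) (suc j))
      ≈⟨ ⊗r _ (⊗l _ (⊗l _ (⊗c (≃sym (sgn-suc j)) (Q-merge _ _ _ (ex j k))))) ⟩
    (qfact (suc j) ⊗ qfact (suc j)) ⊗ Lterm (suc j) k ∎
    where
    Qj : LPoly
    Qj = Q (+ j)
    F : LPoly
    F = qfact j
    E : LPoly
    E = Q (+ tri j ℤ.- + (j ℕ.* k))
    b : LPoly
    b = qint (suc j)
    ex : ∀ j k → (+ tri j ℤ.- + (j ℕ.* k)) ℤ.+ (+ j ℤ.- + k) ≡ + tri (suc j) ℤ.- + (suc j ℕ.* k)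
    ex j k = trans (l (+ tri j) (+ (j ℕ.* k)) (+ j) (+ k)) (sym (cong₂ ℤ._-_ (ℤP.pos-+ (tri j) j) (ℤP.pos-+ k (j ℕ.* k))))
      where
      l : ∀ a b c d → (a ℤ.- b) ℤ.+ (c ℤ.- d) ≡ (a ℤ.+ c) ℤ.- (d ℤ.+ b)
      l = ZS.solve-∀

  Usum-w₂-Kprod-aux : ∀ j m → (ĥ j ⊖ ĥ (suc m)) ⊗ qbin (suc m) j ⊕ Q (ℤ.- (+ suc m)) ⊗ (qint (suc m) ⊗ qint (suc m)) ⊗ qbin m j
               ≃ ⊖' (qint (suc j) ⊗ qint (suc j) ⊗ qbin (suc m) (suc j))
  Usum-w₂-Kprod-aux j m with ℕ.<-cmp j (suc m)
  ... | tri< lt _ _ with leSplit lt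
  ...   | e' , refl = begin
    (ĥ j ⊖ ĥ n) ⊗ qbin n j ⊕ Qi ⊗ (qint n ⊗ qint n) ⊗ qbin m j
      ≈⟨ ⊕l _ (⊗l _ (≃trans (solve 2 (λ x y → x :- y := :- (y :- x)) ≃refl _ _) (⊖'c (≃trans (Q-unit n _)
            (⊗r _ (≃trans (≡≃ (cong (λ N → Q (+ N) ⊗ (ĥ N ⊖ ĥ j)) (sym (ℕP.+-suc j e')))) (ĥ-difference j e))))))) ⟩
    ⊖' (Qi ⊗ (qint e ⊗ qint (e ℕ.+ suc (j ℕ.+ j)))) ⊗ qbin n j ⊕ Qi ⊗ (qint n ⊗ qint n) ⊗ qbin m j
      ≈⟨ ⊕c (⊗l _ (⊖'c (⊗r _ (⊗r _ (≃trans (≡≃ (cong qint (l1 j e'))) (qint-+ n (suc j)))))))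
             (≃trans (⊗assoc _ _ _) (⊗r _ (≃trans (⊗assoc _ _ _) (⊗r _ (≃sym (absorb-bottom j e')))))) ⟩
    ⊖' (Qi ⊗ (qint e ⊗ (qint n ⊕ Q (+ n) ⊗ qint (suc j)))) ⊗ qbin n j ⊕ Qi ⊗ (qint n ⊗ (qint e ⊗ qbin n j))
      ≈⟨ solve 6 (λ qi x y qn b c → (:- (qi :* (x :* (y :+ qn :* b)))) :* c :+ qi :* (y :* (x :* c)) := :- ((qi :* qn) :* (b :* (x :* c))))
           ≃refl Qi (qint e) (qint n) (Q (+ n)) (qint (suc j)) (qbin n j) ⟩
    ⊖' ((Qi ⊗ Q (+ n)) ⊗ (qint (suc j) ⊗ (qint e ⊗ qbin n j)))
      ≈⟨ ⊖'c (⊗c (≃trans (⊗comm _ _) (Q-inv (+ n))) (⊗r _ (≃trans (⊗r _ (≡≃ (cong (λ N → qbin N j) (sym (ℕP.+-suc j e'))))) (≃trans (≃sym (absorb-swap j e)) (⊗r _ (≡≃ (cong (λ N → qbin N (suc j)) (ℕP.+-suc j e')))))))) ⟩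
    ⊖' (𝟙 ⊗ (qint (suc j) ⊗ (qint (suc j) ⊗ qbin n (suc j))))
      ≈⟨ ⊖'c (solve 3 (λ a b c → con (+ 1) :* (a :* (b :* c)) := a :* b :* c) ≃refl _ _ _) ⟩
    ⊖' (qint (suc j) ⊗ qint (suc j) ⊗ qbin n (suc j)) ∎
    where
    e : ℕ
    e = suc e'
    n : ℕ
    n = suc (j ℕ.+ e')
    Qi : LPoly
    Qi = Q (ℤ.- (+ n))
    l1 : ∀ j e' → suc e' ℕ.+ suc (j ℕ.+ j) ≡ suc (j ℕ.+ e') ℕ.+ suc j
    l1 = NS.solve-∀
  Usum-w₂-Kprod-aux j m | tri≈ _ refl _ = begin
    (ĥ n ⊖ ĥ n) ⊗ qbin n n ⊕ Q (ℤ.- (+ n)) ⊗ (qint n ⊗ qint n) ⊗ qbin m n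
      ≈⟨ ⊕c (⊗l _ (ĥ-self n)) (⊗r _ (qbin-above m n (ℕP.n<1+n m))) ⟩
    𝟘 ⊗ qbin n n ⊕ Q (ℤ.- (+ n)) ⊗ (qint n ⊗ qint n) ⊗ 𝟘
      ≈⟨ solve 4 (λ a b c d → con (+ 0) :* a :+ b :* c :* con (+ 0) := :- (d :* d :* con (+ 0))) ≃refl _ _ _ (qint (suc n)) ⟩
    ⊖' (qint (suc n) ⊗ qint (suc n) ⊗ 𝟘) ≈⟨ ⊖'c (⊗r _ (≃sym (qbin-above n (suc n) (ℕP.n<1+n n)))) ⟩
    ⊖' (qint (suc n) ⊗ qint (suc n) ⊗ qbin n (suc n)) ∎
    where
    n : ℕ
    n = suc m
  Usum-w₂-Kprod-aux j m | tri> _ _ gt = begin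
    (ĥ j ⊖ ĥ n) ⊗ qbin n j ⊕ Q (ℤ.- (+ n)) ⊗ (qint n ⊗ qint n) ⊗ qbin m j
      ≈⟨ ⊕c (⊗r _ (qbin-above n j gt)) (⊗r _ (qbin-above m j (ℕP.<-trans (ℕP.n<1+n m) gt))) ⟩
    (ĥ j ⊖ ĥ n) ⊗ 𝟘 ⊕ Q (ℤ.- (+ n)) ⊗ (qint n ⊗ qint n) ⊗ 𝟘
      ≈⟨ solve 4 (λ a b c d → a :* con (+ 0) :+ b :* c :* con (+ 0) := :- (d :* d :* con (+ 0))) ≃refl _ _ _ (qint (suc j)) ⟩
    ⊖' (qint (suc j) ⊗ qint (suc j) ⊗ 𝟘) ≈⟨ ⊖'c (⊗r _ (≃sym (qbin-above n (suc j) (ℕP.m<n⇒m<1+n gt)))) ⟩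
    ⊖' (qint (suc j) ⊗ qint (suc j) ⊗ qbin n (suc j)) ∎
    where
    n : ℕ
    n = suc m

  Pcoeff : ℕ → LPoly
  Pcoeff j = sgn j ⊗ Q (+ tri j) ⊗ (qfact j ⊗ qfact j)

  Pcoeff-suc : ∀ j → Pcoeff (suc j) ≃ ⊖' (Q (+ j) ⊗ Pcoeff j ⊗ (qint (suc j) ⊗ qint (suc j)))
  Pcoeff-suc j = begin
    sgn (suc j) ⊗ Q (+ (tri j ℕ.+ j)) ⊗ ((qfact j ⊗ qint (suc j)) ⊗ (qfact j ⊗ qint (suc j))) ≈⟨ ⊗l _ (⊗c (sgn-suc j) (Q+ (tri j) j)) ⟩
    ⊖' (sgn j) ⊗ (Q (+ tri j) ⊗ Q (+ j)) ⊗ ((qfact j ⊗ qint (suc j)) ⊗ (qfact j ⊗ qint (suc j)))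
      ≈⟨ solve 5 (λ s t a f b → (:- s) :* (t :* a) :* ((f :* b) :* (f :* b)) := :- (a :* (s :* t :* (f :* f)) :* (b :* b))) ≃refl (sgn j) (Q (+ tri j)) (Q (+ j)) (qfact j) (qint (suc j)) ⟩
    ⊖' (Q (+ j) ⊗ Pcoeff j ⊗ (qint (suc j) ⊗ qint (suc j))) ∎

  -- Explicit evaluation Usum w₂ (Kprod j) n = Pcoeff j [n,j] Mod n, by the same
  -- recursion as Divisible-Kprod, starting from Usum-w₂.
  Usum-w₂-Kprod : ∀ j n → Usum w₂ (Kprod j) n ≃ (Pcoeff j ⊗ qbin n j) ⊗ Mod n
  Usum-w₂-Kprod zero n = ≃trans (Usum-w₂ n) (≃sym (≃trans (⊗l _ (solve-subst 2 (λ a c → con (+ 1) :* a :* (con (+ 1) :* con (+ 1)) :* c) (Q0 ∷ qbin-zero n ∷ [])))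
    (solve 1 (λ x → con (+ 1) :* con (+ 1) :* (con (+ 1) :* con (+ 1)) :* con (+ 1) :* x := x) ≃refl _)))
  Usum-w₂-Kprod (suc j) zero = begin
    Usum w₂ (Kprod (suc j)) 0 ≈⟨ Usum-Kprod-suc w₂ j 0 ⟩
    Q (+ j) ⊗ (ĥ j ⊗ U ⊖ Vsum w₂ (Kprod j) 0) ≈⟨ ⊗r _ (⊖c ≃refl (Vsum-zero w₂ (Kprod j))) ⟩
    Q (+ j) ⊗ (ĥ j ⊗ U ⊖ ĥ 0 ⊗ U) ≈⟨ ⊗r _ (⊖c (⊗r _ (Usum-w₂-Kprod j 0)) (⊗r _ (Usum-w₂-Kprod j 0))) ⟩
    Q (+ j) ⊗ (ĥ j ⊗ ((Pcoeff j ⊗ qbin 0 j) ⊗ Mod 0) ⊖ ĥ 0 ⊗ ((Pcoeff j ⊗ qbin 0 j) ⊗ Mod 0))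
      ≈⟨ solve 6 (λ a x y p c mm → a :* (x :* ((p :* c) :* mm) :- y :* ((p :* c) :* mm)) := a :* p :* mm :* ((x :- y) :* c)) ≃refl _ _ _ _ _ _ ⟩
    Q (+ j) ⊗ Pcoeff j ⊗ Mod 0 ⊗ ((ĥ j ⊖ ĥ 0) ⊗ qbin 0 j) ≈⟨ ⊗r _ (z0 j) ⟩
    Q (+ j) ⊗ Pcoeff j ⊗ Mod 0 ⊗ 𝟘 ≈⟨ solve 4 (λ a b c d → a :* b :* c :* con (+ 0) := (d :* con (+ 0)) :* c) ≃refl (Q (+ j)) (Pcoeff j) (Mod 0) (Pcoeff (suc j)) ⟩
    (Pcoeff (suc j) ⊗ 𝟘) ⊗ Mod 0 ≈⟨ ⊗l _ (⊗r _ (≃sym (qbin-empty j))) ⟩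
    (Pcoeff (suc j) ⊗ qbin 0 (suc j)) ⊗ Mod 0 ∎
    where
    U : LPoly
    U = Usum w₂ (Kprod j) 0
    z0 : ∀ j → (ĥ j ⊖ ĥ 0) ⊗ qbin 0 j ≃ 𝟘
    z0 zero = ≃trans (⊗l _ (ĥ-self 0)) (solve 1 (λ x → con (+ 0) :* x := con (+ 0)) ≃refl _)
    z0 (suc j) = ≃trans (⊗r _ (qbin-empty j)) (z⊗ _)
  Usum-w₂-Kprod (suc j) (suc m) = begin
    Usum w₂ (Kprod (suc j)) n ≈⟨ Usum-Kprod-suc w₂ j n ⟩
    Q (+ j) ⊗ (ĥ j ⊗ Un ⊖ Vsum w₂ (Kprod j) n) ≈⟨ ⊗r _ (⊖c ≃refl (Vsum-step w₂ (Kprod j) m)) ⟩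
    Q (+ j) ⊗ (ĥ j ⊗ Un ⊖ (ĥ n ⊗ Un ⊖ cstep m ⊗ Um)) ≈⟨ ⊗r _ (⊖c (⊗r _ (Usum-w₂-Kprod j n)) (⊖c (⊗r _ (Usum-w₂-Kprod j n)) (⊗r _ (Usum-w₂-Kprod j m)))) ⟩
    Q (+ j) ⊗ (ĥ j ⊗ ((P ⊗ qbin n j) ⊗ Mod n) ⊖ (ĥ n ⊗ ((P ⊗ qbin n j) ⊗ Mod n) ⊖ cstep m ⊗ ((P ⊗ qbin m j) ⊗ Mod m)))
      ≈⟨ solve 11 (λ a x y p c₁ mn qi b1 b2 c2 mm →
            a :* (x :* ((p :* c₁) :* mn) :- (y :* ((p :* c₁) :* mn) :- (qi :* (b1 :* b2)) :* ((p :* c2) :* mm)))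
            := a :* p :* ((x :- y) :* c₁ :* mn :+ qi :* c2 :* ((b1 :* b2) :* mm)))
           ≃refl (Q (+ j)) (ĥ j) (ĥ n) P (qbin n j) (Mod n) (Q (ℤ.- (+ n))) (qint (2 ℕ.* n)) (qint (2 ℕ.* n ℕ.+ 1)) (qbin m j) (Mod m) ⟩
    Q (+ j) ⊗ P ⊗ ((ĥ j ⊖ ĥ n) ⊗ qbin n j ⊗ Mod n ⊕ Q (ℤ.- (+ n)) ⊗ qbin m j ⊗ ((qint (2 ℕ.* n) ⊗ qint (2 ℕ.* n ℕ.+ 1)) ⊗ Mod m))
      ≈⟨ ⊗r _ (⊕r _ (⊗r _ (Mod-step m))) ⟩
    Q (+ j) ⊗ P ⊗ ((ĥ j ⊖ ĥ n) ⊗ qbin n j ⊗ Mod n ⊕ Q (ℤ.- (+ n)) ⊗ qbin m j ⊗ ((qint n ⊗ qint n) ⊗ Mod (suc m)))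
      ≈⟨ solve 9 (λ a p x c₁ mm qi c2 b z → a :* p :* (x :* c₁ :* mm :+ qi :* c2 :* ((b :* b) :* mm)) := a :* p :* (x :* c₁ :+ qi :* (b :* b) :* c2) :* mm)
           ≃refl (Q (+ j)) P (ĥ j ⊖ ĥ n) (qbin n j) (Mod n) (Q (ℤ.- (+ n))) (qbin m j) (qint n) 𝟘 ⟩
    Q (+ j) ⊗ P ⊗ ((ĥ j ⊖ ĥ n) ⊗ qbin n j ⊕ Q (ℤ.- (+ n)) ⊗ (qint n ⊗ qint n) ⊗ qbin m j) ⊗ Mod n
      ≈⟨ ⊗l _ (⊗r _ (Usum-w₂-Kprod-aux j m)) ⟩
    Q (+ j) ⊗ P ⊗ ⊖' (qint (suc j) ⊗ qint (suc j) ⊗ qbin n (suc j)) ⊗ Mod n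
      ≈⟨ ⊗l _ (solve 4 (λ a p b c → a :* p :* (:- (b :* b :* c)) := (:- (a :* p :* (b :* b))) :* c) ≃refl _ _ _ _) ⟩
    (⊖' (Q (+ j) ⊗ P ⊗ (qint (suc j) ⊗ qint (suc j))) ⊗ qbin n (suc j)) ⊗ Mod n ≈⟨ ⊗l _ (⊗l _ (≃sym (Pcoeff-suc j))) ⟩
    (Pcoeff (suc j) ⊗ qbin n (suc j)) ⊗ Mod n ∎
    where
    n : ℕ
    n = suc m
    P : LPoly
    P = Pcoeff j
    Un : LPoly
    Un = Usum w₂ (Kprod j) n
    Um : LPoly
    Um = Usum w₂ (Kprod j) m

  -- cvTerm j k i = (-1)^j q^(j(j-1)/2 - jk + j) [k,j][i+j,j] and cvSum k i = Σ_{j≤k}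
  -- cvTerm j k i: a q-Chu-Vandermonde type expansion of (-1)^k q^(k(k+1)/2) [i,k].
  cvExp : ℕ → ℕ → ℤ
  cvExp j k = + tri j ℤ.- + (j ℕ.* k) ℤ.+ + j

  cvTerm : ℕ → ℕ → ℕ → LPoly
  cvTerm j k i = sgn j ⊗ Q (cvExp j k) ⊗ qbin k j ⊗ qbin (i ℕ.+ j) j

  cvSum : ℕ → ℕ → LPoly
  cvSum k i = sumUp k (λ j → cvTerm j k i)

  cvExp-suc-suc : ∀ l k → cvExp (suc l) (suc k) ≡ cvExp l k ℤ.+ ℤ.- (+ k)
  cvExp-suc-suc l k = trans (cong₂ (λ a b → a ℤ.- b ℤ.+ + suc l) (ℤP.pos-+ (tri l) l) (pz l k))
     (trans (cong (λ z → (+ tri l ℤ.+ + l) ℤ.- (+ suc k ℤ.+ (+ l ℤ.+ + (l ℕ.* k))) ℤ.+ z) (ℤP.pos-+ 1 l))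
     (trans (cong (λ z → (+ tri l ℤ.+ + l) ℤ.- (z ℤ.+ (+ l ℤ.+ + (l ℕ.* k))) ℤ.+ (+ 1 ℤ.+ + l)) (ℤP.pos-+ 1 k))
     (l1 (+ tri l) (+ l) (+ k) (+ (l ℕ.* k)))))
    where
    nz : ∀ l k → suc l ℕ.* suc k ≡ suc k ℕ.+ (l ℕ.+ l ℕ.* k)
    nz = NS.solve-∀
    pz : ∀ l k → + (suc l ℕ.* suc k) ≡ + suc k ℤ.+ (+ l ℤ.+ + (l ℕ.* k))
    pz l k = trans (cong +_ (nz l k)) (trans (ℤP.pos-+ (suc k) (l ℕ.+ l ℕ.* k)) (cong (λ z → + suc k ℤ.+ z) (ℤP.pos-+ l (l ℕ.* k))))
    l1 : ∀ t l k lk → (t ℤ.+ l) ℤ.- ((+ 1 ℤ.+ k) ℤ.+ (l ℤ.+ lk)) ℤ.+ (+ 1 ℤ.+ l) ≡ (t ℤ.- lk ℤ.+ l) ℤ.+ ℤ.- k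
    l1 = ZS.solve-∀

  cvExp-suc : ∀ l k → cvExp (suc l) k ≡ cvExp l k ℤ.+ ℤ.- (+ k) ℤ.+ + suc l
  cvExp-suc l k = trans (cong₂ (λ a b → a ℤ.- b ℤ.+ + suc l) (ℤP.pos-+ (tri l) l) (ℤP.pos-+ k (l ℕ.* k)))
    (trans (cong (λ z → (+ tri l ℤ.+ + l) ℤ.- (+ k ℤ.+ + (l ℕ.* k)) ℤ.+ z) (ℤP.pos-+ 1 l))
    (trans (l1 (+ tri l) (+ l) (+ k) (+ (l ℕ.* k))) (cong (λ z → cvExp l k ℤ.+ ℤ.- (+ k) ℤ.+ z) (sym (ℤP.pos-+ 1 l)))))
    where
    l1 : ∀ t l k lk → (t ℤ.+ l) ℤ.- (k ℤ.+ lk) ℤ.+ (+ 1 ℤ.+ l) ≡ (t ℤ.- lk ℤ.+ l) ℤ.+ ℤ.- k ℤ.+ (+ 1 ℤ.+ l)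
    l1 = ZS.solve-∀

  cvTerm-suc : ∀ l k i → cvTerm (suc l) (suc k) i
        ≃ ⊖' (Q (ℤ.- (+ k))) ⊗ (sgn l ⊗ Q (cvExp l k) ⊗ qbin k l ⊗ qbin (suc (i ℕ.+ l)) (suc l)) ⊕ cvTerm (suc l) k i
  cvTerm-suc l k i = begin
    sgn (suc l) ⊗ Q (cvExp (suc l) (suc k)) ⊗ qbin (suc k) (suc l) ⊗ C
      ≈⟨ ⊗l _ (⊗c (⊗c (sgn-suc l) (≃trans (Q-cong (cvExp-suc-suc l k)) (Q-add _ _))) (pascal k l)) ⟩
    ⊖' (sgn l) ⊗ (Q (cvExp l k) ⊗ Q (ℤ.- (+ k))) ⊗ (qbin k l ⊕ Q (+ suc l) ⊗ qbin k (suc l)) ⊗ C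
      ≈⟨ solve 7 (λ s e ki c₁ ql c2 c → (:- s) :* (e :* ki) :* (c₁ :+ ql :* c2) :* c :=
            (:- ki) :* (s :* e :* c₁ :* c) :+ (:- s) :* ((e :* ki) :* ql) :* c2 :* c)
          ≃refl (sgn l) (Q (cvExp l k)) (Q (ℤ.- (+ k))) (qbin k l) (Q (+ suc l)) (qbin k (suc l)) C ⟩
    ⊖' (Q (ℤ.- (+ k))) ⊗ (sgn l ⊗ Q (cvExp l k) ⊗ qbin k l ⊗ C) ⊕ ⊖' (sgn l) ⊗ ((Q (cvExp l k) ⊗ Q (ℤ.- (+ k))) ⊗ Q (+ suc l)) ⊗ qbin k (suc l) ⊗ C
      ≈⟨ ⊕c (⊗r _ (⊗r _ (≡≃ (cong (λ N → qbin N (suc l)) (ℕP.+-suc i l)))))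
            (⊗l _ (⊗l _ (⊗c (≃sym (sgn-suc l)) (≃trans (⊗l _ (≃sym (Q-add _ _))) (≃trans (≃sym (Q-add _ _)) (Q-cong (sym (cvExp-suc l k)))))))) ⟩
    ⊖' (Q (ℤ.- (+ k))) ⊗ (sgn l ⊗ Q (cvExp l k) ⊗ qbin k l ⊗ qbin (suc (i ℕ.+ l)) (suc l)) ⊕ cvTerm (suc l) k i ∎
    where
    C : LPoly
    C = qbin (i ℕ.+ suc l) (suc l)

  cvTerm-zero : ∀ k i → cvTerm 0 k i ≃ 𝟙
  cvTerm-zero k i = ≃trans (solve-subst 3 (λ a b c → con (+ 1) :* a :* b :* c) (≃trans (Q-cong (l k)) Q0 ∷ qbin-zero k ∷ qbin-zero (i ℕ.+ 0) ∷ []))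
    (solve 0 (con (+ 1) :* con (+ 1) :* con (+ 1) :* con (+ 1) := con (+ 1)) ≃refl)
    where
    l : ∀ k → cvExp 0 k ≡ + 0
    l k = refl

  cvTerm-above : ∀ k i → cvTerm (suc k) k i ≃ 𝟘
  cvTerm-above k i = ≃trans (⊗l _ (⊗r _ (qbin-above k (suc k) (ℕP.n<1+n k)))) (solve 3 (λ a b c → a :* b :* con (+ 0) :* c := con (+ 0)) ≃refl _ _ _)

  -- cvSum k i = (-1)^k q^(k(k+1)/2) [i,k], by induction on k using the
  -- q-hockey-stick identities.
  cvSum-closed : ∀ k i → cvSum k i ≃ sgn k ⊗ Q (+ tri (suc k)) ⊗ qbin i k
  cvSum-closed zero i = ≃trans (cvTerm-zero 0 i) (≃sym (≃trans (solve-subst 2 (λ a b → con (+ 1) :* a :* b) (Q0 ∷ qbin-zero i ∷ [])) (solve 0 (con (+ 1) :* con (+ 1) :* con (+ 1) := con (+ 1)) ≃refl)))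
  cvSum-closed (suc k) i = begin
    cvSum (suc k) i ≈⟨ sumUp-shift k (λ j → cvTerm j (suc k) i) ⟩
    cvTerm 0 (suc k) i ⊕ sumUp k (λ l → cvTerm (suc l) (suc k) i) ≈⟨ ⊕c (cvTerm-zero (suc k) i) (sumUp-cong′ k (λ l → cvTerm-suc l k i)) ⟩
    𝟙 ⊕ sumUp k (λ l → ⊖' Qk ⊗ (sgn l ⊗ Q (cvExp l k) ⊗ qbin k l ⊗ qbin (suc (i ℕ.+ l)) (suc l)) ⊕ cvTerm (suc l) k i) ≈⟨ ⊕r _ (sumUp-+ k _ _) ⟩
    𝟙 ⊕ (sumUp k (λ l → ⊖' Qk ⊗ (sgn l ⊗ Q (cvExp l k) ⊗ qbin k l ⊗ qbin (suc (i ℕ.+ l)) (suc l))) ⊕ sumUp k (λ l → cvTerm (suc l) k i))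
      ≈⟨ ⊕r _ (⊕c (≃trans (sumUp-* k _ _) (⊗r _ (sumUp-cong′ k (λ l → ≃trans (⊗r _ (hockey2 i l)) (≃sym (sumUp-* i _ _)))))) ≃refl) ⟩
    𝟙 ⊕ (⊖' Qk ⊗ sumUp k (λ l → sumUp i (λ t → (sgn l ⊗ Q (cvExp l k) ⊗ qbin k l) ⊗ (Q (+ t) ⊗ qbin (t ℕ.+ l) l))) ⊕ sumUp k (λ l → cvTerm (suc l) k i))
      ≈⟨ ⊕r _ (⊕l _ (⊗r _ (≃trans (sumUp-swap k i _) (sumUp-cong′ i (λ t → ≃trans (sumUp-cong′ k (λ l → solve 4 (λ a b c d → a :* (b :* c) := b :* (a :* c)) ≃refl _ _ _ 𝟘)) (sumUp-* k _ _)))))) ⟩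
    𝟙 ⊕ (⊖' Qk ⊗ sumUp i (λ t → Q (+ t) ⊗ cvSum k t) ⊕ sumUp k (λ l → cvTerm (suc l) k i))
      ≈⟨ ⊕r _ (⊕l _ (⊗r _ (sumUp-cong′ i (λ t → ⊗r _ (cvSum-closed k t))))) ⟩
    𝟙 ⊕ (⊖' Qk ⊗ sumUp i (λ t → Q (+ t) ⊗ (R ⊗ qbin t k)) ⊕ sumUp k (λ l → cvTerm (suc l) k i))
      ≈⟨ solve 3 (λ a b c → con (+ 1) :+ (a :+ c) := (con (+ 1) :+ c) :+ a) ≃refl _ 𝟘 _ ⟩
    (𝟙 ⊕ sumUp k (λ l → cvTerm (suc l) k i)) ⊕ ⊖' Qk ⊗ sumUp i (λ t → Q (+ t) ⊗ (R ⊗ qbin t k))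
      ≈⟨ ⊕c (≃trans (⊕l _ (≃sym (cvTerm-zero k i))) (≃trans (≃sym (sumUp-shift k (λ j → cvTerm j k i))) (≃trans (⊕r _ (cvTerm-above k i)) (⊕idʳ _)))) ≃refl ⟩
    cvSum k i ⊕ ⊖' Qk ⊗ sumUp i (λ t → Q (+ t) ⊗ (R ⊗ qbin t k)) ≈⟨ ⊕c (cvSum-closed k i) (⊗r _ (sumUp-cong′ i (λ t → solve 3 (λ a b c → a :* (b :* c) := b :* (a :* c)) ≃refl _ _ _))) ⟩
    R ⊗ qbin i k ⊕ ⊖' Qk ⊗ sumUp i (λ t → R ⊗ (Q (+ t) ⊗ qbin t k)) ≈⟨ ⊕r _ (⊗r _ (sumUp-* i R _)) ⟩
    R ⊗ qbin i k ⊕ ⊖' Qk ⊗ (R ⊗ sumUp i (λ t → Q (+ t) ⊗ qbin t k))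
      ≈⟨ solve 4 (λ r c qk s → r :* c :+ (:- qk) :* (r :* s) := r :* (c :- qk :* s)) ≃refl R (qbin i k) Qk _ ⟩
    R ⊗ (qbin i k ⊖ Qk ⊗ sumUp i (λ t → Q (+ t) ⊗ qbin t k)) ≈⟨ ⊗r _ (⊖c ≃refl hk) ⟩
    R ⊗ (qbin i k ⊖ qbin (suc i) (suc k)) ≈⟨ ⊗r _ (⊖c ≃refl (pascal i k)) ⟩
    R ⊗ (qbin i k ⊖ (qbin i k ⊕ Q (+ suc k) ⊗ qbin i (suc k)))
      ≈⟨ solve 4 (λ r c a d → r :* (c :- (c :+ a :* d)) := (:- r) :* a :* d) ≃refl R (qbin i k) (Q (+ suc k)) (qbin i (suc k)) ⟩
    ⊖' R ⊗ Q (+ suc k) ⊗ qbin i (suc k)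
      ≈⟨ ⊗l _ (≃trans (solve 3 (λ s t a → (:- (s :* t)) :* a := (:- s) :* (t :* a)) ≃refl (sgn k) (Q (+ tri (suc k))) _)
              (⊗c (≃sym (sgn-suc k)) (≃sym (Q+ (tri (suc k)) (suc k))))) ⟩
    sgn (suc k) ⊗ Q (+ tri (suc (suc k))) ⊗ qbin i (suc k) ∎
    where
    Qk : LPoly
    Qk = Q (ℤ.- (+ k))
    R : LPoly
    R = sgn k ⊗ Q (+ tri (suc k))
    hk : Qk ⊗ sumUp i (λ t → Q (+ t) ⊗ qbin t k) ≃ qbin (suc i) (suc k)
    hk = ≃trans (≃sym (sumUp-* i Qk _)) (≃trans (sumUp-cong′ i (λ t → ≃trans (≃sym (⊗assoc _ _ _)) (⊗l _ (Q-merge _ _ _ (ℤP.+-comm (ℤ.- (+ k)) (+ t)))))) (≃sym (hockey1 i k)))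

  w₄ : ℕ → LPoly
  w₄ k = w₃ k ⊗ w₂ k

  -- cvTerm j k k = q^j Lterm j k, that is q^j Kprod j k / [j]!².
  cvTerm-Lterm : ∀ j k → cvTerm j k k ≃ Q (+ j) ⊗ Lterm j k
  cvTerm-Lterm j k = begin
    sgn j ⊗ Q (cvExp j k) ⊗ qbin k j ⊗ qbin (k ℕ.+ j) j ≈⟨ ⊗l _ (⊗l _ (⊗r _ (Q-add _ _))) ⟩
    sgn j ⊗ (Q (+ tri j ℤ.- + (j ℕ.* k)) ⊗ Q (+ j)) ⊗ qbin k j ⊗ qbin (k ℕ.+ j) j
      ≈⟨ solve 5 (λ s e a c d → s :* (e :* a) :* c :* d := a :* (s :* e :* c :* d)) ≃refl _ _ _ _ _ ⟩
    Q (+ j) ⊗ Lterm j k ∎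

  Usum-w₂-cvTerm : ∀ j n → Usum w₂ (λ k → cvTerm j k k) n ≃ (Q (+ j) ⊗ (sgn j ⊗ Q (+ tri j) ⊗ qbin n j)) ⊗ Mod n
  Usum-w₂-cvTerm j n = cancel (Cancellable-* (Cancellable-qfact j) (Cancellable-qfact j)) (begin
    (qfact j ⊗ qfact j) ⊗ Usum w₂ (λ k → cvTerm j k k) n ≈⟨ ≃sym (sumUp-* n _ _) ⟩
    sumUp n (λ k → (qfact j ⊗ qfact j) ⊗ (w₂ k ⊗ (ĝ k ⊗ (Bin n k ⊗ cvTerm j k k))))
      ≈⟨ sumUp-cong′ n (λ k → ≃trans (solve 5 (λ f a b c y → f :* (a :* (b :* (c :* y))) := a :* (b :* (c :* (f :* y)))) ≃refl _ _ _ _ _)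
            (⊗r _ (⊗r _ (⊗r _ (≃trans (⊗r _ (cvTerm-Lterm j k)) (≃trans (solve 3 (λ f a l → f :* (a :* l) := a :* (f :* l)) ≃refl _ _ _) (⊗r _ (≃sym (Kprod-closed j k))))))))) ⟩
    sumUp n (λ k → w₂ k ⊗ (ĝ k ⊗ (Bin n k ⊗ (Q (+ j) ⊗ Kprod j k))))
      ≈⟨ sumUp-cong′ n (λ k → solve 5 (λ a b c q x → a :* (b :* (c :* (q :* x))) := q :* (a :* (b :* (c :* x)))) ≃refl _ _ _ _ _) ⟩
    sumUp n (λ k → Q (+ j) ⊗ (w₂ k ⊗ (ĝ k ⊗ (Bin n k ⊗ Kprod j k)))) ≈⟨ sumUp-* n _ _ ⟩
    Q (+ j) ⊗ Usum w₂ (Kprod j) n ≈⟨ ⊗r _ (Usum-w₂-Kprod j n) ⟩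
    Q (+ j) ⊗ ((Pcoeff j ⊗ qbin n j) ⊗ Mod n)
      ≈⟨ solve 7 (λ a s t f c m z → a :* ((s :* t :* (f :* f) :* c) :* m) := (f :* f) :* ((a :* (s :* t :* c)) :* m))
           ≃refl (Q (+ j)) (sgn j) (Q (+ tri j)) (qfact j) (qbin n j) (Mod n) 𝟘 ⟩
    (qfact j ⊗ qfact j) ⊗ ((Q (+ j) ⊗ (sgn j ⊗ Q (+ tri j) ⊗ qbin n j)) ⊗ Mod n) ∎)

  cvTerm-vanish : ∀ j k → k < j → cvTerm j k k ≃ 𝟘
  cvTerm-vanish j k lt = ≃trans (⊗l _ (⊗r _ (qbin-above k j lt))) (solve 3 (λ a b c → a :* b :* con (+ 0) :* c := con (+ 0)) ≃refl _ _ _)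

  w₃-expand : ∀ {k n} → k ≤ n → w₃ k ≃ sumUp n (λ j → cvTerm j k k)
  w₃-expand {k} le with leSplit le
  ... | m , refl = begin
    w₃ k ≈⟨ ≃sym (≃trans (cvSum-closed k k) (≃trans (⊗r _ (qbin-diag k)) (⊗idʳ _))) ⟩
    sumUp k (λ j → cvTerm j k k) ≈⟨ ≃sym (sumUp-extend k m (λ j lt → cvTerm-vanish j k lt)) ⟩
    sumUp (m ℕ.+ k) (λ j → cvTerm j k k) ≈⟨ ≡≃ (cong (λ N → sumUp N (λ j → cvTerm j k k)) (ℕP.+-comm m k)) ⟩
    sumUp (k ℕ.+ m) (λ j → cvTerm j k k) ∎

  w₄-summand : ∀ n k → k ≤ n → w₄ k ⊗ (ĝ k ⊗ (Bin n k ⊗ 𝟙)) ≃ sumUp n (λ j → w₂ k ⊗ (ĝ k ⊗ (Bin n k ⊗ cvTerm j k k)))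
  w₄-summand n k le = begin
    (w₃ k ⊗ w₂ k) ⊗ (ĝ k ⊗ (Bin n k ⊗ 𝟙)) ≈⟨ ⊗l _ (⊗l _ (w₃-expand le)) ⟩
    (sumUp n (λ j → cvTerm j k k) ⊗ w₂ k) ⊗ (ĝ k ⊗ (Bin n k ⊗ 𝟙))
      ≈⟨ solve 4 (λ s a g b → (s :* a) :* (g :* (b :* con (+ 1))) := (a :* (g :* b)) :* s) ≃refl _ _ _ _ ⟩
    (w₂ k ⊗ (ĝ k ⊗ Bin n k)) ⊗ sumUp n (λ j → cvTerm j k k) ≈⟨ ≃sym (sumUp-* n _ _) ⟩
    sumUp n (λ j → (w₂ k ⊗ (ĝ k ⊗ Bin n k)) ⊗ cvTerm j k k) ≈⟨ sumUp-cong′ n (λ j → solve 4 (λ a g b y → (a :* (g :* b)) :* y := a :* (g :* (b :* y))) ≃refl _ _ _ _) ⟩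
    sumUp n (λ j → w₂ k ⊗ (ĝ k ⊗ (Bin n k ⊗ cvTerm j k k))) ∎

  -- Hence the constant 1 is w₄-divisible: exchange the double sum and evaluate each
  -- inner sum with Usum-w₂-cvTerm.
  divisible-w₄ : Divisible w₄ (λ _ → 𝟙)
  divisible-w₄ n = sumUp n cj , (begin
    Usum w₄ (λ _ → 𝟙) n ≈⟨ sumUp-cong n (w₄-summand n) ⟩
    sumUp n (λ k → sumUp n (λ j → w₂ k ⊗ (ĝ k ⊗ (Bin n k ⊗ cvTerm j k k)))) ≈⟨ sumUp-swap n n _ ⟩
    sumUp n (λ j → Usum w₂ (λ k → cvTerm j k k) n) ≈⟨ sumUp-cong′ n (λ j → Usum-w₂-cvTerm j n) ⟩
    sumUp n (λ j → cj j ⊗ Mod n) ≈⟨ sumUp-cong′ n (λ j → ⊗comm _ _) ⟩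
    sumUp n (λ j → Mod n ⊗ cj j) ≈⟨ sumUp-* n _ _ ⟩
    Mod n ⊗ sumUp n cj ≈⟨ ⊗comm _ _ ⟩
    sumUp n cj ⊗ Mod n ∎)
    where
    cj : ℕ → LPoly
    cj j = Q (+ j) ⊗ (sgn j ⊗ Q (+ tri j) ⊗ qbin n j)

-- From the definitions to the ring: the summands of S₁, ..., S₄, and the
-- final reduction to divisibility.
module Translation where

  open PolyArith
  open LaurentRing
  open LaurentSolver
  open QAnalogues
  open FiniteSums
  open QBinomials
  open Divisibility
  open SimpleWeights
  open FourthWeight
  open import Data.Nat as ℕ using (ℕ; zero; suc; _≤_)
  open import Data.Nat.DivMod as ℕD using ()
  open import Data.Nat.Combinatorics using (_C_; nC1≡n; nCk+nC[k+1]≡[n+1]C[k+1])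
  open import Data.Integer as ℤ using (ℤ; +_)
  import Data.Integer.Properties as ℤP
  import Data.Nat.Properties as ℕP
  import Data.Integer.Tactic.RingSolver as ZS
  import Data.Nat.Tactic.RingSolver as NS
  open import Data.Product using (Σ; _,_; _×_)
  open import Relation.Binary.PropositionalEquality using (_≡_; refl; sym; trans; cong; cong₂)

  tr* : ∀ a b → (a *L b) ≃ a ⊗ b
  tr* a b = ≡≃ (sym (⊗≡ a b))
  tr+ : ∀ a b → (a +L b) ≃ a ⊕ b
  tr+ a b = ≡≃ (sym (⊕≡ a b))
  tr- : ∀ a b → (a -L b) ≃ a ⊖ b
  tr- a b = ≡≃ (sym (trans (⊕≡ a (⊖' b)) (cong (a +L_) (⊖≡ b))))
  tr1 : 1L ≃ 𝟙
  tr1 = ≡≃ (sym (cst≡ (+ 1)))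
  tr0 : 0L ≃ 𝟘
  tr0 = ≡≃ (sym (cst≡ (+ 0)))

  opaque
    unfolding Q qint qbin
    trQ : ∀ e → q^ e ≃ Q e
    trQ e = ≃refl
    trbr : ∀ n → [ n ]q ≃ qint n
    trbr n = ≃refl
    trcb : ∀ n k → qbinom n k ≃ qbin n k
    trcb n k = ≃refl

  trsign : ∀ k → sign k ≃ sgn k
  trsign k = ≡≃ (sym (cst≡ _))

  trpow : ∀ a b n → a ≃ b → (a ^L n) ≃ power b n
  trpow a b zero h = tr1
  trpow a b (suc n) h = ≃trans (tr* (a ^L n) a) (⊗c (trpow a b n h) h)

  trqp : ∀ a b s → a ≃ b → qpoch a s ≃ poch b s
  trqp a b zero h = tr1
  trqp a b (suc s) h = ≃trans (tr* (qpoch a s) (1L -L (a *L q^ (+ s)))) (⊗c (trqp a b s h) (≃trans (tr- 1L (a *L q^ (+ s))) (⊖c tr1 (≃trans (tr* a (q^ (+ s))) (⊗c h (trQ _))))))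

  trsum : ∀ n f g → (∀ k → f k ≃ g k) → sumTo n f ≃ sumUp n g
  trsum zero f g h = h 0
  trsum (suc n) f g h = ≃trans (tr+ (sumTo n f) (f (suc n))) (⊕c (trsum n f g h) (h (suc n)))

  trcommon : ∀ n r s k → common n r s k ≃ power (qint (2 ℕ.* k ℕ.+ 1)) (2 ℕ.* r ℕ.+ 1) ⊗ (Bin n k ⊗ pochPair s k)
  trcommon n r s k = ≃trans (tr* A (Bq *L (Poch₁ *L Poch₂))) (⊗c (trpow [ 2 ℕ.* k ℕ.+ 1 ]q _ _ (trbr _))
     (≃trans (tr* Bq (Poch₁ *L Poch₂)) (⊗c (trcb _ _) (≃trans (tr* Poch₁ Poch₂) (⊗c (trqp _ _ s (trQ _)) (trqp _ _ s (trQ _)))))))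
    where
    A : LPoly
    A = [ 2 ℕ.* k ℕ.+ 1 ]q ^L (2 ℕ.* r ℕ.+ 1)
    Bq : LPoly
    Bq = qbinom (2 ℕ.* n ℕ.+ 1) (n ℕ.∸ k)
    Poch₁ : LPoly
    Poch₁ = qpoch (q^ (ℤ.- (+ k))) s
    Poch₂ : LPoly
    Poch₂ = qpoch (q^ (+ (k ℕ.+ 1))) s

  ĝ-power : ∀ r k → Q (e₁ r k) ⊗ power (qint (2 ℕ.* k ℕ.+ 1)) (2 ℕ.* r ℕ.+ 1) ≃ ĝ k ⊗ ĝ²ʳ r k
  ĝ-power zero k = begin
    Q (e₁ 0 k) ⊗ (𝟙 ⊗ X) ≈⟨ ⊗l _ (Q-cong (cong (λ z → ℤ.- (+ z)) (ℕP.+-identityʳ k))) ⟩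
    Q (ℤ.- (+ k)) ⊗ (𝟙 ⊗ X) ≈⟨ solve 2 (λ a x → a :* (con (+ 1) :* x) := (a :* x) :* con (+ 1)) ≃refl _ _ ⟩
    ĝ k ⊗ 𝟙 ∎
    where
    X : LPoly
    X = qint (2 ℕ.* k ℕ.+ 1)
  ĝ-power (suc r) k = begin
    Q (e₁ (suc r) k) ⊗ power X (2 ℕ.* suc r ℕ.+ 1) ≈⟨ ⊗c (≃trans (Q-cong (ee r k)) (≃trans (Q-add _ _) (⊗l _ (Q-add _ _)))) (≡≃ (cong (power X) (l r))) ⟩
    (Q (e₁ r k) ⊗ Ki ⊗ Ki) ⊗ (power X (2 ℕ.* r ℕ.+ 1) ⊗ X ⊗ X)
      ≈⟨ solve 4 (λ e ki p x → (e :* ki :* ki) :* (p :* x :* x) := (e :* p) :* ((ki :* x) :* (ki :* x))) ≃refl _ _ _ _ ⟩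
    (Q (e₁ r k) ⊗ power X (2 ℕ.* r ℕ.+ 1)) ⊗ (ĝ k ⊗ ĝ k) ≈⟨ ⊗l _ (ĝ-power r k) ⟩
    (ĝ k ⊗ ĝ²ʳ r k) ⊗ (ĝ k ⊗ ĝ k) ≈⟨ ⊗assoc _ _ _ ⟩
    ĝ k ⊗ ĝ²ʳ (suc r) k ∎
    where
    X : LPoly
    X = qint (2 ℕ.* k ℕ.+ 1)
    Ki : LPoly
    Ki = Q (ℤ.- (+ k))
    l : ∀ r → 2 ℕ.* suc r ℕ.+ 1 ≡ suc (suc (2 ℕ.* r ℕ.+ 1))
    l = NS.solve-∀
    nl : ∀ r k → (2 ℕ.* suc r ℕ.+ 1) ℕ.* k ≡ ((2 ℕ.* r ℕ.+ 1) ℕ.* k ℕ.+ k) ℕ.+ k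
    nl = NS.solve-∀
    ee : ∀ r k → e₁ (suc r) k ≡ e₁ r k ℤ.+ ℤ.- (+ k) ℤ.+ ℤ.- (+ k)
    ee r k = trans (cong (λ z → ℤ.- (+ z)) (nl r k)) (trans (cong ℤ.-_ (trans (ℤP.pos-+ _ k) (cong (ℤ._+ + k) (ℤP.pos-+ _ k))))
      (ZL (+ ((2 ℕ.* r ℕ.+ 1) ℕ.* k)) (+ k)))
      where
      ZL : ∀ a b → ℤ.- (a ℤ.+ b ℤ.+ b) ≡ ℤ.- a ℤ.+ ℤ.- b ℤ.+ ℤ.- b
      ZL = ZS.solve-∀

  tri-C : ∀ k → k C 2 ≡ tri k
  tri-C zero = refl
  tri-C (suc k) = trans (sym (nCk+nC[k+1]≡[n+1]C[k+1] k 1)) (trans (cong₂ ℕ._+_ (nC1≡n k) (tri-C k)) (ℕP.+-comm k (tri k)))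

  tri-square : ∀ k → 2 ℕ.* tri k ℕ.+ k ≡ k ℕ.* k
  tri-square zero = refl
  tri-square (suc k) = trans (l1 (tri k) k) (trans (cong (λ z → z ℕ.+ (2 ℕ.* k ℕ.+ 1)) (tri-square k)) (l2 k))
    where
    l1 : ∀ t k → 2 ℕ.* (t ℕ.+ k) ℕ.+ suc k ≡ (2 ℕ.* t ℕ.+ k) ℕ.+ (2 ℕ.* k ℕ.+ 1)
    l1 = NS.solve-∀
    l2 : ∀ k → k ℕ.* k ℕ.+ (2 ℕ.* k ℕ.+ 1) ≡ suc k ℕ.* suc k
    l2 = NS.solve-∀

  e₄-exponent : ∀ k → (3 ℕ.* k ℕ.* k ℕ.+ k) ℕD./ 2 ≡ tri k ℕ.+ k ℕ.* k ℕ.+ k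
  e₄-exponent k = trans (cong (ℕD._/ 2) e) (ℕD.m*n/n≡m (tri k ℕ.+ k ℕ.* k ℕ.+ k) 2)
    where
    l1 : ∀ t k → (t ℕ.+ k ℕ.* k ℕ.+ k) ℕ.* 2 ≡ (2 ℕ.* t ℕ.+ k) ℕ.+ (2 ℕ.* (k ℕ.* k) ℕ.+ k)
    l1 = NS.solve-∀
    l2 : ∀ k → k ℕ.* k ℕ.+ (2 ℕ.* (k ℕ.* k) ℕ.+ k) ≡ 3 ℕ.* k ℕ.* k ℕ.+ k
    l2 = NS.solve-∀
    e : 3 ℕ.* k ℕ.* k ℕ.+ k ≡ (tri k ℕ.+ k ℕ.* k ℕ.+ k) ℕ.* 2
    e = sym (trans (l1 (tri k) k) (trans (cong (λ z → z ℕ.+ (2 ℕ.* (k ℕ.* k) ℕ.+ k)) (tri-square k)) (l2 k)))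

  pz : ∀ r k → + ((2 ℕ.* r ℕ.+ 1) ℕ.* k) ≡ + (2 ℕ.* r ℕ.* k) ℤ.+ + k
  pz r k = trans (cong +_ (l r k)) (ℤP.pos-+ _ k)
    where
    l : ∀ r k → (2 ℕ.* r ℕ.+ 1) ℕ.* k ≡ 2 ℕ.* r ℕ.* k ℕ.+ k
    l = NS.solve-∀

  e₂-split : ∀ r k → e₂ r k ≡ + (k ℕ.* k ℕ.+ k) ℤ.+ e₁ r k
  e₂-split r k = sym (trans (cong₂ (λ a b → a ℤ.+ ℤ.- b) (ℤP.pos-+ (k ℕ.* k) k) (pz r k)) (l (+ (k ℕ.* k)) (+ k) (+ (2 ℕ.* r ℕ.* k))))
    where
    l : ∀ a b c → (a ℤ.+ b) ℤ.+ ℤ.- (c ℤ.+ b) ≡ a ℤ.- c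
    l = ZS.solve-∀

  e₃-split : ∀ r k → e₃ r k ≡ + (tri k ℕ.+ k) ℤ.+ e₁ r k
  e₃-split r k = sym (trans (cong₂ (λ a b → a ℤ.+ ℤ.- b) (ℤP.pos-+ (tri k) k) (pz r k))
    (trans (l (+ (tri k)) (+ k) (+ (2 ℕ.* r ℕ.* k))) (cong (λ z → + z ℤ.- + (2 ℕ.* r ℕ.* k)) (sym (tri-C k)))))
    where
    l : ∀ a b c → (a ℤ.+ b) ℤ.+ ℤ.- (c ℤ.+ b) ≡ a ℤ.- c
    l = ZS.solve-∀

  e₄-split : ∀ r k → e₄ r k ≡ + (tri k ℕ.+ k) ℤ.+ (+ (k ℕ.* k ℕ.+ k) ℤ.+ e₁ r k)
  e₄-split r k = sym (trans (cong₂ (λ a b → a ℤ.+ (b ℤ.+ ℤ.- c)) (ℤP.pos-+ (tri k) k) (ℤP.pos-+ (k ℕ.* k) k))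
    (trans (cong (λ b → (+ tri k ℤ.+ + k) ℤ.+ ((+ (k ℕ.* k) ℤ.+ + k) ℤ.+ ℤ.- b)) (pz r k))
    (trans (l (+ tri k) (+ k) (+ (k ℕ.* k)) (+ (2 ℕ.* r ℕ.* k)))
    (cong (λ z → z ℤ.- + (2 ℕ.* r ℕ.* k)) (sym (trans (cong +_ (e₄-exponent k)) (trans (ℤP.pos-+ _ k) (cong (ℤ._+ + k) (ℤP.pos-+ (tri k) (k ℕ.* k))))))))))
    where
    c : ℤ
    c = + ((2 ℕ.* r ℕ.+ 1) ℕ.* k)
    l : ∀ t a s b → (t ℤ.+ a) ℤ.+ ((s ℤ.+ a) ℤ.+ ℤ.- (b ℤ.+ a)) ≡ (t ℤ.+ s ℤ.+ a) ℤ.- b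
    l = ZS.solve-∀

  summand : ℕ → ℕ → ℕ → LPoly
  summand r s k = ĝ²ʳ r k ⊗ pochPair s k

  summand-core : ∀ n r s k → Q (e₁ r k) ⊗ (power (qint (2 ℕ.* k ℕ.+ 1)) (2 ℕ.* r ℕ.+ 1) ⊗ (Bin n k ⊗ pochPair s k)) ≃ ĝ k ⊗ (Bin n k ⊗ summand r s k)
  summand-core n r s k = begin
    Q (e₁ r k) ⊗ (P ⊗ (Bin n k ⊗ pochPair s k)) ≈⟨ ≃sym (⊗assoc _ _ _) ⟩
    (Q (e₁ r k) ⊗ P) ⊗ (Bin n k ⊗ pochPair s k) ≈⟨ ⊗l _ (ĝ-power r k) ⟩
    (ĝ k ⊗ ĝ²ʳ r k) ⊗ (Bin n k ⊗ pochPair s k) ≈⟨ solve 4 (λ g a b d → (g :* a) :* (b :* d) := g :* (b :* (a :* d))) ≃refl _ _ _ _ ⟩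
    ĝ k ⊗ (Bin n k ⊗ summand r s k) ∎
    where
    P : LPoly
    P = power (qint (2 ℕ.* k ℕ.+ 1)) (2 ℕ.* r ℕ.+ 1)

  e₁-summand : ∀ n r s k → (q^ (e₁ r k) *L common n r s k) ≃ ĝ k ⊗ (Bin n k ⊗ summand r s k)
  e₁-summand n r s k = ≃trans (tr* _ (common n r s k)) (≃trans (⊗c (trQ _) (trcommon n r s k)) (summand-core n r s k))

  -- Each summand of S_i is w_i k ĝ k Bin n k (ĝ²ʳ r k pochPair s k): the sign and
  -- power of q in front of it equal w_i k q^(e₁ r k).
  term₁ : ∀ n r s k → (q^ (e₁ r k) *L common n r s k) ≃ w₁ k ⊗ (ĝ k ⊗ (Bin n k ⊗ summand r s k))
  term₁ n r s k = ≃trans (e₁-summand n r s k) (≃sym (⊗idˡ _))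

  term₂ : ∀ n r s k → (q^ (e₂ r k) *L common n r s k) ≃ w₂ k ⊗ (ĝ k ⊗ (Bin n k ⊗ summand r s k))
  term₂ n r s k = begin
    (q^ (e₂ r k) *L common n r s k) ≈⟨ tr* _ (common n r s k) ⟩
    q^ (e₂ r k) ⊗ common n r s k ≈⟨ ⊗l _ (≃trans (trQ _) (≃trans (Q-cong (e₂-split r k)) (Q-add _ _))) ⟩
    (w₂ k ⊗ Q (e₁ r k)) ⊗ common n r s k ≈⟨ ⊗assoc _ _ _ ⟩
    w₂ k ⊗ (Q (e₁ r k) ⊗ common n r s k) ≈⟨ ⊗r _ (≃trans (⊗l _ (≃sym (trQ _))) (≃trans (≃sym (tr* _ (common n r s k))) (e₁-summand n r s k))) ⟩
    w₂ k ⊗ (ĝ k ⊗ (Bin n k ⊗ summand r s k)) ∎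

  term₃ : ∀ n r s k → (sign k *L (q^ (e₃ r k) *L common n r s k)) ≃ w₃ k ⊗ (ĝ k ⊗ (Bin n k ⊗ summand r s k))
  term₃ n r s k = begin
    (sign k *L (q^ (e₃ r k) *L common n r s k)) ≈⟨ ≃trans (tr* _ _) (⊗c (trsign k) (tr* _ (common n r s k))) ⟩
    sgn k ⊗ (q^ (e₃ r k) ⊗ common n r s k) ≈⟨ ⊗r _ (⊗l _ (≃trans (trQ _) (≃trans (Q-cong (e₃-split r k)) (Q-add _ _)))) ⟩
    sgn k ⊗ ((Q (+ (tri k ℕ.+ k)) ⊗ Q (e₁ r k)) ⊗ common n r s k)
      ≈⟨ solve 4 (λ s a b c → s :* ((a :* b) :* c) := (s :* a) :* (b :* c)) ≃refl _ _ _ _ ⟩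
    w₃ k ⊗ (Q (e₁ r k) ⊗ common n r s k) ≈⟨ ⊗r _ (≃trans (⊗l _ (≃sym (trQ _))) (≃trans (≃sym (tr* _ (common n r s k))) (e₁-summand n r s k))) ⟩
    w₃ k ⊗ (ĝ k ⊗ (Bin n k ⊗ summand r s k)) ∎

  term₄ : ∀ n r s k → (sign k *L (q^ (e₄ r k) *L common n r s k)) ≃ w₄ k ⊗ (ĝ k ⊗ (Bin n k ⊗ summand r s k))
  term₄ n r s k = begin
    (sign k *L (q^ (e₄ r k) *L common n r s k)) ≈⟨ ≃trans (tr* _ _) (⊗c (trsign k) (tr* _ (common n r s k))) ⟩
    sgn k ⊗ (q^ (e₄ r k) ⊗ common n r s k)
      ≈⟨ ⊗r _ (⊗l _ (≃trans (trQ _) (≃trans (Q-cong (e₄-split r k)) (≃trans (Q-add _ _) (⊗r _ (Q-add _ _)))))) ⟩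
    sgn k ⊗ ((Q (+ (tri k ℕ.+ k)) ⊗ (w₂ k ⊗ Q (e₁ r k))) ⊗ common n r s k)
      ≈⟨ solve 5 (λ s a w b c → s :* ((a :* (w :* b)) :* c) := ((s :* a) :* w) :* (b :* c)) ≃refl _ _ _ _ _ ⟩
    w₄ k ⊗ (Q (e₁ r k) ⊗ common n r s k) ≈⟨ ⊗r _ (≃trans (⊗l _ (≃sym (trQ _))) (≃trans (≃sym (tr* _ (common n r s k))) (e₁-summand n r s k))) ⟩
    w₄ k ⊗ (ĝ k ⊗ (Bin n k ⊗ summand r s k)) ∎

  ≃⇒≈L : ∀ a b → a ≃ b → a ≈L b
  ≃⇒≈L ⟨ m , p ⟩ ⟨ m' , p' ⟩ (mkL h) = get h

  tr-modulus : ∀ n → modulus n ≃ Mod n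
  tr-modulus n = ≃trans (tr* _ _) (⊗c (trbr _) (trcb _ _))

  divisible⇒mod : ∀ S n → (Σ LPoly (λ A → S ≃ A ⊗ Mod n)) → S ≡ 0L [mod modulus n ]
  divisible⇒mod S n (A , h) = A , ≃⇒≈L _ _ (≃trans (tr- S 0L) (≃trans (⊖c ≃refl tr0) (≃trans (solve 1 (λ x → x :- con (+ 0) := x) ≃refl S)
     (≃trans h (≃trans (⊗r A (≃sym (tr-modulus n))) (≃sym (tr* A (modulus n))))))))

  sum≡0-mod : ∀ n r s (w : ℕ → LPoly) (t : ℕ → LPoly) → Divisible w (λ _ → 𝟙) → (∀ k → t k ≃ w k ⊗ (ĝ k ⊗ (Bin n k ⊗ summand r s k))) →
        sumTo n t ≡ 0L [mod modulus n ]
  sum≡0-mod n r s w t G h with Divisible-ĝ²ʳ-pochPair w G r s n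
  ... | A , e = divisible⇒mod (sumTo n t) n (A , ≃trans (trsum n t _ h) e)

open SimpleWeights using (w₁; w₂; w₃; divisible-w₁; divisible-w₂; divisible-w₃)
open FourthWeight using (w₄; divisible-w₄)
open Translation using (sum≡0-mod; term₁; term₂; term₃; term₄)

-- Each S_i is a sum of the shape handled by sum≡0-mod for the weight w_i, and the
-- constant 1 is w_i-divisible.
theorem2p2 : (n r s : ℕ) → 1 ≤ n →
    (S₁ n r s ≡ 0L [mod modulus n ])
    × (S₂ n r s ≡ 0L [mod modulus n ])
    × (S₃ n r s ≡ 0L [mod modulus n ])
    × (S₄ n r s ≡ 0L [mod modulus n ])
theorem2p2 n r s _ =
    sum≡0-mod n r s w₁ _ divisible-w₁ (term₁ n r s)
  , sum≡0-mod n r s w₂ _ divisible-w₂ (term₂ n r s)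
  , sum≡0-mod n r s w₃ _ divisible-w₃ (term₃ n r s)
  , sum≡0-mod n r s w₄ _ divisible-w₄ (term₄ n r s)
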